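{- Let $q$ be an odd prime power and let $P$ be a point of the Hermitian surface $H(3,q^2)$. Then $\mathfrak{X}_P=(\mathcal{X},\{R_0,\dots,R_5\})$ is a symmetric, imprimitive association scheme, and its primitive idempotents $E_0,\dots,E_5$ can be ordered so that its first eigenmatrix $\mathcal{P}$ (defined by $A_j=\sum_i\mathcal{P}(i,j)E_i$) has rows $(1,\ (q^2-1)(q+1),\ q-1,\ (q^2-1)^2,\ (q^3-q)(q-1)^2,\ (q^3-q)(q-1))$, $(1,\ q^2-q-1,\ q-1,\ q^3-2q^2+1,\ -q(q-1)^2,\ -q(q-1))$, $(1,\ q^2-1,\ -1,\ -q^2+1,\ 0,\ 0)$, $(1,\ -q-1,\ q-1,\ -q^2+1,\ q(q-1),\ q)$, $(1,\ -q-1,\ -1,\ q+1,\ -q(q+1),\ q(q+1))$, $(1,\ -q-1,\ -1,\ q+1,\ q(q-1),\ -q(q-1))$, and its second eigenmatrix $\mathcal{Q}$ (defined by $E_j=|\mathcal{X}|^{ -1}\sum_i\mathcal{Q}(i,j)A_i$) has rows $(1,\ (q-1)(q+1)^2,\ q^3(q-1),\ q(q-1)^2(q+1),\ \tfrac12q^2(q-1)^3,\ \tfrac12q^2(q+1)(q-1)^2)$, $(1,\ q^2-q-1,\ \tfrac{q^3(q-1)}{q+1},\ -q(q-1),\ -\tfrac{q^2(q-1)^2}{2(q+1)},\ -\tfrac12q^2(q-1))$, $(1,\ (q-1)(q+1)^2,\ -q^3,\ q(q-1)^2(q+1),\ -\tfrac12q^2(q-1)^2,\ -\tfrac12q^2(q+1)(q-1))$,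 $(1,\ q^2-q-1,\ -\tfrac{q^3}{q+1},\ -q(q-1),\ \tfrac{q^2(q-1)}{2(q+1)},\ \tfrac{q^2}{2})$, $(1,\ -q-1,\ 0,\ q,\ -\tfrac{q^2}{2},\ \tfrac{q^2}{2})$, $(1,\ -q-1,\ 0,\ q,\ \tfrac12q^2(q-1),\ -\tfrac12q^2(q-1))$. Here $A_j$ is the adjacency matrix of $R_j$.
   Context: $H(3,q^2)$ is the set of points $\langle \mathbf{x}\rangle$ of $\mathrm{PG}(3,q^2)$ with $h(\mathbf{x},\mathbf{x})=0$, where $h(\mathbf{x},\mathbf{y})=x_0y_3^q-x_1y_1^q-x_2y_2^q+x_3y_0^q$. Two points $\langle\mathbf{p}\rangle,\langle\mathbf{q}\rangle$ of $H(3,q^2)$ are collinear if $h(\mathbf{p},\mathbf{q})=0$. For three distinct points $P=\langle\mathbf p\rangle,Q=\langle\mathbf q\rangle,R=\langle\mathbf r\rangle$ of $H(3,q^2)$ let $z(P,Q,R)=h(\mathbf p,\mathbf q)h(\mathbf q,\mathbf r)h(\mathbf r,\mathbf p)\,\mathrm{GF}(q)^*$, which is either $0$ or an element of the group $T=\mathrm{GF}(q^2)^*/\mathrm{GF}(q)^*$ (cyclic of order $q+1$). Let $e=\mathrm{GF}(q)^*$ be the identity of $T$, $t$ its unique involution ($t=\theta\mathrm{GF}(q)^*$ with $\theta^q=-\theta$), and $\Gamma=T\setminus\{e,t\}$. Fix a point $P$ of $H(3,q^2)$ and let $\mathcal{X}$ be the set of the $q^5$ points of $H(3,q^2)$ not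 collinear with $P$. On $\mathcal{X}$ define: $R_0$ the diagonal relation; and for distinct $Q,R\in\mathcal X$: $(Q,R)\in R_1$ iff $z(P,Q,R)=0$; $(Q,R)\in R_2$ iff $P,Q,R$ lie on a common line of $\mathrm{PG}(3,q^2)$; $(Q,R)\in R_3$ iff $z(P,Q,R)=t$; $(Q,R)\in R_4$ iff $z(P,Q,R)\in\Gamma$; $(Q,R)\in R_5$ iff $z(P,Q,R)=e$.
   Formalization: R_3 is taken as the pairs with z(P,Q,R)=t that are not in R_2: if P,Q,R lie on a common line then z(P,Q,R)=t, so as literally defined R_2 would be contained in R_3 and R_3 would have valency (q^2-1)^2+q-1 instead of the stated (q^2-1)^2. -}

module Defs where

open import Level using (0ℓ)
open import Data.Bool using (Bool; true; false; _∧_; _∨_; not; if_then_else_)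
open import Data.Nat as ℕ using (ℕ; zero; suc; _%_; _^_)
open import Data.Nat.Primality using (Prime)
open import Data.Integer as Int using (ℤ; +_)
import Data.Rational as ℚ
open ℚ using (ℚ; 0ℚ; 1ℚ)
open import Data.Fin as Fin using (Fin)
open import Data.Vec as Vec using (Vec; []; _∷_; lookup)
open import Data.List as List using (List; []; _∷_; concatMap; length)
open import Data.Bool.ListAction using (any)
open import Data.List.Membership.Propositional using (_∈_)
open import Data.List.Relation.Unary.Unique.Propositional using (Unique)
open import Data.Product using (Σ; _×_; _,_)
open import Function using (_∘_)
open import Relation.Nullary using (¬_; does)
open import Relation.Nullary.Decidable using (⌊_⌋)
open import Relation.Binary.PropositionalEquality using (_≡_; _≢_)
open import Relation.Binary.Definitions using (DecidableEquality)
open import Relation.Binary.Construct.Closure.ReflexiveTransitive using (Star)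
open import Algebra.Structures using (IsCommutativeRing)

filterB : ∀ {A : Set} → (A → Bool) → List A → List A
filterB f [] = []
filterB f (x ∷ xs) = if f x then x ∷ filterB f xs else filterB f xs

IsPrimePower : ℕ → Set
IsPrimePower q = Σ ℕ λ p → Σ ℕ λ k → Prime p × q ≡ p ^ suc k

record FiniteField : Set₁ where
  infixl 6 _+_
  infixl 7 _*_
  infix 8 -_
  field
    Carrier   : Set
    _+_ _*_   : Carrier → Carrier → Carrier
    -_        : Carrier → Carrier
    0# 1#     : Carrier
    isCommutativeRing : IsCommutativeRing _≡_ _+_ _*_ -_ 0# 1#
    0≢1       : 0# ≢ 1#
    inverse   : ∀ x → x ≢ 0# → Σ Carrier λ y → x * y ≡ 1#
    _≟_       : DecidableEquality Carrier
    elements  : List Carrier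
    elements-unique   : Unique elements
    elements-complete : ∀ x → x ∈ elements

  size : ℕ
  size = length elements

-- Geometry of H(3,q²) over a field F of order q², with q given.

module Hermitian (F : FiniteField) (q : ℕ) where
  open FiniteField F

  infix 4 _==_
  _==_ : Carrier → Carrier → Bool
  x == y = does (x ≟ y)

  pow : Carrier → ℕ → Carrier
  pow x zero = 1#
  pow x (suc n) = x * pow x n

  conj : Carrier → Carrier
  conj x = pow x q

  record V4 : Set where
    constructor v4
    field x0 x1 x2 x3 : Carrier
  open V4

  zeroV : V4
  zeroV = v4 0# 0# 0# 0#

  h : V4 → V4 → Carrier
  h x y = x0 x * conj (x3 y) + - (x1 x * conj (x1 y)) + - (x2 x * conj (x2 y))
          + x3 x * conj (x0 y)

  _·V_ : Carrier → V4 → V4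
  a ·V v = v4 (a * x0 v) (a * x1 v) (a * x2 v) (a * x3 v)

  _+V_ : V4 → V4 → V4
  u +V v = v4 (x0 u + x0 v) (x1 u + x1 v) (x2 u + x2 v) (x3 u + x3 v)

  isZeroV : V4 → Bool
  isZeroV v = (x0 v == 0#) ∧ (x1 v == 0#) ∧ (x2 v == 0#) ∧ (x3 v == 0#)

  allV : List V4
  allV = concatMap (λ a → concatMap (λ b → concatMap (λ c → List.map (λ d → v4 a b c d)
           elements) elements) elements) elements

  -- canonical representative of a projective point: first nonzero coordinate is 1
  normalized : V4 → Bool
  normalized v =
    if not (x0 v == 0#) then x0 v == 1# else
    if not (x1 v == 0#) then x1 v == 1# else
    if not (x2 v == 0#) then x2 v == 1# else
    if not (x3 v == 0#) then x3 v == 1# else false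

  hermPoints : List V4
  hermPoints = filterB (λ v → normalized v ∧ (h v v == 0#)) allV

  -- 𝒳 : points of H(3,q²) not collinear with P = ⟨p⟩
  𝒳 : V4 → List V4
  𝒳 p = filterB (λ v → not (h p v == 0#)) hermPoints

  -- three vectors span at most a line of PG(3,q²): they are linearly dependent
  onCommonLine : V4 → V4 → V4 → Bool
  onCommonLine u v w =
    any (λ a → any (λ b → any (λ c →
      not ((a == 0#) ∧ (b == 0#) ∧ (c == 0#)) ∧
      isZeroV (((a ·V u) +V (b ·V v)) +V (c ·V w))) elements) elements) elements

  -- membership of w in the cosets e = GF(q)* and t = θ GF(q)* of T
  inGFq* : Carrier → Bool
  inGFq* c = not (c == 0#) ∧ (conj c == c)

  isE : Carrier → Bool
  isE w = inGFq* w

  isT : Carrier → Bool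
  isT w = any (λ θ → any (λ c →
            not (θ == 0#) ∧ (conj θ == - θ) ∧ inGFq* c ∧ (w == θ * c)) elements) elements

  isΓ : Carrier → Bool
  isΓ w = not (w == 0#) ∧ not (isE w) ∧ not (isT w)

  -- representative of z(P,Q,R)
  zval : V4 → V4 → V4 → Carrier
  zval p u v = h p u * h u v * h v p

  N : V4 → ℕ
  N p = length (𝒳 p)

  pt : (p : V4) → Fin (N p) → V4
  pt p i = List.lookup (𝒳 p) i

  Rel : (p : V4) → Fin 6 → Fin (N p) → Fin (N p) → Bool
  Rel p j x y = rel j
    where
      Q R : V4
      Q = pt p x
      R = pt p y
      w = zval p Q R
      dist = not (does (x Fin.≟ y))
      rel : Fin 6 → Bool
      rel Fin.zero = does (x Fin.≟ y)
      rel (Fin.suc Fin.zero) = dist ∧ (w == 0#)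
      rel (Fin.suc (Fin.suc Fin.zero)) = dist ∧ onCommonLine p Q R
      rel (Fin.suc (Fin.suc (Fin.suc Fin.zero))) = dist ∧ isT w ∧ not (onCommonLine p Q R)
      rel (Fin.suc (Fin.suc (Fin.suc (Fin.suc Fin.zero)))) = dist ∧ isΓ w
      rel (Fin.suc (Fin.suc (Fin.suc (Fin.suc (Fin.suc Fin.zero))))) = dist ∧ isE w

countF : ∀ {n} → (Fin n → Bool) → ℕ
countF {zero} f = 0
countF {suc n} f = (if f Fin.zero then 1 else 0) ℕ.+ countF (f ∘ Fin.suc)

∑ : ∀ {n} → (Fin n → ℚ) → ℚ
∑ {zero} f = 0ℚ
∑ {suc n} f = f Fin.zero ℚ.+ ∑ (f ∘ Fin.suc)

Mat : ℕ → Set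
Mat n = Fin n → Fin n → ℚ

_·M_ : ∀ {n} → Mat n → Mat n → Mat n
(M ·M M') x y = ∑ (λ z → M x z ℚ.* M' z y)

idM : ∀ {n} → Mat n
idM x y = if does (x Fin.≟ y) then 1ℚ else 0ℚ

adj : ∀ {n} → (Fin n → Fin n → Bool) → Mat n
adj R x y = if R x y then 1ℚ else 0ℚ

record IsSymmetricScheme (N d : ℕ) (R : Fin (suc d) → Fin N → Fin N → Bool) : Set where
  field
    diagonal     : ∀ x y → R Fin.zero x y ≡ does (x Fin.≟ y)
    partition    : ∀ x y → Σ (Fin (suc d)) λ i → R i x y ≡ true × (∀ j → R j x y ≡ true → j ≡ i)
    nonempty     : ∀ i → Σ (Fin N) λ x → Σ (Fin N) λ y → R i x y ≡ true
    symmetric    : ∀ i x y → R i x y ≡ R i y x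
    intersection : ∀ i j k → Σ ℕ λ p → ∀ x y → R k x y ≡ true →
                     countF (λ z → R i x z ∧ R j z y) ≡ p

IsImprimitive : (N d : ℕ) (R : Fin (suc d) → Fin N → Fin N → Bool) → Set
IsImprimitive N d R = Σ (Fin (suc d)) λ i → i ≢ Fin.zero ×
  Σ (Fin N) λ x → Σ (Fin N) λ y → ¬ Star (λ a b → R i a b ≡ true) x y

record ArePrimitiveIdempotents (N d : ℕ) (A E : Fin (suc d) → Mat N) : Set where
  field
    inBM      : ∀ j → Σ (Fin (suc d) → ℚ) λ c → ∀ x y → E j x y ≡ ∑ (λ i → c i ℚ.* A i x y)
    orthIdem  : ∀ i j x y → (E i ·M E j) x y ≡ (if does (i Fin.≟ j) then E i x y else 0ℚ)
    nonzero   : ∀ i → Σ (Fin N) λ x → Σ (Fin N) λ y → E i x y ≢ 0ℚ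
    sumId     : ∀ x y → ∑ (λ i → E i x y) ≡ idM x y

module Eigen (q : ℕ) where
  open Int using (_-_; _*_; -_) renaming (_+_ to _⊕_)
  Q : ℤ
  Q = + q
  ι : ℤ → ℚ
  ι z = z ℚ./ 1
  i1 : ℤ
  i1 = + 1

  Pmat : Fin 6 → Fin 6 → ℚ
  Pmat i j = lookup (lookup rows i) j
    where
    rows : Vec (Vec ℚ 6) 6
    rows =
      (ι i1 ∷ ι ((Q * Q - i1) * (Q ⊕ i1)) ∷ ι (Q - i1) ∷ ι ((Q * Q - i1) * (Q * Q - i1))
        ∷ ι ((Q * Q * Q - Q) * (Q - i1) * (Q - i1)) ∷ ι ((Q * Q * Q - Q) * (Q - i1)) ∷ []) ∷
      (ι i1 ∷ ι (Q * Q - Q - i1) ∷ ι (Q - i1) ∷ ι (Q * Q * Q - + 2 * Q * Q ⊕ i1)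
        ∷ ι (- (Q * (Q - i1) * (Q - i1))) ∷ ι (- (Q * (Q - i1))) ∷ []) ∷
      (ι i1 ∷ ι (Q * Q - i1) ∷ ι (- i1) ∷ ι (- (Q * Q) ⊕ i1) ∷ ι (+ 0) ∷ ι (+ 0) ∷ []) ∷
      (ι i1 ∷ ι (- Q - i1) ∷ ι (Q - i1) ∷ ι (- (Q * Q) ⊕ i1) ∷ ι (Q * (Q - i1)) ∷ ι Q ∷ []) ∷
      (ι i1 ∷ ι (- Q - i1) ∷ ι (- i1) ∷ ι (Q ⊕ i1) ∷ ι (- (Q * (Q ⊕ i1))) ∷ ι (Q * (Q ⊕ i1)) ∷ []) ∷
      (ι i1 ∷ ι (- Q - i1) ∷ ι (- i1) ∷ ι (Q ⊕ i1) ∷ ι (Q * (Q - i1)) ∷ ι (- (Q * (Q - i1))) ∷ []) ∷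
      []

  Qmat : Fin 6 → Fin 6 → ℚ
  Qmat i j = lookup (lookup rows i) j
    where
    -- 2(q+1) written as suc (suc (q + q))
    rows : Vec (Vec ℚ 6) 6
    rows =
      (ι i1 ∷ ι ((Q - i1) * (Q ⊕ i1) * (Q ⊕ i1)) ∷ ι (Q * Q * Q * (Q - i1))
        ∷ ι (Q * (Q - i1) * (Q - i1) * (Q ⊕ i1))
        ∷ (Q * Q * (Q - i1) * (Q - i1) * (Q - i1)) ℚ./ 2
        ∷ (Q * Q * (Q ⊕ i1) * (Q - i1) * (Q - i1)) ℚ./ 2 ∷ []) ∷
      (ι i1 ∷ ι (Q * Q - Q - i1) ∷ (Q * Q * Q * (Q - i1)) ℚ./ suc q ∷ ι (- (Q * (Q - i1)))
        ∷ (- (Q * Q * (Q - i1) * (Q - i1))) ℚ./ suc (suc (q ℕ.+ q))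
        ∷ (- (Q * Q * (Q - i1))) ℚ./ 2 ∷ []) ∷
      (ι i1 ∷ ι ((Q - i1) * (Q ⊕ i1) * (Q ⊕ i1)) ∷ ι (- (Q * Q * Q))
        ∷ ι (Q * (Q - i1) * (Q - i1) * (Q ⊕ i1))
        ∷ (- (Q * Q * (Q - i1) * (Q - i1))) ℚ./ 2
        ∷ (- (Q * Q * (Q ⊕ i1) * (Q - i1))) ℚ./ 2 ∷ []) ∷
      (ι i1 ∷ ι (Q * Q - Q - i1) ∷ (- (Q * Q * Q)) ℚ./ suc q ∷ ι (- (Q * (Q - i1)))
        ∷ (Q * Q * (Q - i1)) ℚ./ suc (suc (q ℕ.+ q))
        ∷ (Q * Q) ℚ./ 2 ∷ []) ∷
      (ι i1 ∷ ι (- Q - i1) ∷ ι (+ 0) ∷ ι Q ∷ (- (Q * Q)) ℚ./ 2 ∷ (Q * Q) ℚ./ 2 ∷ []) ∷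
      (ι i1 ∷ ι (- Q - i1) ∷ ι (+ 0) ∷ ι Q
        ∷ (Q * Q * (Q - i1)) ℚ./ 2 ∷ (- (Q * Q * (Q - i1))) ℚ./ 2 ∷ []) ∷
      []

module _ (F : FiniteField) (q : ℕ) where
  open Hermitian F q using (V4; N; Rel)

  SchemeEigenConclusion : V4 → Set
  SchemeEigenConclusion p =
    IsSymmetricScheme (N p) 5 (Rel p) × IsImprimitive (N p) 5 (Rel p) ×
    Σ (Fin 6 → Mat (N p)) λ E → ArePrimitiveIdempotents (N p) 5 A E ×
      (∀ j x y → A j x y ≡ ∑ (λ i → Eigen.Pmat q i j ℚ.* E i x y)) ×
      (∀ j x y → ((+ N p) ℚ./ 1) ℚ.* E j x y ≡ ∑ (λ i → Eigen.Qmat q i j ℚ.* A i x y))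
    where
      A : Fin 6 → Mat (N p)
      A j = adj (Rel p j)

{-# OPTIONS --safe #-}
-- Rescale every x ∈ 𝒳 to x̂ with h(x̂,p) = 1 and put H(x,y) = h(x̂,ŷ); up to a factor in GF(q)* this is
-- z(P,x,y).  Besides I and the all-ones matrix J let K, M, L, D be the 0/1 matrices of "x = y or
-- x, y, P collinear in PG(3,q²)", "H fixed by conjugation", "H skew under conjugation" and "H = 0".
-- These six matrices have the same span as A_0, …, A_5, and coordinates in a hyperbolic frame
-- (p, x̂, f, g) reduce their products to six counts in GF(q²):
--   K K = q K,  K M = J,  K D = L,  M M = q⁴ I + q³ (J - K),
--   D M = q³ I - q² K + (q² + q) J - q M - q L + q² D,
--   D D = q³ I - q K + (q + 1) J - L + (q² - q) D.
-- All other products follow by associativity and transposition (in particular |𝒳| = q⁵, from J J).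
-- Hence K, M, D act as scalars on explicit combinations E_0, …, E_5 of the six matrices, and the
-- eigenmatrices, the orthogonality relations and the intersection numbers are read off from there.
module Submission where

open import Defs
open import Level using (0ℓ)
open import Algebra.Bundles using (CommutativeRing; CommutativeMonoid; RawRing)
import Algebra.Properties.AbelianGroup
import Algebra.Properties.CommutativeMonoid.Sum
import Algebra.Properties.CommutativeSemiring.Binomial
import Algebra.Properties.CommutativeSemiring.Exp
import Algebra.Properties.Ring
import Algebra.Properties.Semiring.Exp
import Algebra.Properties.Semiring.Mult
import Algebra.Properties.Semiring.Sum
import Algebra.Solver.Ring
import Algebra.Solver.Ring.AlmostCommutativeRing as ACR
open import Data.Bool using (Bool; true; false; if_then_else_; not; _∧_)
open import Data.Bool.ListAction using (any)
open import Data.Empty using (⊥-elim)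
open import Data.Fin as Fin using (Fin; zero; suc)
open import Data.Fin.Patterns
import Data.Fin.Permutation as Perm
import Data.Fin.Properties as Finₚ
open import Data.Integer as Int using (ℤ; -[1+_])
import Data.Integer.Properties as ℤₚ
open import Data.List as List using (List; []; _∷_; concatMap)
open import Data.List.Membership.Propositional using (_∈_; find; lose)
open import Data.List.Membership.Propositional.Properties
  using (∈-lookup; ∈-concatMap⁺; ∈-concatMap⁻; ∈-map⁺; ∈-map⁻)
import Data.List.Relation.Unary.All as All
open import Data.List.Relation.Unary.AllPairs using ([]; _∷_)
open import Data.List.Relation.Unary.Any using (here; there; index)
open import Data.List.Relation.Unary.Any.Properties using (lookup-index)
open import Data.List.Relation.Unary.Unique.Propositional using (Unique)
import Data.List.Relation.Unary.Unique.Propositional.Properties as Uniqueₚ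
import Data.Maybe
open import Data.Nat as ℕ using (ℕ; zero; suc; _!; _%_)
import Data.Nat.Combinatorics as Comb
open import Data.Nat.Divisibility as ∣ using (_∣_; _∤_; divides)
import Data.Nat.DivMod as DivMod
open import Data.Nat.Primality using (Prime; euclidsLemma; prime⇒nonTrivial)
import Data.Nat.Properties as ℕₚ
import Data.Nat.Solver
open import Data.Product using (Σ; _×_; _,_; proj₁; proj₂)
import Data.Rational as Rat
open Rat using (ℚ; 0ℚ; 1ℚ)
import Data.Rational.Properties as ℚₚ
import Data.Rational.Solver
import Data.Rational.Unnormalised as ℚᵘ
import Data.Rational.Unnormalised.Properties as ℚᵘₚ
open import Data.Sum using (inj₁; inj₂)
open import Data.Vec as Vec using (Vec; lookup; []; _∷_)
open import Data.Vec.Properties using (lookup-map)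
open import Function using (_∘_; id; mk⇔)
open import Relation.Binary.Construct.Closure.ReflexiveTransitive using (Star; _◅_)
open import Relation.Binary.PropositionalEquality hiding ([_]; J)
open import Relation.Nullary using (¬_; does; yes; no; Dec; ¬?)
open import Relation.Nullary.Decidable
  using (dec-true; dec-false; dec⇒maybe; decidable-stable; does-⇔; _×-dec_)
open import Tactic.RingSolver using (solve-∀)
open import Tactic.RingSolver.Core.AlmostCommutativeRing using (AlmostCommutativeRing; fromCommutativeRing)

-- The product rules force the six joint eigenvalues (k, m, d) of `K`, `M`, `D`. `K K = q K` leaves
-- k = q or k = 0. On the constants the scalars are the row sums; elsewhere `J` acts as 0. For k =
-- q, `K M = J` then gives m = 0, and `L = K D` turns `D D` into d² = (q² - 2q) d + q³ - q², with
-- roots q² - q and -q. For k = 0 also `L` acts as 0, so `M M` gives m = q² or -q², `D D` gives d =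
-- q² or -q, and `D M` becomes (d + q)(m - q²) = 0, which excludes m = -q² with d = q². These are
-- six triples in all, one for each idempotent. Oddness of q enters through the unique splitting of
-- a field element into a fixed and a skew part: 0 is the only element that is both, and
-- transposition, which conjugates H, preserves all three tests. An element of norm -1 supplies the
-- second hyperbolic pair of the frame. In the frame at x the points z correspond to triples of
-- field elements and H(z,y) is affine in them; keeping degenerate cases as indicator terms yields
-- one formula for every position of y.

module ℚSolver = Data.Rational.Solver.+-*-Solver

ℚ-ring : AlmostCommutativeRing _ _
ℚ-ring = fromCommutativeRing ℚₚ.+-*-commutativeRing (λ x → dec⇒maybe (0ℚ ℚₚ.≟ x))

-- Finite sums and matrix products over ℚ.

module Summation where
  open CommutativeRing ℚₚ.+-*-commutativeRing using (semiring)
  open module S = Algebra.Properties.Semiring.Sum semiring using (sum)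
  open Rat using (_+_; _*_; -_)

  ∑≡sum : ∀ n (f : Fin n → ℚ) → ∑ f ≡ sum f
  ∑≡sum zero f = refl
  ∑≡sum (suc n) f = cong (f zero +_) (∑≡sum n (f ∘ suc))

  ∑-0 : ∀ n → ∑ {n} (λ _ → 0ℚ) ≡ 0ℚ
  ∑-0 zero = refl
  ∑-0 (suc n) = trans (ℚₚ.+-identityˡ _) (∑-0 n)

  ∑-cong : ∀ {n} {f g : Fin n → ℚ} → (∀ i → f i ≡ g i) → ∑ f ≡ ∑ g
  ∑-cong {zero} e = refl
  ∑-cong {suc n} e = cong₂ _+_ (e zero) (∑-cong (e ∘ suc))

  ∑-zero : ∀ {n} {f : Fin n → ℚ} → (∀ i → f i ≡ 0ℚ) → ∑ f ≡ 0ℚ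
  ∑-zero {n} e = trans (∑-cong e) (∑-0 n)

  ∑-single : ∀ {n} (f : Fin n → ℚ) i → (∀ j → j ≢ i → f j ≡ 0ℚ) → ∑ f ≡ f i
  ∑-single f zero e =
    trans (cong (f zero +_) (∑-zero {f = f ∘ suc} (λ j → e (suc j) (λ ())))) (ℚₚ.+-identityʳ _)
  ∑-single f (suc i) e =
    trans (cong (_+ ∑ (f ∘ suc)) (e zero (λ ())))
      (trans (ℚₚ.+-identityˡ _)
        (∑-single (f ∘ suc) i (λ j j≢i → e (suc j) (j≢i ∘ Finₚ.suc-injective))))

  ∑-swap : ∀ m n (f : Fin m → Fin n → ℚ) →
           ∑ (λ i → ∑ (λ j → f i j)) ≡ ∑ (λ j → ∑ (λ i → f i j))
  ∑-swap m n f = trans (double m n f) (trans (S.∑-comm f) (sym (double n m (λ j i → f i j))))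
    where
    double : ∀ m n (f : Fin m → Fin n → ℚ) → ∑ (λ i → ∑ (f i)) ≡ sum (λ i → sum (f i))
    double m n f = trans (∑-cong (λ i → ∑≡sum n (f i))) (∑≡sum m (λ i → sum (f i)))

  module Size (n : ℕ) where

    ∑-+ : (f g : Fin n → ℚ) → ∑ (λ i → f i + g i) ≡ ∑ f + ∑ g
    ∑-+ f g = trans (∑≡sum n _) (trans (S.∑-distrib-+ f g) (sym (cong₂ _+_ (∑≡sum n f) (∑≡sum n g))))

    ∑-*ˡ : ∀ c (f : Fin n → ℚ) → ∑ (λ i → c * f i) ≡ c * ∑ f
    ∑-*ˡ c f = trans (∑≡sum n _) (sym (trans (cong (c *_) (∑≡sum n f)) (S.*-distribˡ-sum c f)))

    ∑-*ʳ : ∀ c (f : Fin n → ℚ) → ∑ (λ i → f i * c) ≡ ∑ f * c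
    ∑-*ʳ c f = trans (∑≡sum n _) (sym (trans (cong (_* c) (∑≡sum n f)) (S.*-distribʳ-sum c f)))

    ·M-congˡ : (A : Mat n) {B B' : Mat n} → (∀ x y → B x y ≡ B' x y) →
               ∀ x y → (A ·M B) x y ≡ (A ·M B') x y
    ·M-congˡ A e x y = ∑-cong (λ z → cong (A x z *_) (e z y))

    ·M-congʳ : (B : Mat n) {A A' : Mat n} → (∀ x y → A x y ≡ A' x y) →
               ∀ x y → (A ·M B) x y ≡ (A' ·M B) x y
    ·M-congʳ B e x y = ∑-cong (λ z → cong (_* B z y) (e x z))

    ·M-assoc : (A B C : Mat n) → ∀ x y → ((A ·M B) ·M C) x y ≡ (A ·M (B ·M C)) x y
    ·M-assoc A B C x y = begin
      ∑ (λ z → ∑ (λ w → A x w * B w z) * C z y)   ≡⟨ ∑-cong (λ z → sym (∑-*ʳ (C z y) _)) ⟩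
      ∑ (λ z → ∑ (λ w → A x w * B w z * C z y))   ≡⟨ ∑-swap n n _ ⟩
      ∑ (λ w → ∑ (λ z → A x w * B w z * C z y))
        ≡⟨ ∑-cong (λ w → trans (∑-cong (λ z → ℚₚ.*-assoc (A x w) (B w z) (C z y))) (∑-*ˡ (A x w) _)) ⟩
      ∑ (λ w → A x w * ∑ (λ z → B w z * C z y))   ∎
      where open ≡-Reasoning

    ·M-transpose : {A B : Mat n} → (∀ x y → A x y ≡ A y x) → (∀ x y → B x y ≡ B y x) →
                   ∀ x y → (A ·M B) x y ≡ (B ·M A) y x
    ·M-transpose {A} {B} sA sB x y =
      ∑-cong (λ z → trans (ℚₚ.*-comm (A x z) (B z y)) (cong₂ _*_ (sB z y) (sA x z)))

    ·M-scaleˡ : ∀ c (A B : Mat n) x y → ((λ u v → c * A u v) ·M B) x y ≡ c * (A ·M B) x y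
    ·M-scaleˡ c A B x y =
      trans (∑-cong (λ z → ℚₚ.*-assoc c (A x z) (B z y))) (∑-*ˡ c _)

    ·M-scaleʳ : ∀ c (A B : Mat n) x y → (A ·M (λ u v → c * B u v)) x y ≡ c * (A ·M B) x y
    ·M-scaleʳ c A B x y =
      trans (∑-cong (λ z → swap (A x z) c (B z y))) (∑-*ˡ c _)
      where
      swap : ∀ u a f → u * (a * f) ≡ a * (u * f)
      swap = solve-∀ ℚ-ring

    idM-refl : (x : Fin n) → idM x x ≡ 1ℚ
    idM-refl x with x Fin.≟ x
    ... | yes _ = refl
    ... | no ¬p with () ← ¬p refl

    idM-≢ : {x y : Fin n} → x ≢ y → idM x y ≡ 0ℚ
    idM-≢ {x} {y} x≢y with x Fin.≟ y
    ... | yes p with () ← x≢y p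
    ... | no _ = refl

    idM-sym : (x y : Fin n) → idM x y ≡ idM y x
    idM-sym x y with x Fin.≟ y
    ... | yes refl = sym (idM-refl x)
    ... | no x≢y = sym (idM-≢ (x≢y ∘ sym))

    ·M-idM : (A : Mat n) → ∀ x y → (A ·M idM) x y ≡ A x y
    ·M-idM A x y = trans (∑-single (λ z → A x z * idM z y) y λ j j≢y →
        trans (cong (A x j *_) (idM-≢ j≢y)) (ℚₚ.*-zeroʳ (A x j)))
      (trans (cong (A x y *_) (idM-refl y)) (ℚₚ.*-identityʳ _))

-- Coefficient tables and eigenvalues of the six-dimensional algebra.

by-six : {P : Fin 6 → Set} → P 0F → P 1F → P 2F → P 3F → P 4F → P 5F → ∀ i → P i
by-six a b c d e f 0F = a
by-six a b c d e f 1F = b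
by-six a b c d e f 2F = c
by-six a b c d e f 3F = d
by-six a b c d e f 4F = e
by-six a b c d e f 5F = f

-- Used in two dual roles: coefficients of a combination of `I`, `K`, `J`, `M`, `L`, `D`, and the
-- values of these six matrices at one place or on one eigenspace. `dot` pairs the two.
record Lin (A : Set) : Set where
  constructor ⟨_,_,_,_,_,_⟩
  field cI cK cJ cM cL cD : A

-- The same formulas serve over ℚ and over the solver's polynomial expressions.
module Formulas (R : RawRing 0ℓ 0ℓ) (q : RawRing.Carrier R) where
  open RawRing R renaming (Carrier to A)

  infixl 6 _-_
  _-_ : A → A → A
  x - y = x + - y

  2# s n : A
  2# = 1# + 1#
  s = q + 1#
  n = 2# * q * q * q * q * q * s

  -- n E_i for the i-th primitive idempotent E_i; n clears all denominators.
  G : Fin 6 → Lin A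
  G 0F = ⟨ 0# , 0# , 2# * s , 0# , 0# , 0# ⟩
  G 1F = ⟨ 0# , 2# * q * q * q * s , - (2# * s * s) , 0# , 2# * q * q * s , 0# ⟩
  G 2F = ⟨ 2# * q * q * q * q * q , - (2# * q * q * q * q) , 0# , 0# , - (2# * q * q * q) ,
           2# * q * q * q * q ⟩
  G 3F = ⟨ 0# , 2# * q * q * q * s * (q - 1#) , 2# * s * q , 0# , - (2# * q * q * s) , 0# ⟩
  G 4F = ⟨ q * q * q * q * q * (q - 1#) , - (q * q * q * q * (q - 1#)) , - (q * q * s) ,
           q * q * q * s , 2# * q * q * q , - (2# * q * q * q * q) ⟩
  G 5F = ⟨ q * q * q * q * q * s , - (q * q * q * q * s) , q * q * s , - (q * q * q * s) , 0# , 0# ⟩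

  -- Eigenvalues of K, M and D on the image of E_i.
  κ μ δ : Fin 6 → A
  κ = lookup (q ∷ q ∷ 0# ∷ q ∷ 0# ∷ 0# ∷ [])
  μ = lookup (q * q * q * q ∷ 0# ∷ q * q ∷ 0# ∷ q * q ∷ - (q * q) ∷ [])
  δ = lookup (q * q * q + q * q - q ∷ q * q - q ∷ q * q ∷ - q ∷ - q ∷ - q ∷ [])

  dot : Lin A → Lin A → A
  dot ⟨ a , b , c , d , e , f ⟩ ⟨ i , k , j , m , l , g ⟩ =
    a * i + (b * k + (c * j + (d * m + (e * l + f * g))))

  -- Since `J = K M` and `L = K D`, the scalars of `K`, `M`, `D` on the image of E_i determine those
  -- of all six matrices. Thus `dot c (χ i)` is the scalar by which the combination `c` acts there.
  χ : Fin 6 → Lin A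
  χ i = ⟨ 1# , κ i , κ i * μ i , μ i , κ i * δ i , δ i ⟩

  -- A_j in terms of (I , K , J , M , L , D).
  adjacency : Fin 6 → Lin A
  adjacency 0F = ⟨ 1# , 0# , 0# , 0# , 0# , 0# ⟩
  adjacency 1F = ⟨ - 1# , 0# , 0# , 0# , 0# , 1# ⟩
  adjacency 2F = ⟨ - 1# , 1# , 0# , 0# , 0# , 0# ⟩
  adjacency 3F = ⟨ 1# , - 1# , 0# , 0# , 1# , - 1# ⟩
  adjacency 4F = ⟨ 0# , 0# , 1# , - 1# , - 1# , 1# ⟩
  adjacency 5F = ⟨ 0# , 0# , 0# , 1# , 0# , - 1# ⟩

  -- Values of (I , K , J , M , L , D) on the relation R_j.
  relationEntries : Fin 6 → Lin A
  relationEntries 0F = ⟨ 1# , 1# , 1# , 1# , 1# , 1# ⟩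
  relationEntries 1F = ⟨ 0# , 0# , 1# , 1# , 1# , 1# ⟩
  relationEntries 2F = ⟨ 0# , 1# , 1# , 0# , 1# , 0# ⟩
  relationEntries 3F = ⟨ 0# , 0# , 1# , 0# , 1# , 0# ⟩
  relationEntries 4F = ⟨ 0# , 0# , 1# , 0# , 0# , 0# ⟩
  relationEntries 5F = ⟨ 0# , 0# , 1# , 1# , 0# , 0# ⟩

  -- The trailing zero reproduces the unfolding of `∑` over `Fin 6`, so identities proved for `sum₆`
  -- are identities about `∑` by reduction.
  sum₆ : (Fin 6 → A) → A
  sum₆ f = f 0F + (f 1F + (f 2F + (f 3F + (f 4F + (f 5F + 0#)))))

  mm md dd : Lin A
  mm = ⟨ q * q * q * q , - (q * q * q) , q * q * q , 0# , 0# , 0# ⟩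
  md = ⟨ q * q * q , - (q * q) , q * q + q , - q , - q , q * q ⟩
  dd = ⟨ q * q * q , - q , q + 1# , 0# , - 1# , q * q - q ⟩

  -- The row sum of `D`: one more than the valency of R_1, because `D` also counts the diagonal. The
  -- same constant fills `M L = (M D) K`.
  kDegree : A
  kDegree = q * q * q + q * q - q

  -- Entries of the products of K, M, D with (I , K , J , M , L , D), at a place where
  -- the entries of the six matrices are v.
  K· M· D· : Lin A → Lin A
  K· ⟨ i , k , j , m , l , d ⟩ = ⟨ k , q * k , q , 1# , q * l , l ⟩
  M· v@(⟨ i , k , j , m , l , d ⟩) = ⟨ m , 1# , q * q * q * q , dot mm v , kDegree , dot md v ⟩
  D· v@(⟨ i , k , j , m , l , d ⟩) =
    ⟨ d , l , kDegree , dot md v , (q * q * q - q * q) * k + (q * q + q + (q * q - q - q) * l) , dot dd v ⟩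

polynomialRing : ℕ → RawRing 0ℓ 0ℓ
polynomialRing k = record
  { Carrier = ℚSolver.Polynomial k ; _≈_ = _≡_ ; _+_ = ℚSolver._:+_ ; _*_ = ℚSolver._:*_ ; -_ = ℚSolver.:-_
  ; 0# = ℚSolver.con 0ℚ ; 1# = ℚSolver.con 1ℚ }

module ℚForm = Formulas Rat.+-*-rawRing
module PForm {k : ℕ} = Formulas (polynomialRing k)

module EigenEquations (q i k m l d : ℚSolver.Polynomial 6) where
  open ℚSolver using (Polynomial; _:=_; _:*_; con)
  open PForm q
  entries : Lin (Polynomial 6)
  entries = ⟨ i , k , con 1ℚ , m , l , d ⟩

  K-eq M-eq D-eq : Fin 6 → Polynomial 6 × Polynomial 6
  K-eq j = dot (G j) (K· entries) := κ j :* dot (G j) entries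
  M-eq j = dot (G j) (M· entries) := μ j :* dot (G j) entries
  D-eq j = dot (G j) (D· entries) := δ j :* dot (G j) entries

module EigenIdentities (q i k m l d : ℚ) where
  open ℚSolver using (solve)
  open ℚForm q
  open EigenEquations
  open Rat using (_*_)
  entries′ : Lin ℚ
  entries′ = ⟨ i , k , 1ℚ , m , l , d ⟩

  -- The product table is linear in the entries, so each case is a polynomial identity in `q` and
  -- free variables, with `J` entering as the constant 1.
  K-eigen : ∀ j → dot (G j) (K· entries′) ≡ κ j * dot (G j) entries′
  K-eigen 0F = solve 6 (λ q i k m l d → K-eq q i k m l d 0F) refl q i k m l d
  K-eigen 1F = solve 6 (λ q i k m l d → K-eq q i k m l d 1F) refl q i k m l d
  K-eigen 2F = solve 6 (λ q i k m l d → K-eq q i k m l d 2F) refl q i k m l d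
  K-eigen 3F = solve 6 (λ q i k m l d → K-eq q i k m l d 3F) refl q i k m l d
  K-eigen 4F = solve 6 (λ q i k m l d → K-eq q i k m l d 4F) refl q i k m l d
  K-eigen 5F = solve 6 (λ q i k m l d → K-eq q i k m l d 5F) refl q i k m l d

  M-eigen : ∀ j → dot (G j) (M· entries′) ≡ μ j * dot (G j) entries′
  M-eigen 0F = solve 6 (λ q i k m l d → M-eq q i k m l d 0F) refl q i k m l d
  M-eigen 1F = solve 6 (λ q i k m l d → M-eq q i k m l d 1F) refl q i k m l d
  M-eigen 2F = solve 6 (λ q i k m l d → M-eq q i k m l d 2F) refl q i k m l d
  M-eigen 3F = solve 6 (λ q i k m l d → M-eq q i k m l d 3F) refl q i k m l d
  M-eigen 4F = solve 6 (λ q i k m l d → M-eq q i k m l d 4F) refl q i k m l d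
  M-eigen 5F = solve 6 (λ q i k m l d → M-eq q i k m l d 5F) refl q i k m l d

  D-eigen : ∀ j → dot (G j) (D· entries′) ≡ δ j * dot (G j) entries′
  D-eigen 0F = solve 6 (λ q i k m l d → D-eq q i k m l d 0F) refl q i k m l d
  D-eigen 1F = solve 6 (λ q i k m l d → D-eq q i k m l d 1F) refl q i k m l d
  D-eigen 2F = solve 6 (λ q i k m l d → D-eq q i k m l d 2F) refl q i k m l d
  D-eigen 3F = solve 6 (λ q i k m l d → D-eq q i k m l d 3F) refl q i k m l d
  D-eigen 4F = solve 6 (λ q i k m l d → D-eq q i k m l d 4F) refl q i k m l d
  D-eigen 5F = solve 6 (λ q i k m l d → D-eq q i k m l d 5F) refl q i k m l d

-- Integers and counts inside ℚ.

module IntegerEmbedding where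
  open Int using (+_)
  open Rat using (_+_; _*_; -_)

  ι : ℤ → ℚ
  ι z = z Rat./ 1

  -- `Rat._/_` divides by a gcd, which does not reduce on variables. The identities below are
  -- therefore checked on unnormalised fractions and carried back by injectivity.
  toℚᵘ-/ : ∀ z d → Rat.toℚᵘ (z Rat./ suc d) ℚᵘ.≃ ℚᵘ.mkℚᵘ z d
  toℚᵘ-/ z d = ℚₚ.toℚᵘ-fromℚᵘ (ℚᵘ.mkℚᵘ z d)

  ι-+ : ∀ a b → ι (a Int.+ b) ≡ ι a + ι b
  ι-+ a b = ℚₚ.toℚᵘ-injective (ℚᵘₚ.≃-trans (toℚᵘ-/ (a Int.+ b) 0) (ℚᵘₚ.≃-sym
    (ℚᵘₚ.≃-trans (ℚₚ.toℚᵘ-homo-+ (ι a) (ι b))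
    (ℚᵘₚ.≃-trans (ℚᵘₚ.+-cong (toℚᵘ-/ a 0) (toℚᵘ-/ b 0))
      (ℚᵘ.*≡* (cong (Int._* + 1) (cong₂ Int._+_ (ℤₚ.*-identityʳ a) (ℤₚ.*-identityʳ b))))))))

  ι-* : ∀ a b → ι (a Int.* b) ≡ ι a * ι b
  ι-* a b = ℚₚ.toℚᵘ-injective (ℚᵘₚ.≃-trans (toℚᵘ-/ (a Int.* b) 0) (ℚᵘₚ.≃-sym
    (ℚᵘₚ.≃-trans (ℚₚ.toℚᵘ-homo-* (ι a) (ι b))
      (ℚᵘₚ.*-cong (toℚᵘ-/ a 0) (toℚᵘ-/ b 0)))))

  ι-neg : ∀ a → ι (Int.- a) ≡ - ι a
  ι-neg a = ℚₚ.toℚᵘ-injective (ℚᵘₚ.≃-trans (toℚᵘ-/ (Int.- a) 0) (ℚᵘₚ.≃-sym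
    (ℚᵘₚ.≃-trans (ℚₚ.toℚᵘ-homo‿- (ι a)) (ℚᵘₚ.-‿cong (toℚᵘ-/ a 0)))))

  /-*-cancel : ∀ z d → (z Rat./ suc d) * ι (+ suc d) ≡ ι z
  /-*-cancel z d = ℚₚ.toℚᵘ-injective
    (ℚᵘₚ.≃-trans (ℚₚ.toℚᵘ-homo-* (z Rat./ suc d) (ι (+ suc d)))
    (ℚᵘₚ.≃-trans (ℚᵘₚ.*-cong (toℚᵘ-/ z d) (toℚᵘ-/ (+ suc d) 0))
    (ℚᵘₚ.≃-trans (ℚᵘ.*≡* (trans (ℤₚ.*-identityʳ _) (cong (z Int.*_) (cong +_ (sym (ℕₚ.*-identityʳ (suc d)))))))
      (ℚᵘₚ.≃-sym (toℚᵘ-/ z 0)))))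

  ι-injective : ∀ {a b} → ι (+ a) ≡ ι (+ b) → a ≡ b
  ι-injective {a} {b} e
    with ℚᵘ.*≡* eq ← ℚᵘₚ.≃-trans (ℚᵘₚ.≃-sym (toℚᵘ-/ (+ a) 0))
                      (ℚᵘₚ.≃-trans (ℚₚ.toℚᵘ-cong e) (toℚᵘ-/ (+ b) 0)) =
    ℤₚ.+-injective (trans (sym (ℤₚ.*-identityʳ (+ a))) (trans eq (ℤₚ.*-identityʳ (+ b))))

  ∑-1 : ∀ n → ∑ {n} (λ _ → 1ℚ) ≡ ι (+ n)
  ∑-1 zero = refl
  ∑-1 (suc n) = trans (cong (λ z → 1ℚ + z) (∑-1 n)) (sym (ι-+ (+ 1) (+ n)))

  ∑-countF : ∀ n (f : Fin n → Bool) → ∑ (λ i → if f i then 1ℚ else 0ℚ) ≡ ι (+ countF f)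
  ∑-countF zero f = refl
  ∑-countF (suc n) f with f zero
  ... | true = trans (cong (λ z → 1ℚ + z) (∑-countF n (f ∘ suc))) (sym (ι-+ (+ 1) (+ countF (f ∘ suc))))
  ... | false = trans (ℚₚ.+-identityˡ _) (∑-countF n (f ∘ suc))

open IntegerEmbedding

*-≢0 : ∀ {a b} → a ≢ 0ℚ → b ≢ 0ℚ → a Rat.* b ≢ 0ℚ
*-≢0 {a} {b} a≢0 b≢0 ab≡0 = a≢0 (begin
  a                      ≡⟨ ℚₚ.*-identityʳ a ⟨
  a * 1ℚ                 ≡⟨ cong (a *_) (ℚₚ.*-inverseʳ b) ⟨
  a * (b * (Rat.1/ b))   ≡⟨ ℚₚ.*-assoc a b (Rat.1/ b) ⟨
  a * b * (Rat.1/ b)     ≡⟨ cong (_* (Rat.1/ b)) ab≡0 ⟩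
  0ℚ * (Rat.1/ b)        ≡⟨ ℚₚ.*-zeroˡ (Rat.1/ b) ⟩
  0ℚ                     ∎)
  where
  open ≡-Reasoning
  open Rat using (_*_)
  instance
    b-nonZero : Rat.NonZero b
    b-nonZero = Rat.≢-nonZero b≢0

-- The two eigenmatrices as tables of polynomials in q.

module Eigenmatrices where
  open Int using (+_)
  infixl 6 _⊕_ _⊝_
  infixl 7 _⊗_
  infix 8 ⊖_

  -- A syntax with three evaluations: in ℤ, as in the statement; in ℚ, where the matrices live; and
  -- in formal polynomials, where identities are decided.
  data Poly : Set where
    𝐪 𝟎 𝟏 : Poly
    _⊕_ _⊗_ : Poly → Poly → Poly
    ⊖_ : Poly → Poly

  _⊝_ : Poly → Poly → Poly
  a ⊝ b = a ⊕ ⊖ b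

  𝟐 : Poly
  𝟐 = 𝟏 ⊕ 𝟏

  module Eval (R : RawRing 0ℓ 0ℓ) (q : RawRing.Carrier R) where
    open RawRing R
    eval : Poly → Carrier
    eval 𝐪 = q
    eval 𝟎 = 0#
    eval 𝟏 = 1#
    eval (a ⊕ b) = eval a + eval b
    eval (a ⊗ b) = eval a * eval b
    eval (⊖ a) = - eval a

  module Evalℤ (q : ℕ) = Eval Int.+-*-rawRing (+ q)
  module Evalℚ = Eval Rat.+-*-rawRing
  module EvalP {k : ℕ} = Eval (polynomialRing k)

  ι-eval : ∀ q p → ι (Evalℤ.eval q p) ≡ Evalℚ.eval (ι (+ q)) p
  ι-eval q 𝐪 = refl
  ι-eval q 𝟎 = refl
  ι-eval q 𝟏 = refl
  ι-eval q (a ⊕ b) = trans (ι-+ (Evalℤ.eval q a) (Evalℤ.eval q b)) (cong₂ Rat._+_ (ι-eval q a) (ι-eval q b))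
  ι-eval q (a ⊗ b) = trans (ι-* (Evalℤ.eval q a) (Evalℤ.eval q b)) (cong₂ Rat._*_ (ι-eval q a) (ι-eval q b))
  ι-eval q (⊖ a) = trans (ι-neg (Evalℤ.eval q a)) (cong Rat.-_ (ι-eval q a))

  Prows : Vec (Vec Poly 6) 6
  Prows =
    (𝟏 ∷ (𝐪 ⊗ 𝐪 ⊝ 𝟏) ⊗ (𝐪 ⊕ 𝟏) ∷ 𝐪 ⊝ 𝟏 ∷ (𝐪 ⊗ 𝐪 ⊝ 𝟏) ⊗ (𝐪 ⊗ 𝐪 ⊝ 𝟏)
      ∷ (𝐪 ⊗ 𝐪 ⊗ 𝐪 ⊝ 𝐪) ⊗ (𝐪 ⊝ 𝟏) ⊗ (𝐪 ⊝ 𝟏) ∷ (𝐪 ⊗ 𝐪 ⊗ 𝐪 ⊝ 𝐪) ⊗ (𝐪 ⊝ 𝟏) ∷ []) ∷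
    (𝟏 ∷ 𝐪 ⊗ 𝐪 ⊝ 𝐪 ⊝ 𝟏 ∷ 𝐪 ⊝ 𝟏 ∷ 𝐪 ⊗ 𝐪 ⊗ 𝐪 ⊝ 𝟐 ⊗ 𝐪 ⊗ 𝐪 ⊕ 𝟏
      ∷ ⊖ (𝐪 ⊗ (𝐪 ⊝ 𝟏) ⊗ (𝐪 ⊝ 𝟏)) ∷ ⊖ (𝐪 ⊗ (𝐪 ⊝ 𝟏)) ∷ []) ∷
    (𝟏 ∷ 𝐪 ⊗ 𝐪 ⊝ 𝟏 ∷ ⊖ 𝟏 ∷ ⊖ (𝐪 ⊗ 𝐪) ⊕ 𝟏 ∷ 𝟎 ∷ 𝟎 ∷ []) ∷
    (𝟏 ∷ ⊖ 𝐪 ⊝ 𝟏 ∷ 𝐪 ⊝ 𝟏 ∷ ⊖ (𝐪 ⊗ 𝐪) ⊕ 𝟏 ∷ 𝐪 ⊗ (𝐪 ⊝ 𝟏) ∷ 𝐪 ∷ []) ∷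
    (𝟏 ∷ ⊖ 𝐪 ⊝ 𝟏 ∷ ⊖ 𝟏 ∷ 𝐪 ⊕ 𝟏 ∷ ⊖ (𝐪 ⊗ (𝐪 ⊕ 𝟏)) ∷ 𝐪 ⊗ (𝐪 ⊕ 𝟏) ∷ []) ∷
    (𝟏 ∷ ⊖ 𝐪 ⊝ 𝟏 ∷ ⊖ 𝟏 ∷ 𝐪 ⊕ 𝟏 ∷ 𝐪 ⊗ (𝐪 ⊝ 𝟏) ∷ ⊖ (𝐪 ⊗ (𝐪 ⊝ 𝟏)) ∷ []) ∷ []

  -- The denominators 1, 2, q + 1 and 2 (q + 1) of the second eigenmatrix.
  data Denominator : Set where
    /1 /2 /s /2s : Denominator

  fraction : ℕ → Poly × Denominator → ℚ
  fraction q (p , /1) = ι (Evalℤ.eval q p)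
  fraction q (p , /2) = Evalℤ.eval q p Rat./ 2
  fraction q (p , /s) = Evalℤ.eval q p Rat./ suc q
  fraction q (p , /2s) = Evalℤ.eval q p Rat./ suc (suc (q ℕ.+ q))

  Qrows : Vec (Vec (Poly × Denominator) 6) 6
  Qrows =
    ((𝟏 , /1) ∷ ((𝐪 ⊝ 𝟏) ⊗ (𝐪 ⊕ 𝟏) ⊗ (𝐪 ⊕ 𝟏) , /1) ∷ (𝐪 ⊗ 𝐪 ⊗ 𝐪 ⊗ (𝐪 ⊝ 𝟏) , /1)
      ∷ (𝐪 ⊗ (𝐪 ⊝ 𝟏) ⊗ (𝐪 ⊝ 𝟏) ⊗ (𝐪 ⊕ 𝟏) , /1)
      ∷ (𝐪 ⊗ 𝐪 ⊗ (𝐪 ⊝ 𝟏) ⊗ (𝐪 ⊝ 𝟏) ⊗ (𝐪 ⊝ 𝟏) , /2)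
      ∷ (𝐪 ⊗ 𝐪 ⊗ (𝐪 ⊕ 𝟏) ⊗ (𝐪 ⊝ 𝟏) ⊗ (𝐪 ⊝ 𝟏) , /2) ∷ []) ∷
    ((𝟏 , /1) ∷ (𝐪 ⊗ 𝐪 ⊝ 𝐪 ⊝ 𝟏 , /1) ∷ (𝐪 ⊗ 𝐪 ⊗ 𝐪 ⊗ (𝐪 ⊝ 𝟏) , /s) ∷ (⊖ (𝐪 ⊗ (𝐪 ⊝ 𝟏)) , /1)
      ∷ (⊖ (𝐪 ⊗ 𝐪 ⊗ (𝐪 ⊝ 𝟏) ⊗ (𝐪 ⊝ 𝟏)) , /2s) ∷ (⊖ (𝐪 ⊗ 𝐪 ⊗ (𝐪 ⊝ 𝟏)) , /2) ∷ []) ∷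
    ((𝟏 , /1) ∷ ((𝐪 ⊝ 𝟏) ⊗ (𝐪 ⊕ 𝟏) ⊗ (𝐪 ⊕ 𝟏) , /1) ∷ (⊖ (𝐪 ⊗ 𝐪 ⊗ 𝐪) , /1)
      ∷ (𝐪 ⊗ (𝐪 ⊝ 𝟏) ⊗ (𝐪 ⊝ 𝟏) ⊗ (𝐪 ⊕ 𝟏) , /1)
      ∷ (⊖ (𝐪 ⊗ 𝐪 ⊗ (𝐪 ⊝ 𝟏) ⊗ (𝐪 ⊝ 𝟏)) , /2) ∷ (⊖ (𝐪 ⊗ 𝐪 ⊗ (𝐪 ⊕ 𝟏) ⊗ (𝐪 ⊝ 𝟏)) , /2) ∷ []) ∷
    ((𝟏 , /1) ∷ (𝐪 ⊗ 𝐪 ⊝ 𝐪 ⊝ 𝟏 , /1) ∷ (⊖ (𝐪 ⊗ 𝐪 ⊗ 𝐪) , /s) ∷ (⊖ (𝐪 ⊗ (𝐪 ⊝ 𝟏)) , /1)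
      ∷ (𝐪 ⊗ 𝐪 ⊗ (𝐪 ⊝ 𝟏) , /2s) ∷ (𝐪 ⊗ 𝐪 , /2) ∷ []) ∷
    ((𝟏 , /1) ∷ (⊖ 𝐪 ⊝ 𝟏 , /1) ∷ (𝟎 , /1) ∷ (𝐪 , /1) ∷ (⊖ (𝐪 ⊗ 𝐪) , /2) ∷ (𝐪 ⊗ 𝐪 , /2) ∷ []) ∷
    ((𝟏 , /1) ∷ (⊖ 𝐪 ⊝ 𝟏 , /1) ∷ (𝟎 , /1) ∷ (𝐪 , /1)
      ∷ (𝐪 ⊗ 𝐪 ⊗ (𝐪 ⊝ 𝟏) , /2) ∷ (⊖ (𝐪 ⊗ 𝐪 ⊗ (𝐪 ⊝ 𝟏)) , /2) ∷ []) ∷ []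

  lookup₂-map : ∀ {A B : Set} (f : A → B) (v : Vec (Vec A 6) 6) i j →
                lookup (lookup (Vec.map (Vec.map f) v) i) j ≡ f (lookup (lookup v i) j)
  lookup₂-map f v i j = trans (cong (λ r → lookup r j) (lookup-map i (Vec.map f) v)) (lookup-map j f (lookup v i))

  Pentry : Fin 6 → Fin 6 → Poly
  Pentry i j = lookup (lookup Prows i) j

  Qentry : Fin 6 → Fin 6 → Poly × Denominator
  Qentry i j = lookup (lookup Qrows i) j

  Pmat-entry : ∀ q i j → Eigen.Pmat q i j ≡ Evalℚ.eval (ι (+ q)) (Pentry i j)
  Pmat-entry q i j = trans (P-rows i j) (trans (lookup₂-map (ι ∘ Evalℤ.eval q) Prows i j) (ι-eval q (Pentry i j)))
    where
    -- Both tables reduce to the same terms; in particular `𝟐` evaluates to a sum of two ones, which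
    -- computes to `+ 2`.
    P-rows : ∀ i j → Eigen.Pmat q i j ≡ lookup (lookup (Vec.map (Vec.map (ι ∘ Evalℤ.eval q)) Prows) i) j
    P-rows i j = refl

  Qmat-entry : ∀ q i j → Eigen.Qmat q i j ≡ fraction q (Qentry i j)
  Qmat-entry q i j = trans (Q-rows i j) (lookup₂-map (fraction q) Qrows i j)
    where
    Q-rows : ∀ i j → Eigen.Qmat q i j ≡ lookup (lookup (Vec.map (Vec.map (fraction q)) Qrows) i) j
    Q-rows i j = refl

  -- n divided by the denominator.
  cofactor : Denominator → Poly
  cofactor /1 = 𝟐 ⊗ 𝐪 ⊗ 𝐪 ⊗ 𝐪 ⊗ 𝐪 ⊗ 𝐪 ⊗ (𝐪 ⊕ 𝟏)
  cofactor /2 = 𝐪 ⊗ 𝐪 ⊗ 𝐪 ⊗ 𝐪 ⊗ 𝐪 ⊗ (𝐪 ⊕ 𝟏)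
  cofactor /s = 𝟐 ⊗ 𝐪 ⊗ 𝐪 ⊗ 𝐪 ⊗ 𝐪 ⊗ 𝐪
  cofactor /2s = 𝐪 ⊗ 𝐪 ⊗ 𝐪 ⊗ 𝐪 ⊗ 𝐪

  scaledQ : Fin 6 → Fin 6 → Poly
  scaledQ i j = proj₁ (Qentry i j) ⊗ cofactor (proj₂ (Qentry i j))

  -- Each of the four denominators divides `n`, so scaling by `n` turns every entry of the second
  -- eigenmatrix into a polynomial in q.
  n*fraction : ∀ q pd → ℚForm.n (ι (+ q)) Rat.* fraction q pd ≡
               Evalℚ.eval (ι (+ q)) (proj₁ pd ⊗ cofactor (proj₂ pd))
  n*fraction q (p , /1) rewrite ι-eval q p = ℚₚ.*-comm (ℚForm.n (ι (+ q))) _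
  n*fraction q (p , /2) = trans (lem r (Evalℤ.eval q p Rat./ 2))
      (cong (Rat._* Evalℚ.eval r (cofactor /2)) (trans (/-*-cancel (Evalℤ.eval q p) 1) (ι-eval q p)))
    where
    r = ι (+ q)
    open Rat using (_+_; _*_)
    lem : ∀ q f → (1ℚ + 1ℚ) * q * q * q * q * q * (q + 1ℚ) * f ≡ f * (1ℚ + 1ℚ) * (q * q * q * q * q * (q + 1ℚ))
    lem = solve-∀ ℚ-ring
  n*fraction q (p , /s) = trans (lem r (Evalℤ.eval q p Rat./ suc q))
      (cong (Rat._* Evalℚ.eval r (cofactor /s))
        (trans (cong ((Evalℤ.eval q p Rat./ suc q) *_) (trans (ℚₚ.+-comm r 1ℚ) (sym (ι-+ (+ 1) (+ q)))))
          (trans (/-*-cancel (Evalℤ.eval q p) q) (ι-eval q p))))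
    where
    r = ι (+ q)
    open Rat using (_+_; _*_)
    lem : ∀ q f → (1ℚ + 1ℚ) * q * q * q * q * q * (q + 1ℚ) * f ≡ f * (q + 1ℚ) * ((1ℚ + 1ℚ) * q * q * q * q * q)
    lem = solve-∀ ℚ-ring
  n*fraction q (p , /2s) = trans (lem r (Evalℤ.eval q p Rat./ suc (suc (q ℕ.+ q))))
      (cong (Rat._* Evalℚ.eval r (cofactor /2s))
        (trans (cong ((Evalℤ.eval q p Rat./ suc (suc (q ℕ.+ q))) *_)
            (trans (cong (λ z → 1ℚ + 1ℚ + z) (sym (ι-+ (+ q) (+ q)))) (sym (ι-+ (+ 2) (+ (q ℕ.+ q))))))
          (trans (/-*-cancel (Evalℤ.eval q p) (suc (q ℕ.+ q))) (ι-eval q p))))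
    where
    r = ι (+ q)
    open Rat using (_+_; _*_)
    lem : ∀ q f → (1ℚ + 1ℚ) * q * q * q * q * q * (q + 1ℚ) * f ≡ f * (1ℚ + 1ℚ + (q + q)) * (q * q * q * q * q)
    lem = solve-∀ ℚ-ring

  n*Qmat : ∀ q i j → ℚForm.n (ι (+ q)) Rat.* Eigen.Qmat q i j ≡ Evalℚ.eval (ι (+ q)) (scaledQ i j)
  n*Qmat q i j = trans (cong (ℚForm.n (ι (+ q)) Rat.*_) (Qmat-entry q i j)) (n*fraction q (Qentry i j))

-- The multiplication table of the six matrices and its eigenspaces.

module SixMatrices (q : ℚ) {N : ℕ} (K M L D : Mat N) where
  open Rat using (_+_; _*_; -_)
  open Summation
  open Size N
  open ℚForm q

  I J : Mat N
  I = idM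
  J _ _ = 1ℚ

  entries : Fin N → Fin N → Lin ℚ
  entries x y = ⟨ I x y , K x y , 1ℚ , M x y , L x y , D x y ⟩

  val : Lin ℚ → Mat N
  val c x y = dot c (entries x y)

  module Products
    (K-sym : ∀ x y → K x y ≡ K y x) (M-sym : ∀ x y → M x y ≡ M y x)
    (L-sym : ∀ x y → L x y ≡ L y x) (D-sym : ∀ x y → D x y ≡ D y x)
    (KK : ∀ x y → (K ·M K) x y ≡ q * K x y)
    (KM : ∀ x y → (K ·M M) x y ≡ 1ℚ)
    (KD : ∀ x y → (K ·M D) x y ≡ L x y)
    (MM : ∀ x y → (M ·M M) x y ≡ val mm x y)
    (DM : ∀ x y → (D ·M M) x y ≡ val md x y)
    (DD : ∀ x y → (D ·M D) x y ≡ val dd x y)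
    where

    val-sym : ∀ c x y → val c x y ≡ val c y x
    val-sym c x y rewrite idM-sym x y | K-sym x y | M-sym x y | L-sym x y | D-sym x y = refl

    ∑-linʳ : ∀ (u f g : Fin N → ℚ) a →
             ∑ (λ z → u z * (a * f z + g z)) ≡ a * ∑ (λ z → u z * f z) + ∑ (λ z → u z * g z)
    ∑-linʳ u f g a =
      trans (∑-cong (λ z → lem (u z) a (f z) (g z)))
        (trans (∑-+ _ _) (cong (_+ ∑ (λ z → u z * g z)) (∑-*ˡ a _)))
      where
      lem : ∀ u a f g → u * (a * f + g) ≡ a * (u * f) + u * g
      lem = solve-∀ ℚ-ring

    ∑-linˡ : ∀ (u f g : Fin N → ℚ) a →
             ∑ (λ z → (a * f z + g z) * u z) ≡ a * ∑ (λ z → f z * u z) + ∑ (λ z → g z * u z)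
    ∑-linˡ u f g a =
      trans (∑-cong (λ z → lem (u z) a (f z) (g z)))
        (trans (∑-+ _ _) (cong (_+ ∑ (λ z → g z * u z)) (∑-*ˡ a _)))
      where
      lem : ∀ u a f g → (a * f + g) * u ≡ a * (f * u) + g * u
      lem = solve-∀ ℚ-ring

    ·M-val : ∀ (X : Mat N) {x y i k j m l d} →
      (X ·M I) x y ≡ i → (X ·M K) x y ≡ k → (X ·M J) x y ≡ j →
      (X ·M M) x y ≡ m → (X ·M L) x y ≡ l → (X ·M D) x y ≡ d →
      ∀ c → (X ·M val c) x y ≡ dot c ⟨ i , k , j , m , l , d ⟩
    ·M-val X {x} {y} refl refl refl refl refl refl ⟨ a , b , c , d , e , f ⟩ =
      trans (∑-linʳ (X x) (λ z → I z y) _ a) (cong (a * (X ·M I) x y +_) (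
      trans (∑-linʳ (X x) (λ z → K z y) _ b) (cong (b * (X ·M K) x y +_) (
      trans (∑-linʳ (X x) (λ z → J z y) _ c) (cong (c * (X ·M J) x y +_) (
      trans (∑-linʳ (X x) (λ z → M z y) _ d) (cong (d * (X ·M M) x y +_) (
      trans (∑-linʳ (X x) (λ z → L z y) _ e) (cong (e * (X ·M L) x y +_) (·M-scaleʳ f X D x y))))))))))

    val-·M : ∀ (X : Mat N) {x y i k j m l d} →
      (I ·M X) x y ≡ i → (K ·M X) x y ≡ k → (J ·M X) x y ≡ j →
      (M ·M X) x y ≡ m → (L ·M X) x y ≡ l → (D ·M X) x y ≡ d →
      ∀ c → (val c ·M X) x y ≡ dot c ⟨ i , k , j , m , l , d ⟩
    val-·M X {x} {y} refl refl refl refl refl refl ⟨ a , b , c , d , e , f ⟩ =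
      trans (∑-linˡ (λ z → X z y) (I x) _ a) (cong (a * (I ·M X) x y +_) (
      trans (∑-linˡ (λ z → X z y) (K x) _ b) (cong (b * (K ·M X) x y +_) (
      trans (∑-linˡ (λ z → X z y) (J x) _ c) (cong (c * (J ·M X) x y +_) (
      trans (∑-linˡ (λ z → X z y) (M x) _ d) (cong (d * (M ·M X) x y +_) (
      trans (∑-linˡ (λ z → X z y) (L x) _ e) (cong (e * (L ·M X) x y +_) (·M-scaleˡ f D X x y))))))))))

    -- Products by J and L reduce to the given ones through J = K M and L = K D.
    K-·M : ∀ (Y Z : Mat N) → (∀ x y → (K ·M Y) x y ≡ Z x y) → ∀ x y → (K ·M Z) x y ≡ q * Z x y
    K-·M Y Z KY x y = begin
      (K ·M Z) x y                    ≡⟨ ·M-congˡ K (λ u v → sym (KY u v)) x y ⟩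
      (K ·M (K ·M Y)) x y             ≡⟨ ·M-assoc K K Y x y ⟨
      ((K ·M K) ·M Y) x y             ≡⟨ ·M-congʳ Y KK x y ⟩
      ((λ u v → q * K u v) ·M Y) x y  ≡⟨ ·M-scaleˡ q K Y x y ⟩
      q * (K ·M Y) x y                ≡⟨ cong (q *_) (KY x y) ⟩
      q * Z x y                       ∎
      where open ≡-Reasoning

    MK : ∀ x y → (M ·M K) x y ≡ 1ℚ
    MK x y = trans (·M-transpose M-sym K-sym x y) (KM y x)

    DK : ∀ x y → (D ·M K) x y ≡ L x y
    DK x y = trans (·M-transpose D-sym K-sym x y) (trans (KD y x) (L-sym y x))

    MD : ∀ x y → (M ·M D) x y ≡ val md x y
    MD x y = trans (·M-transpose M-sym D-sym x y) (trans (DM y x) (val-sym md y x))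

    K-val : ∀ c x y → (K ·M val c) x y ≡ dot c (K· (entries x y))
    K-val c x y = ·M-val K (·M-idM K x y) (KK x y)
      (trans (K-·M M J KM x y) (ℚₚ.*-identityʳ q)) (KM x y) (K-·M D L KD x y) (KD x y) c

    -- With `Z = Y K`, associativity gives `X Z = (X Y) K`, and symmetry moves `K` to the left,
    -- where `K-val` applies. This produces `M J`, `D J`, `M L` and `D L` from `M M`, `D M`, `M D`
    -- and `D D`.
    product-K : ∀ (X Y Z : Mat N) c → (∀ x y → (X ·M Y) x y ≡ val c x y) →
      (∀ x y → (Y ·M K) x y ≡ Z x y) → ∀ x y → (X ·M Z) x y ≡ dot c (K· (entries x y))
    product-K X Y Z c XY YK x y = begin
      (X ·M Z) x y                ≡⟨ ·M-congˡ X (λ u v → sym (YK u v)) x y ⟩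
      (X ·M (Y ·M K)) x y         ≡⟨ ·M-assoc X Y K x y ⟨
      ((X ·M Y) ·M K) x y         ≡⟨ ·M-congʳ K XY x y ⟩
      (val c ·M K) x y            ≡⟨ ·M-transpose (val-sym c) K-sym x y ⟩
      (K ·M val c) y x            ≡⟨ K-val c y x ⟩
      dot c (K· (entries y x))    ≡⟨ cong₂ (λ k l → dot c (K· ⟨ I y x , k , 1ℚ , M y x , l , D y x ⟩))
                                       (K-sym y x) (L-sym y x) ⟩
      dot c (K· (entries x y))    ∎
      where open ≡-Reasoning

    MJ : ∀ x y → (M ·M J) x y ≡ q * q * q * q
    MJ x y = trans (product-K M M J mm MM MK x y) (lem q (K x y) (L x y))
      where
      lem : ∀ q k l → q * q * q * q * k + (- (q * q * q) * (q * k) + (q * q * q * q + (0ℚ * 1ℚ +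
            (0ℚ * (q * l) + 0ℚ * l)))) ≡ q * q * q * q
      lem = solve-∀ ℚ-ring

    kDegree-eq : ∀ q k l → q * q * q * k + (- (q * q) * (q * k) + ((q * q + q) * q + (- q * 1ℚ +
            (- q * (q * l) + q * q * l)))) ≡ q * q * q + q * q + - q
    kDegree-eq = solve-∀ ℚ-ring

    DJ : ∀ x y → (D ·M J) x y ≡ kDegree
    DJ x y = trans (product-K D M J md DM MK x y) (kDegree-eq q (K x y) (L x y))

    ML : ∀ x y → (M ·M L) x y ≡ kDegree
    ML x y = trans (product-K M D L md MD DK x y) (kDegree-eq q (K x y) (L x y))

    DL : ∀ x y → (D ·M L) x y ≡ (q * q * q + - (q * q)) * K x y + (q * q + q + (q * q + - q + - q) * L x y)
    DL x y = trans (product-K D D L dd DD DK x y) (lem q (K x y) (L x y))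
      where
      lem : ∀ q k l → q * q * q * k + (- q * (q * k) + ((q + 1ℚ) * q + (0ℚ * 1ℚ +
            (- 1ℚ * (q * l) + (q * q + - q) * l)))) ≡
            (q * q * q + - (q * q)) * k + (q * q + q + (q * q + - q + - q) * l)
      lem = solve-∀ ℚ-ring

    M-val : ∀ c x y → (M ·M val c) x y ≡ dot c (M· (entries x y))
    M-val c x y = ·M-val M (·M-idM M x y) (MK x y) (MJ x y) (MM x y) (ML x y) (MD x y) c

    D-val : ∀ c x y → (D ·M val c) x y ≡ dot c (D· (entries x y))
    D-val c x y = ·M-val D (·M-idM D x y) (DK x y) (DJ x y) (DM x y) (DL x y) (DD x y) c

    module _ (j : Fin 6) where
      E : Mat N
      E = val (G j)

      module Eig (x y : Fin N) = EigenIdentities q (I x y) (K x y) (M x y) (L x y) (D x y)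

      K-E : ∀ x y → (K ·M E) x y ≡ κ j * E x y
      K-E x y = trans (K-val (G j) x y) (Eig.K-eigen x y j)

      M-E : ∀ x y → (M ·M E) x y ≡ μ j * E x y
      M-E x y = trans (M-val (G j) x y) (Eig.M-eigen x y j)

      D-E : ∀ x y → (D ·M E) x y ≡ δ j * E x y
      D-E x y = trans (D-val (G j) x y) (Eig.D-eigen x y j)

      composite : ∀ (A B : Mat N) a b → (∀ x y → (A ·M E) x y ≡ a * E x y) → (∀ x y → (B ·M E) x y ≡ b * E x y) →
        ∀ x y → ((A ·M B) ·M E) x y ≡ a * b * E x y
      composite A B a b AE BE x y = begin
        ((A ·M B) ·M E) x y             ≡⟨ ·M-assoc A B E x y ⟩
        (A ·M (B ·M E)) x y             ≡⟨ ·M-congˡ A BE x y ⟩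
        (A ·M (λ u v → b * E u v)) x y  ≡⟨ ·M-scaleʳ b A E x y ⟩
        b * (A ·M E) x y                ≡⟨ cong (b *_) (AE x y) ⟩
        b * (a * E x y)                 ≡⟨ lem a b (E x y) ⟩
        a * b * E x y                   ∎
        where
        open ≡-Reasoning
        lem : ∀ a b e → b * (a * e) ≡ a * b * e
        lem = solve-∀ ℚ-ring

      J-E : ∀ x y → (J ·M E) x y ≡ κ j * μ j * E x y
      J-E x y = trans (·M-congʳ E (λ u v → sym (KM u v)) x y) (composite K M (κ j) (μ j) K-E M-E x y)

      L-E : ∀ x y → (L ·M E) x y ≡ κ j * δ j * E x y
      L-E x y = trans (·M-congʳ E (λ u v → sym (KD u v)) x y) (composite K D (κ j) (δ j) K-E D-E x y)

      I-E : ∀ x y → (I ·M E) x y ≡ E x y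
      I-E x y = trans (·M-transpose idM-sym (val-sym (G j)) x y)
        (trans (·M-idM E y x) (val-sym (G j) y x))

      val-E : ∀ c x y → (val c ·M E) x y ≡ dot c (χ j) * E x y
      val-E c@(⟨ a , b , e , d , f , g ⟩) x y =
        trans (val-·M E (I-E x y) (K-E x y) (J-E x y) (M-E x y) (L-E x y) (D-E x y) c)
          (lem a b e d f g (κ j) (μ j) (δ j) (E x y))
        where
        lem : ∀ a b c d e f k m g v → a * v + (b * (k * v) + (c * (k * m * v) + (d * (m * v) + (e * (k * g * v) + f * (g * v)))))
           ≡ (a * 1ℚ + (b * k + (c * (k * m) + (d * m + (e * (k * g) + f * g))))) * v
        lem = solve-∀ ℚ-ring

    JJ : ∀ x y → (J ·M J) x y ≡ q * q * q * q * q
    JJ x y = begin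
      (J ·M J) x y                     ≡⟨ ·M-congʳ J (λ u v → sym (KM u v)) x y ⟩
      ((K ·M M) ·M J) x y              ≡⟨ ·M-assoc K M J x y ⟩
      (K ·M (M ·M J)) x y              ≡⟨ ·M-congˡ K (λ u v → trans (MJ u v) (sym (ℚₚ.*-identityʳ _))) x y ⟩
      (K ·M (λ u v → q * q * q * q * 1ℚ)) x y  ≡⟨ ·M-scaleʳ (q * q * q * q) K J x y ⟩
      q * q * q * q * (K ·M J) x y     ≡⟨ cong (q * q * q * q *_) (trans (K-·M M J KM x y) (ℚₚ.*-identityʳ q)) ⟩
      q * q * q * q * q                ∎
      where open ≡-Reasoning

-- Polynomial identities behind the eigenmatrices, valencies and multiplicities.

module SchemeEquations (q i k m l d : ℚSolver.Polynomial 6) where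
  open ℚSolver using (Polynomial; _:=_; _:*_; con)
  open Eigenmatrices
  open PForm q
  entries : Lin (Polynomial 6)
  entries = ⟨ i , k , con 1ℚ , m , l , d ⟩

  P-eq Q-eq : Fin 6 → Polynomial 6 × Polynomial 6
  P-eq j = n :* dot (adjacency j) entries := sum₆ (λ i → EvalP.eval q (Pentry i j) :* dot (G i) entries)
  Q-eq j = (q :* q :* q :* q :* q) :* dot (G j) entries :=
           sum₆ (λ i → EvalP.eval q (scaledQ i j) :* dot (adjacency i) entries)
  unit-eq : Polynomial 6 × Polynomial 6
  unit-eq = sum₆ (λ i → dot (G i) entries) := n :* i

module CharacterEquations (q : ℚSolver.Polynomial 1) where
  open ℚSolver using (Polynomial; _:=_; _:*_; con)
  open PForm q
  diagonal-eq valency-eq multiplicity-eq : Fin 6 → Polynomial 1 × Polynomial 1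
  diagonal-eq i = dot (G i) (χ i) := n
  valency-eq j = dot (adjacency j) (χ 0F) := valency j
    where
    valency : Fin 6 → Polynomial 1
    valency = lookup (con 1ℚ ∷ (q - con 1ℚ) :* s :* s ∷ q - con 1ℚ ∷ (q - con 1ℚ) :* s :* (q - con 1ℚ) :* s
      ∷ q :* (q - con 1ℚ) :* s :* (q - con 1ℚ) :* (q - con 1ℚ) ∷ q :* (q - con 1ℚ) :* s :* (q - con 1ℚ) ∷ [])
  multiplicity-eq j = dot (G j) (relationEntries 0F) := multiplicity j
    where
    multiplicity : Fin 6 → Polynomial 1
    multiplicity = lookup (2# :* s ∷ 2# :* s :* (q - con 1ℚ) :* s :* s ∷ 2# :* q :* q :* q :* (q - con 1ℚ) :* s
      ∷ 2# :* s :* q :* (q - con 1ℚ) :* (q - con 1ℚ) :* s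
      ∷ q :* q :* (q - con 1ℚ) :* (q - con 1ℚ) :* (q - con 1ℚ) :* s
      ∷ q :* q :* s :* (q - con 1ℚ) :* (q - con 1ℚ) :* s ∷ [])
  offDiagonal-eq : Fin 6 → Fin 6 → Polynomial 1 × Polynomial 1
  offDiagonal-eq i j = dot (G i) (χ j) := con 0ℚ

module SchemeIdentities (q i k m l d : ℚ) where
  open ℚSolver using (solve)
  open Eigenmatrices
  open ℚForm q
  open SchemeEquations using (P-eq; Q-eq; unit-eq)
  open Rat using (_*_)
  ent : Lin ℚ
  ent = ⟨ i , k , 1ℚ , m , l , d ⟩

  P-identity : ∀ j → n * dot (adjacency j) ent ≡ ∑ (λ i → Evalℚ.eval q (Pentry i j) * dot (G i) ent)
  P-identity 0F = solve 6 (λ q i k m l d → P-eq q i k m l d 0F) refl q i k m l d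
  P-identity 1F = solve 6 (λ q i k m l d → P-eq q i k m l d 1F) refl q i k m l d
  P-identity 2F = solve 6 (λ q i k m l d → P-eq q i k m l d 2F) refl q i k m l d
  P-identity 3F = solve 6 (λ q i k m l d → P-eq q i k m l d 3F) refl q i k m l d
  P-identity 4F = solve 6 (λ q i k m l d → P-eq q i k m l d 4F) refl q i k m l d
  P-identity 5F = solve 6 (λ q i k m l d → P-eq q i k m l d 5F) refl q i k m l d

  Q-identity : ∀ j → q * q * q * q * q * dot (G j) ent ≡
               ∑ (λ i → Evalℚ.eval q (scaledQ i j) * dot (adjacency i) ent)
  Q-identity 0F = solve 6 (λ q i k m l d → Q-eq q i k m l d 0F) refl q i k m l d
  Q-identity 1F = solve 6 (λ q i k m l d → Q-eq q i k m l d 1F) refl q i k m l d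
  Q-identity 2F = solve 6 (λ q i k m l d → Q-eq q i k m l d 2F) refl q i k m l d
  Q-identity 3F = solve 6 (λ q i k m l d → Q-eq q i k m l d 3F) refl q i k m l d
  Q-identity 4F = solve 6 (λ q i k m l d → Q-eq q i k m l d 4F) refl q i k m l d
  Q-identity 5F = solve 6 (λ q i k m l d → Q-eq q i k m l d 5F) refl q i k m l d

  unit-identity : ∑ (λ i → dot (G i) ent) ≡ n * i
  unit-identity = solve 6 unit-eq refl q i k m l d

module CharacterIdentities (q : ℚ) where
  open ℚSolver using (solve)
  open ℚForm q
  open CharacterEquations using (diagonal-eq; offDiagonal-eq; valency-eq; multiplicity-eq)
  open Rat using (_*_)

  -- `dot (G i) (χ j)` is the scalar of n E_i on the image of E_j. Being n for equal and 0 for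
  -- different indices, it makes the E_i orthogonal idempotents.
  diagonal : ∀ i → dot (G i) (χ i) ≡ n
  diagonal 0F = solve 1 (λ q → diagonal-eq q 0F) refl q
  diagonal 1F = solve 1 (λ q → diagonal-eq q 1F) refl q
  diagonal 2F = solve 1 (λ q → diagonal-eq q 2F) refl q
  diagonal 3F = solve 1 (λ q → diagonal-eq q 3F) refl q
  diagonal 4F = solve 1 (λ q → diagonal-eq q 4F) refl q
  diagonal 5F = solve 1 (λ q → diagonal-eq q 5F) refl q

  offDiagonal : ∀ i j → i ≢ j → dot (G i) (χ j) ≡ 0ℚ
  offDiagonal 0F 0F i≢j = ⊥-elim (i≢j refl)
  offDiagonal 0F 1F _ = solve 1 (λ q → offDiagonal-eq q 0F 1F) refl q
  offDiagonal 0F 2F _ = solve 1 (λ q → offDiagonal-eq q 0F 2F) refl q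
  offDiagonal 0F 3F _ = solve 1 (λ q → offDiagonal-eq q 0F 3F) refl q
  offDiagonal 0F 4F _ = solve 1 (λ q → offDiagonal-eq q 0F 4F) refl q
  offDiagonal 0F 5F _ = solve 1 (λ q → offDiagonal-eq q 0F 5F) refl q
  offDiagonal 1F 0F _ = solve 1 (λ q → offDiagonal-eq q 1F 0F) refl q
  offDiagonal 1F 1F i≢j = ⊥-elim (i≢j refl)
  offDiagonal 1F 2F _ = solve 1 (λ q → offDiagonal-eq q 1F 2F) refl q
  offDiagonal 1F 3F _ = solve 1 (λ q → offDiagonal-eq q 1F 3F) refl q
  offDiagonal 1F 4F _ = solve 1 (λ q → offDiagonal-eq q 1F 4F) refl q
  offDiagonal 1F 5F _ = solve 1 (λ q → offDiagonal-eq q 1F 5F) refl q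
  offDiagonal 2F 0F _ = solve 1 (λ q → offDiagonal-eq q 2F 0F) refl q
  offDiagonal 2F 1F _ = solve 1 (λ q → offDiagonal-eq q 2F 1F) refl q
  offDiagonal 2F 2F i≢j = ⊥-elim (i≢j refl)
  offDiagonal 2F 3F _ = solve 1 (λ q → offDiagonal-eq q 2F 3F) refl q
  offDiagonal 2F 4F _ = solve 1 (λ q → offDiagonal-eq q 2F 4F) refl q
  offDiagonal 2F 5F _ = solve 1 (λ q → offDiagonal-eq q 2F 5F) refl q
  offDiagonal 3F 0F _ = solve 1 (λ q → offDiagonal-eq q 3F 0F) refl q
  offDiagonal 3F 1F _ = solve 1 (λ q → offDiagonal-eq q 3F 1F) refl q
  offDiagonal 3F 2F _ = solve 1 (λ q → offDiagonal-eq q 3F 2F) refl q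
  offDiagonal 3F 3F i≢j = ⊥-elim (i≢j refl)
  offDiagonal 3F 4F _ = solve 1 (λ q → offDiagonal-eq q 3F 4F) refl q
  offDiagonal 3F 5F _ = solve 1 (λ q → offDiagonal-eq q 3F 5F) refl q
  offDiagonal 4F 0F _ = solve 1 (λ q → offDiagonal-eq q 4F 0F) refl q
  offDiagonal 4F 1F _ = solve 1 (λ q → offDiagonal-eq q 4F 1F) refl q
  offDiagonal 4F 2F _ = solve 1 (λ q → offDiagonal-eq q 4F 2F) refl q
  offDiagonal 4F 3F _ = solve 1 (λ q → offDiagonal-eq q 4F 3F) refl q
  offDiagonal 4F 4F i≢j = ⊥-elim (i≢j refl)
  offDiagonal 4F 5F _ = solve 1 (λ q → offDiagonal-eq q 4F 5F) refl q
  offDiagonal 5F 0F _ = solve 1 (λ q → offDiagonal-eq q 5F 0F) refl q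
  offDiagonal 5F 1F _ = solve 1 (λ q → offDiagonal-eq q 5F 1F) refl q
  offDiagonal 5F 2F _ = solve 1 (λ q → offDiagonal-eq q 5F 2F) refl q
  offDiagonal 5F 3F _ = solve 1 (λ q → offDiagonal-eq q 5F 3F) refl q
  offDiagonal 5F 4F _ = solve 1 (λ q → offDiagonal-eq q 5F 4F) refl q
  offDiagonal 5F 5F i≢j = ⊥-elim (i≢j refl)

  module _ (q≢0 : q ≢ 0ℚ) (q-1≢0 : q - 1ℚ ≢ 0ℚ) (s≢0 : s ≢ 0ℚ) where
    infixl 7 _⊛_
    _⊛_ : ∀ {a b} → a ≢ 0ℚ → b ≢ 0ℚ → a * b ≢ 0ℚ
    _⊛_ = *-≢0

    2≢0 : 2# ≢ 0ℚ
    2≢0 ()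

    n≢0 : n ≢ 0ℚ
    n≢0 = 2≢0 ⊛ q≢0 ⊛ q≢0 ⊛ q≢0 ⊛ q≢0 ⊛ q≢0 ⊛ s≢0

    -- The scalar of A_j on the constants is the valency of R_j: 1 for j = 0, otherwise a product of
    -- factors q, q - 1 and q + 1. Its not vanishing is what shows that R_j is nonempty.
    valency≢0 : ∀ j → dot (adjacency j) (χ 0F) ≢ 0ℚ
    valency≢0 0F = (λ ()) ∘ trans (sym (solve 1 (λ q → valency-eq q 0F) refl q))
    valency≢0 1F = (q-1≢0 ⊛ s≢0 ⊛ s≢0) ∘ trans (sym (solve 1 (λ q → valency-eq q 1F) refl q))
    valency≢0 2F = q-1≢0 ∘ trans (sym (solve 1 (λ q → valency-eq q 2F) refl q))
    valency≢0 3F = (q-1≢0 ⊛ s≢0 ⊛ q-1≢0 ⊛ s≢0) ∘ trans (sym (solve 1 (λ q → valency-eq q 3F) refl q))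
    valency≢0 4F = (q≢0 ⊛ q-1≢0 ⊛ s≢0 ⊛ q-1≢0 ⊛ q-1≢0) ∘ trans (sym (solve 1 (λ q → valency-eq q 4F) refl q))
    valency≢0 5F = (q≢0 ⊛ q-1≢0 ⊛ s≢0 ⊛ q-1≢0) ∘ trans (sym (solve 1 (λ q → valency-eq q 5F) refl q))

    -- The diagonal entry of n E_j is 2 (q + 1) times the rank of E_j, since |𝒳| = q⁵ and n = 2 q⁵
    -- (q + 1). It serves to show that E_j is not the zero matrix.
    multiplicity≢0 : ∀ j → dot (G j) (relationEntries 0F) ≢ 0ℚ
    multiplicity≢0 0F = (2≢0 ⊛ s≢0) ∘ trans (sym (solve 1 (λ q → multiplicity-eq q 0F) refl q))
    multiplicity≢0 1F = (2≢0 ⊛ s≢0 ⊛ q-1≢0 ⊛ s≢0 ⊛ s≢0) ∘ trans (sym (solve 1 (λ q → multiplicity-eq q 1F) refl q))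
    multiplicity≢0 2F = (2≢0 ⊛ q≢0 ⊛ q≢0 ⊛ q≢0 ⊛ q-1≢0 ⊛ s≢0) ∘ trans (sym (solve 1 (λ q → multiplicity-eq q 2F) refl q))
    multiplicity≢0 3F = (2≢0 ⊛ s≢0 ⊛ q≢0 ⊛ q-1≢0 ⊛ q-1≢0 ⊛ s≢0) ∘ trans (sym (solve 1 (λ q → multiplicity-eq q 3F) refl q))
    multiplicity≢0 4F = (q≢0 ⊛ q≢0 ⊛ q-1≢0 ⊛ q-1≢0 ⊛ q-1≢0 ⊛ s≢0) ∘ trans (sym (solve 1 (λ q → multiplicity-eq q 4F) refl q))
    multiplicity≢0 5F = (q≢0 ⊛ q≢0 ⊛ s≢0 ⊛ q-1≢0 ⊛ q-1≢0 ⊛ s≢0) ∘ trans (sym (solve 1 (λ q → multiplicity-eq q 5F) refl q))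

-- From the product table to the association scheme.

∑-≢0 : ∀ n (f : Fin n → ℚ) → ∑ f ≢ 0ℚ → Σ (Fin n) λ i → f i ≢ 0ℚ
∑-≢0 n f ∑≢0 with Finₚ.any? (λ i → ¬? (f i ℚₚ.≟ 0ℚ))
... | yes p = p
... | no ¬p = ⊥-elim (∑≢0 (Summation.∑-zero λ i →
  decidable-stable (f i ℚₚ.≟ 0ℚ) (λ fi≢0 → ¬p (i , fi≢0))))

does-true⁻ : {P : Set} (p? : Dec P) → does p? ≡ true → P
does-true⁻ (yes p) _ = p

indicator≢0 : ∀ b → (if b then 1ℚ else 0ℚ) ≢ 0ℚ → b ≡ true
indicator≢0 true _ = refl
indicator≢0 false 0≢0 = ⊥-elim (0≢0 refl)

0≢1ℚ : 0ℚ ≢ 1ℚ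
0≢1ℚ ()

idM-1 : ∀ {n} {x y : Fin n} → idM x y ≡ 1ℚ → x ≡ y
idM-1 {x = x} {y} e with x Fin.≟ y
... | yes x≡y = x≡y
... | no _ = ⊥-elim (0≢1ℚ e)

relationEntries-diagonal : ∀ q i → Lin.cI (ℚForm.relationEntries q i) ≡ 1ℚ → i ≡ 0F
relationEntries-diagonal q 0F _ = refl
relationEntries-diagonal q 1F ()
relationEntries-diagonal q 2F ()
relationEntries-diagonal q 3F ()
relationEntries-diagonal q 4F ()
relationEntries-diagonal q 5F ()

SchemeConclusion : (q N : ℕ) → (Fin 6 → Fin N → Fin N → Bool) → Set
SchemeConclusion q N R =
  IsSymmetricScheme N 5 R × IsImprimitive N 5 R ×
  Σ (Fin 6 → Mat N) λ E → ArePrimitiveIdempotents N 5 (adj ∘ R) E ×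
    (∀ j x y → adj (R j) x y ≡ ∑ (λ i → Eigen.Pmat q i j Rat.* E i x y)) ×
    (∀ j x y → ι (ℤ.pos N) Rat.* E j x y ≡ ∑ (λ i → Eigen.Qmat q i j Rat.* adj (R i) x y))

-- The geometry enters only through the class `cls x y` of a pair, the values of the six matrices on
-- each class, and the products assumed in `Conclusion`. The rational `q` stays a variable, tied to
-- `q₀` by `q-ι`.
module SchemeFromProducts (q₀ N : ℕ) (q : ℚ) (q-ι : q ≡ ι (ℤ.pos q₀)) (R : Fin 6 → Fin N → Fin N → Bool) (cls : Fin N → Fin N → Fin 6)
  (K M L D : Mat N)
  (R-cls : ∀ j x y → R j x y ≡ does (j Fin.≟ cls x y))
  (cls-sym : ∀ x y → cls x y ≡ cls y x)
  (entries-cls : ∀ x y → SixMatrices.entries q K M L D x y ≡ ℚForm.relationEntries q (cls x y))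
  (x₀ : Fin N)
  where
  open Rat using (_*_)
  open Eigenmatrices
  open ℚForm q
  open Summation
  open Size N

  open SixMatrices q K M L D

  entries-sym : ∀ x y → entries x y ≡ entries y x
  entries-sym x y = trans (entries-cls x y) (trans (cong relationEntries (cls-sym x y)) (sym (entries-cls y x)))

  idM-cls : ∀ x y → idM x y ≡ Lin.cI (relationEntries (cls x y))
  idM-cls x y = cong Lin.cI (entries-cls x y)

  K-cls : ∀ {x y i} → cls x y ≡ i → K x y ≡ Lin.cK (relationEntries i)
  K-cls {x} {y} e = trans (cong Lin.cK (entries-cls x y)) (cong (Lin.cK ∘ relationEntries) e)

  val-cls : ∀ c x y → val c x y ≡ dot c (relationEntries (cls x y))
  val-cls c x y = cong (dot c) (entries-cls x y)

  A : Fin 6 → Mat N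
  A j = adj (R j)

  -- Pairing the rows of `adjacency` with those of `relationEntries` by `dot` gives the identity
  -- table; `indicator` checks its 36 entries.
  A-val : ∀ j x y → A j x y ≡ val (adjacency j) x y
  A-val j x y = trans (cong (λ b → if b then 1ℚ else 0ℚ) (R-cls j x y))
      (trans (indicator j (cls x y)) (sym (val-cls (adjacency j) x y)))
    where
    indicator : ∀ j i → (if does (j Fin.≟ i) then 1ℚ else 0ℚ) ≡ dot (adjacency j) (relationEntries i)
    indicator = by-six
      (by-six refl refl refl refl refl refl) (by-six refl refl refl refl refl refl)
      (by-six refl refl refl refl refl refl) (by-six refl refl refl refl refl refl)
      (by-six refl refl refl refl refl refl) (by-six refl refl refl refl refl refl)

  module Conclusion
    (n⁻¹ : ℚ) (n⁻¹*n : n⁻¹ * n ≡ 1ℚ)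
    (q≢0 : q ≢ 0ℚ) (q-1≢0 : q - 1ℚ ≢ 0ℚ) (s≢0 : s ≢ 0ℚ)
    (KK : ∀ x y → (K ·M K) x y ≡ q * K x y)
    (KM : ∀ x y → (K ·M M) x y ≡ 1ℚ)
    (KD : ∀ x y → (K ·M D) x y ≡ L x y)
    (MM : ∀ x y → (M ·M M) x y ≡ val mm x y)
    (DM : ∀ x y → (D ·M M) x y ≡ val md x y)
    (DD : ∀ x y → (D ·M D) x y ≡ val dd x y)
    (K-trans : ∀ x y z → K x y ≡ 1ℚ → K y z ≡ 1ℚ → K x z ≡ 1ℚ)
    where
    open Products
      (λ x y → cong Lin.cK (entries-sym x y)) (λ x y → cong Lin.cM (entries-sym x y))
      (λ x y → cong Lin.cL (entries-sym x y)) (λ x y → cong Lin.cD (entries-sym x y))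
      KK KM KD MM DM DD
      renaming (E to nE)
    open CharacterIdentities q
    module Id (x y : Fin N) = SchemeIdentities q (I x y) (K x y) (M x y) (L x y) (D x y)

    n⁻¹*n* : ∀ a → n⁻¹ * (n * a) ≡ a
    n⁻¹*n* a = trans (sym (ℚₚ.*-assoc n⁻¹ n a))
      (trans (cong (_* a) n⁻¹*n) (ℚₚ.*-identityˡ a))

    E : Fin 6 → Mat N
    E j x y = n⁻¹ * nE j x y

    order : ι (ℤ.pos N) ≡ q * q * q * q * q
    order = trans (sym (∑-1 N)) (JJ x₀ x₀)

    ∑-scale : ∀ c (f g : Fin 6 → ℚ) → ∑ (λ i → f i * (c * g i)) ≡ c * ∑ (λ i → f i * g i)
    ∑-scale c f g = trans (∑-cong (λ i → lem (f i) c (g i))) (Size.∑-*ˡ 6 c (λ i → f i * g i))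
      where
      lem : ∀ f c g → f * (c * g) ≡ c * (f * g)
      lem = solve-∀ ℚ-ring

    Pmat-q : ∀ i j → Eigen.Pmat q₀ i j ≡ Evalℚ.eval q (Pentry i j)
    Pmat-q i j = subst (λ q → Eigen.Pmat q₀ i j ≡ Evalℚ.eval q (Pentry i j)) (sym q-ι) (Pmat-entry q₀ i j)

    n*Qmat-q : ∀ i j → n * Eigen.Qmat q₀ i j ≡ Evalℚ.eval q (scaledQ i j)
    n*Qmat-q i j = subst (λ q → ℚForm.n q * Eigen.Qmat q₀ i j ≡ Evalℚ.eval q (scaledQ i j)) (sym q-ι) (n*Qmat q₀ i j)

    A-eigen : ∀ j x y → A j x y ≡ ∑ (λ i → Eigen.Pmat q₀ i j * E i x y)
    A-eigen j x y = begin
      A j x y                                                ≡⟨ A-val j x y ⟩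
      val (adjacency j) x y                                  ≡⟨ n⁻¹*n* _ ⟨
      n⁻¹ * (n * val (adjacency j) x y)                      ≡⟨ cong (n⁻¹ *_) (Id.P-identity x y j) ⟩
      n⁻¹ * ∑ (λ i → Evalℚ.eval q (Pentry i j) * nE i x y)   ≡⟨ ∑-scale n⁻¹ (λ i → Evalℚ.eval q (Pentry i j)) (λ i → nE i x y) ⟨
      ∑ (λ i → Evalℚ.eval q (Pentry i j) * E i x y)          ≡⟨ ∑-cong (λ i → cong (_* E i x y) (sym (Pmat-q i j))) ⟩
      ∑ (λ i → Eigen.Pmat q₀ i j * E i x y)                  ∎
      where open ≡-Reasoning

    E-eigen : ∀ j x y → q * q * q * q * q * E j x y ≡ ∑ (λ i → Eigen.Qmat q₀ i j * A i x y)
    E-eigen j x y = begin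
      q * q * q * q * q * (n⁻¹ * nE j x y)                   ≡⟨ swap (q * q * q * q * q) n⁻¹ (nE j x y) ⟩
      n⁻¹ * (q * q * q * q * q * nE j x y)                   ≡⟨ cong (n⁻¹ *_) (Id.Q-identity x y j) ⟩
      n⁻¹ * ∑ (λ i → Evalℚ.eval q (scaledQ i j) * val (adjacency i) x y)
        ≡⟨ cong (n⁻¹ *_) (∑-cong (λ i → trans
             (cong₂ _*_ (sym (n*Qmat-q i j)) (sym (A-val i x y)))
             (lem n (Eigen.Qmat q₀ i j) (A i x y)))) ⟩
      n⁻¹ * ∑ (λ i → Eigen.Qmat q₀ i j * (n * A i x y))
        ≡⟨ cong (n⁻¹ *_) (∑-scale n (λ i → Eigen.Qmat q₀ i j) (λ i → A i x y)) ⟩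
      n⁻¹ * (n * ∑ (λ i → Eigen.Qmat q₀ i j * A i x y))      ≡⟨ n⁻¹*n* _ ⟩
      ∑ (λ i → Eigen.Qmat q₀ i j * A i x y)                  ∎
      where
      open ≡-Reasoning
      swap : ∀ a b c → a * (b * c) ≡ b * (a * c)
      swap = solve-∀ ℚ-ring
      lem : ∀ n a b → n * a * b ≡ a * (n * b)
      lem = solve-∀ ℚ-ring

    val-·M-E : ∀ c j x y → (val c ·M E j) x y ≡ dot c (χ j) * E j x y
    val-·M-E c j x y = begin
      (val c ·M E j) x y              ≡⟨ ·M-scaleʳ n⁻¹ (val c) (nE j) x y ⟩
      n⁻¹ * (val c ·M nE j) x y       ≡⟨ cong (n⁻¹ *_) (val-E j c x y) ⟩
      n⁻¹ * (dot c (χ j) * nE j x y)  ≡⟨ swap n⁻¹ (dot c (χ j)) (nE j x y) ⟩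
      dot c (χ j) * E j x y           ∎
      where
      open ≡-Reasoning
      swap : ∀ a b c → a * (b * c) ≡ b * (a * c)
      swap = solve-∀ ℚ-ring

    E-orthogonal : ∀ i j x y → (E i ·M E j) x y ≡ (if does (i Fin.≟ j) then E i x y else 0ℚ)
    E-orthogonal i j x y = trans (·M-scaleˡ n⁻¹ (nE i) (E j) x y)
        (trans (cong (n⁻¹ *_) (val-·M-E (G i) j x y)) (evaluate (i Fin.≟ j)))
      where
      evaluate : (i≟j : Dec (i ≡ j)) → n⁻¹ * (dot (G i) (χ j) * E j x y) ≡ (if does i≟j then E i x y else 0ℚ)
      evaluate (yes refl) = trans (cong (λ z → n⁻¹ * (z * E i x y)) (diagonal i)) (n⁻¹*n* (E i x y))
      evaluate (no i≢j) = trans (cong (λ z → n⁻¹ * (z * E j x y)) (offDiagonal i j i≢j))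
        (trans (cong (n⁻¹ *_) (ℚₚ.*-zeroˡ (E j x y))) (ℚₚ.*-zeroʳ n⁻¹))

    cls-refl : ∀ x → cls x x ≡ 0F
    cls-refl x = relationEntries-diagonal q (cls x x) (trans (sym (idM-cls x x)) (idM-refl x))

    n⁻¹≢0 : n⁻¹ ≢ 0ℚ
    n⁻¹≢0 e = 0≢1ℚ (trans (sym (trans (cong (_* n) e) (ℚₚ.*-zeroˡ n))) n⁻¹*n)

    E-nonzero : ∀ j → E j x₀ x₀ ≢ 0ℚ
    E-nonzero j e = *-≢0 n⁻¹≢0 (multiplicity≢0 q≢0 q-1≢0 s≢0 j)
      (trans (cong (λ i → n⁻¹ * dot (G j) (relationEntries i)) (sym (cls-refl x₀)))
        (trans (cong (n⁻¹ *_) (sym (val-cls (G j) x₀ x₀))) e))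

    E-sum : ∀ x y → ∑ (λ i → E i x y) ≡ idM x y
    E-sum x y = trans (Size.∑-*ˡ 6 n⁻¹ (λ i → nE i x y))
      (trans (cong (n⁻¹ *_) (Id.unit-identity x y)) (n⁻¹*n* _))

    E-inBM : ∀ j x y → E j x y ≡ ∑ (λ i → n⁻¹ * 2# * s * Eigen.Qmat q₀ i j * A i x y)
    E-inBM j x y = begin
      E j x y                                                ≡⟨ n⁻¹*n* _ ⟨
      n⁻¹ * (n * E j x y)                                    ≡⟨ lem n⁻¹ q (E j x y) ⟩
      c * (q * q * q * q * q * E j x y)                      ≡⟨ cong (c *_) (E-eigen j x y) ⟩
      c * ∑ (λ i → Eigen.Qmat q₀ i j * A i x y)              ≡⟨ Size.∑-*ˡ 6 c (λ i → Eigen.Qmat q₀ i j * A i x y) ⟨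
      ∑ (λ i → c * (Eigen.Qmat q₀ i j * A i x y))
        ≡⟨ ∑-cong (λ i → sym (ℚₚ.*-assoc c (Eigen.Qmat q₀ i j) (A i x y))) ⟩
      ∑ (λ i → c * Eigen.Qmat q₀ i j * A i x y)              ∎
      where
      open ≡-Reasoning
      open Rat using (_+_)
      -- This is 1 / q⁵, the reciprocal of |𝒳|, because n = 2 q⁵ (q + 1).
      c = n⁻¹ * 2# * s
      lem : ∀ w q e → w * ((1ℚ + 1ℚ) * q * q * q * q * q * (q + 1ℚ) * e) ≡
                      w * (1ℚ + 1ℚ) * (q + 1ℚ) * (q * q * q * q * q * e)
      lem = solve-∀ ℚ-ring

    R⇒cls : ∀ {j x y} → R j x y ≡ true → cls x y ≡ j
    R⇒cls {j} {x} {y} e = sym (does-true⁻ (j Fin.≟ cls x y) (trans (sym (R-cls j x y)) e))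

    cls⇒R : ∀ {j x y} → cls x y ≡ j → R j x y ≡ true
    cls⇒R {j} {x} {y} e = trans (R-cls j x y) (dec-true (j Fin.≟ cls x y) (sym e))

    A-E : ∀ i l x y → (A i ·M E l) x y ≡ dot (adjacency i) (χ l) * E l x y
    A-E i l x y = trans (·M-congʳ (E l) (A-val i) x y) (val-·M-E (adjacency i) l x y)

    -- The image of E 0 is the constant functions, on which A j acts as its valency.
    related : ∀ j → Σ (Fin N) λ y → R j x₀ y ≡ true
    related j = proj₁ nonzeroTerm , indicator≢0 (R j x₀ (proj₁ nonzeroTerm)) (λ e →
        proj₂ nonzeroTerm (trans (cong (_* E 0F (proj₁ nonzeroTerm) x₀) e)
          (ℚₚ.*-zeroˡ (E 0F (proj₁ nonzeroTerm) x₀))))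
      where
      nonzeroTerm : Σ (Fin N) λ z → A j x₀ z * E 0F z x₀ ≢ 0ℚ
      nonzeroTerm = ∑-≢0 N (λ z → A j x₀ z * E 0F z x₀) (λ e →
        *-≢0 (valency≢0 q≢0 q-1≢0 s≢0 j) (E-nonzero 0F) (trans (sym (A-E j 0F x₀ x₀)) e))

    -- The intersection number as a spectral sum: A_j is expanded in the E_l, A_i acts on each by a
    -- scalar, and E_l is evaluated on R_k. Hence the entries of A_i A_j depend only on the class of
    -- the pair.
    product : Fin 6 → Fin 6 → Fin 6 → ℚ
    product i j k = ∑ (λ l → Eigen.Pmat q₀ l j *
      (dot (adjacency i) (χ l) * (n⁻¹ * dot (G l) (relationEntries k))))

    A-A : ∀ i j x y → (A i ·M A j) x y ≡ product i j (cls x y)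
    A-A i j x y = begin
      ∑ (λ z → A i x z * A j z y)
        ≡⟨ ∑-cong (λ z → trans (cong (A i x z *_) (A-eigen j z y)) (sym (Size.∑-*ˡ 6 (A i x z) (λ l → p l * E l z y)))) ⟩
      ∑ (λ z → ∑ (λ l → A i x z * (p l * E l z y)))   ≡⟨ ∑-swap N 6 (λ z l → A i x z * (p l * E l z y)) ⟩
      ∑ (λ l → ∑ (λ z → A i x z * (p l * E l z y)))
        ≡⟨ ∑-cong (λ l → trans (·M-scaleʳ (p l) (A i) (E l) x y) (cong (p l *_) (trans (A-E i l x y)
             (cong (λ v → dot (adjacency i) (χ l) * (n⁻¹ * v)) (val-cls (G l) x y))))) ⟩
      product i j (cls x y)                           ∎
      where
      open ≡-Reasoning
      p : Fin 6 → ℚ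
      p l = Eigen.Pmat q₀ l j

    count : ∀ i j x y → ι (ℤ.pos (countF (λ z → R i x z ∧ R j z y))) ≡ product i j (cls x y)
    count i j x y = trans (sym (∑-countF N (λ z → R i x z ∧ R j z y)))
      (trans (∑-cong (λ z → ∧-indicator (R i x z) (R j z y))) (A-A i j x y))
      where
      ∧-indicator : ∀ a b → (if a ∧ b then 1ℚ else 0ℚ) ≡ (if a then 1ℚ else 0ℚ) * (if b then 1ℚ else 0ℚ)
      ∧-indicator true true = refl
      ∧-indicator true false = refl
      ∧-indicator false true = refl
      ∧-indicator false false = refl

    -- A walk along R_2 stays inside one class of the equivalence relation `K`. Points related by
    -- R_1 lie in different classes, so the graph of R_2 is disconnected.
    K-star : ∀ {x y} → Star (λ a b → R 2F a b ≡ true) x y → K x y ≡ 1ℚ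
    K-star {x} Star.ε = K-cls (cls-refl x)
    K-star (_◅_ {x} {z} {y} e es) = K-trans x z y (K-cls (R⇒cls e)) (K-star es)

    conclusion : SchemeConclusion q₀ N R
    conclusion =
      record
        { diagonal = λ x y → trans (R-cls 0F x y) (diagonal-cls x y)
        ; partition = λ x y → cls x y , cls⇒R refl , λ j e → sym (R⇒cls e)
        ; nonempty = λ i → x₀ , related i
        ; symmetric = λ i x y → trans (R-cls i x y) (trans (cong (λ c → does (i Fin.≟ c)) (cls-sym x y)) (sym (R-cls i y x)))
        -- The natural number is counted at one sample pair of R_k; `product` depends on the class
        -- only, so every other pair of R_k gives the same count.
        ; intersection = λ i j k → countF (λ z → R i x₀ z ∧ R j z (proj₁ (related k))) , λ x y e →
            ι-injective (trans (count i j x y) (trans (cong (product i j) (trans (R⇒cls e) (sym (R⇒cls (proj₂ (related k))))))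
              (sym (count i j x₀ (proj₁ (related k))))))
        } ,
      (2F , (λ ()) , x₀ , proj₁ (related 1F) , λ star →
        0≢1ℚ (trans (sym (K-cls (R⇒cls (proj₂ (related 1F))))) (K-star star))) ,
      E ,
      record
        { inBM = λ j → (λ i → n⁻¹ * 2# * s * Eigen.Qmat q₀ i j) , E-inBM j
        ; orthIdem = E-orthogonal
        ; nonzero = λ i → x₀ , x₀ , E-nonzero i
        ; sumId = E-sum
        } ,
      A-eigen ,
      λ j x y → trans (cong (_* E j x y) order) (E-eigen j x y)
      where
      diagonal-cls : ∀ x y → does (0F Fin.≟ cls x y) ≡ does (x Fin.≟ y)
      diagonal-cls x y = does-⇔
        (mk⇔ (λ 0≡cls → idM-1 (trans (idM-cls x y) (cong (Lin.cI ∘ relationEntries) (sym 0≡cls))))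
             (λ { refl → sym (cls-refl x) }))
        (0F Fin.≟ cls x y) (x Fin.≟ y)

-- Arithmetic of finite fields.

lookup-unique : ∀ {A : Set} {xs : List A} → Unique xs → ∀ i j → List.lookup xs i ≡ List.lookup xs j → i ≡ j
lookup-unique (_ ∷ _) zero zero _ = refl
lookup-unique (x∉ ∷ _) zero (suc j) e = ⊥-elim (All.lookup x∉ (∈-lookup j) e)
lookup-unique (x∉ ∷ _) (suc i) zero e = ⊥-elim (All.lookup x∉ (∈-lookup i) (sym e))
lookup-unique (_ ∷ u) (suc i) (suc j) e = cong suc (lookup-unique u i j e)

prime∤! : ∀ {p} → Prime p → ∀ k → k ℕ.< p → p ∤ k !
prime∤! {p} pp zero _ p∣1 with refl ← ∣.∣1⇒≡1 p∣1 with () ← prime⇒nonTrivial pp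
prime∤! {p} pp (suc k) k<p p∣ with euclidsLemma (suc k) (k !) pp p∣
... | inj₁ p∣suc = ℕₚ.<⇒≱ k<p (∣.∣⇒≤ p∣suc)
... | inj₂ p∣k! = prime∤! pp k (ℕₚ.<-trans (ℕₚ.n<1+n k) k<p) p∣k!

-- The prime divides p! = C(p,k) k! (p - k)! but neither of the two factorials, both being of
-- numbers below p.
prime∣C : ∀ {p} → Prime p → ∀ k → 0 ℕ.< k → k ℕ.< p → p ∣ p Comb.C k
prime∣C {zero} pp k _ ()
prime∣C {suc p-1} pp k 0<k k<p with euclidsLemma (p Comb.C k) (k ! ℕ.* (p ℕ.∸ k) !) pp p∣product
  where
  p = suc p-1
  k≤p = ℕₚ.<⇒≤ k<p
  instance _ = k ℕₚ.!* (p ℕ.∸ k) !≢0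
  p∣product : p ∣ (p Comb.C k) ℕ.* (k ! ℕ.* (p ℕ.∸ k) !)
  p∣product = subst (p ∣_) (sym (trans (cong (ℕ._* (k ! ℕ.* (p ℕ.∸ k) !)) (Comb.nCk≡n!/k![n-k]! k≤p))
    (DivMod.m/n*n≡m (Comb.k![n∸k]!∣n! k≤p)))) (∣.m∣m*n (p-1 !))
... | inj₁ p∣C = p∣C
... | inj₂ p∣k!* with euclidsLemma (k !) ((suc p-1 ℕ.∸ k) !) pp p∣k!*
... | inj₁ p∣k! = ⊥-elim (prime∤! pp k k<p p∣k!)
... | inj₂ p∣! = ⊥-elim (prime∤! pp (suc p-1 ℕ.∸ k) (ℕₚ.∸-monoʳ-< 0<k (ℕₚ.<⇒≤ k<p)) p∣!)

module _ (M : CommutativeMonoid 0ℓ 0ℓ) where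
  open CommutativeMonoid M
  open Algebra.Properties.CommutativeMonoid.Sum M using (sum; sum-cong-≋; sum-replicate-zero)

  sum-single : ∀ {n} (f : Fin n → Carrier) i → (∀ j → j ≢ i → f j ≈ ε) → sum f ≈ f i
  sum-single {suc n} f zero e = CommutativeMonoid.trans M
    (∙-congˡ (CommutativeMonoid.trans M (sum-cong-≋ (λ j → e (suc j) (λ ()))) (sum-replicate-zero n))) (identityʳ _)
  sum-single {suc n} f (suc i) e = CommutativeMonoid.trans M
    (∙-cong (e zero (λ ())) (sum-single (f ∘ suc) i (λ j j≢i → e (suc j) (j≢i ∘ Finₚ.suc-injective)))) (identityˡ _)

module FieldArithmetic (F : FiniteField) where
  open FiniteField F public
  open ≡-Reasoning

  commutativeRing : CommutativeRing 0ℓ 0ℓ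
  commutativeRing = record { isCommutativeRing = isCommutativeRing }

  open CommutativeRing commutativeRing public
    using (+-comm; +-assoc; +-identityˡ; +-identityʳ; *-comm; *-assoc; *-identityˡ; *-identityʳ;
      zeroˡ; zeroʳ; distribˡ; distribʳ; -‿inverseˡ; -‿inverseʳ;
      +-commutativeMonoid; *-commutativeMonoid; commutativeSemiring; semiring; ring; +-abelianGroup)
  open Algebra.Properties.Semiring.Mult semiring using (×-homo-+; ×1-homo-*; ×-assoc-*)
    renaming (_×_ to infixr 8 _•_; ×-homo-1 to 1•) public
  open Algebra.Properties.Semiring.Exp semiring using (_^_; ^-homo-*; ^-assocʳ) public
  open Algebra.Properties.CommutativeSemiring.Exp commutativeSemiring using (^-distrib-*) public
  open Algebra.Properties.Ring ring using (-‿distribˡ-*; -‿distribʳ-*; -‿involutive; -0#≈0#)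
  open Algebra.Properties.AbelianGroup +-abelianGroup using (⁻¹-∙-comm)

  -- The canonical map from ℤ supplies coefficients with decidable equality for deciding polynomial
  -- identities in the field.
  fromℤ : ℤ → Carrier
  fromℤ (ℤ.pos n) = n • 1#
  fromℤ -[1+ n ] = - (suc n • 1#)

  fromℤ-neg : ∀ a → fromℤ (Int.- a) ≡ - fromℤ a
  fromℤ-neg (ℤ.pos zero) = sym -0#≈0#
  fromℤ-neg (ℤ.pos (suc n)) = refl
  fromℤ-neg -[1+ n ] = sym (-‿involutive _)

  fromℤ-⊖ : ∀ m n → fromℤ (m Int.⊖ n) ≡ m • 1# + - (n • 1#)
  fromℤ-⊖ m zero = trans (cong fromℤ (ℤₚ.⊖-≥ {m} {0} ℕ.z≤n)) (sym (trans (cong (m • 1# +_) -0#≈0#) (+-identityʳ _)))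
  fromℤ-⊖ zero (suc n) = sym (+-identityˡ _)
  fromℤ-⊖ (suc m) (suc n) = trans (cong fromℤ (ℤₚ.[1+m]⊖[1+n]≡m⊖n m n)) (trans (fromℤ-⊖ m n) (sym (begin
    1# + m • 1# + - (1# + n • 1#)            ≡⟨ cong (1# + m • 1# +_) (sym (⁻¹-∙-comm 1# (n • 1#))) ⟩
    1# + m • 1# + (- 1# + - (n • 1#))        ≡⟨ +-assoc _ _ _ ⟨
    1# + m • 1# + - 1# + - (n • 1#)          ≡⟨ cong (_+ - (n • 1#)) (trans (cong (_+ - 1#) (+-comm 1# (m • 1#))) (+-assoc _ _ _)) ⟩
    m • 1# + (1# + - 1#) + - (n • 1#)        ≡⟨ cong (λ z → m • 1# + z + - (n • 1#)) (-‿inverseʳ 1#) ⟩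
    m • 1# + 0# + - (n • 1#)                 ≡⟨ cong (_+ - (n • 1#)) (+-identityʳ _) ⟩
    m • 1# + - (n • 1#)                      ∎)))

  fromℤ-+ : ∀ a b → fromℤ (a Int.+ b) ≡ fromℤ a + fromℤ b
  fromℤ-+ (ℤ.pos m) (ℤ.pos n) = ×-homo-+ 1# m n
  fromℤ-+ (ℤ.pos m) -[1+ n ] = fromℤ-⊖ m (suc n)
  fromℤ-+ -[1+ m ] (ℤ.pos n) = trans (fromℤ-⊖ n (suc m)) (+-comm _ _)
  fromℤ-+ -[1+ m ] -[1+ n ] = trans (cong (λ k → - (k • 1#)) (cong suc (sym (ℕₚ.+-suc m n))))
    (trans (cong -_ (×-homo-+ 1# (suc m) (suc n))) (sym (⁻¹-∙-comm _ _)))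

  fromℤ-pos* : ∀ m b → fromℤ (ℤ.pos m Int.* b) ≡ m • 1# * fromℤ b
  fromℤ-pos* m (ℤ.pos n) = trans (cong fromℤ (sym (ℤₚ.pos-* m n))) (×1-homo-* m n)
  fromℤ-pos* m -[1+ n ] = begin
    fromℤ (ℤ.pos m Int.* -[1+ n ])               ≡⟨ cong fromℤ (sym (ℤₚ.neg-distribʳ-* (ℤ.pos m) (ℤ.pos (suc n)))) ⟩
    fromℤ (Int.- (ℤ.pos m Int.* ℤ.pos (suc n)))  ≡⟨ fromℤ-neg (ℤ.pos m Int.* ℤ.pos (suc n)) ⟩
    - fromℤ (ℤ.pos m Int.* ℤ.pos (suc n))        ≡⟨ cong -_ (fromℤ-pos* m (ℤ.pos (suc n))) ⟩
    - (m • 1# * suc n • 1#)                      ≡⟨ -‿distribʳ-* _ _ ⟩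
    m • 1# * - (suc n • 1#)                      ∎

  fromℤ-* : ∀ a b → fromℤ (a Int.* b) ≡ fromℤ a * fromℤ b
  fromℤ-* (ℤ.pos m) b = fromℤ-pos* m b
  fromℤ-* -[1+ m ] b = begin
    fromℤ (-[1+ m ] Int.* b)                     ≡⟨ cong fromℤ (sym (ℤₚ.neg-distribˡ-* (ℤ.pos (suc m)) b)) ⟩
    fromℤ (Int.- (ℤ.pos (suc m) Int.* b))        ≡⟨ fromℤ-neg (ℤ.pos (suc m) Int.* b) ⟩
    - fromℤ (ℤ.pos (suc m) Int.* b)              ≡⟨ cong -_ (fromℤ-pos* (suc m) b) ⟩
    - (suc m • 1# * fromℤ b)                     ≡⟨ -‿distribˡ-* _ _ ⟩
    - (suc m • 1#) * fromℤ b                     ∎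

  -- Agrees with fromℤ; sending 1 to 1# on the nose lets the solver see 1# as a constant.
  embed : ℤ → Carrier
  embed (ℤ.pos 1) = 1#
  embed a = fromℤ a

  embed-fromℤ : ∀ a → embed a ≡ fromℤ a
  embed-fromℤ (ℤ.pos 0) = refl
  embed-fromℤ (ℤ.pos 1) = sym (1• 1#)
  embed-fromℤ (ℤ.pos (suc (suc n))) = refl
  embed-fromℤ -[1+ n ] = refl

  embed-homomorphism : Int.+-*-rawRing ACR.-Raw-AlmostCommutative⟶ ACR.fromCommutativeRing commutativeRing
  embed-homomorphism = record
    { ⟦_⟧ = embed
    ; +-homo = λ a b → trans (embed-fromℤ (a Int.+ b)) (trans (fromℤ-+ a b) (sym (cong₂ _+_ (embed-fromℤ a) (embed-fromℤ b))))
    ; *-homo = λ a b → trans (embed-fromℤ (a Int.* b)) (trans (fromℤ-* a b) (sym (cong₂ _*_ (embed-fromℤ a) (embed-fromℤ b))))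
    ; -‿homo = λ a → trans (embed-fromℤ (Int.- a)) (trans (fromℤ-neg a) (cong -_ (sym (embed-fromℤ a))))
    ; 0-homo = refl
    ; 1-homo = refl }

  embed-≟ : ∀ a b → Data.Maybe.Maybe (embed a ≡ embed b)
  embed-≟ a b = Data.Maybe.map (cong embed) (dec⇒maybe (a ℤₚ.≟ b))

  module Solver =
    Algebra.Solver.Ring Int.+-*-rawRing (ACR.fromCommutativeRing commutativeRing) embed-homomorphism embed-≟
  open Solver using (solve; _:=_; _:+_; _:*_; :-_; _:-_; con)

  *-cancel-0 : ∀ {a b} → a ≢ 0# → a * b ≡ 0# → b ≡ 0#
  *-cancel-0 {a} {b} a≢0 ab≡0 = begin
    b              ≡⟨ *-identityˡ b ⟨
    1# * b         ≡⟨ cong (_* b) (trans (sym aw≡1) (*-comm a w)) ⟩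
    w * a * b      ≡⟨ *-assoc w a b ⟩
    w * (a * b)    ≡⟨ cong (w *_) ab≡0 ⟩
    w * 0#         ≡⟨ zeroʳ w ⟩
    0#             ∎
    where
    w = proj₁ (inverse a a≢0)
    aw≡1 = proj₂ (inverse a a≢0)

  leftInverse : ∀ a → a ≢ 0# → Σ Carrier λ w → w ≢ 0# × w * a ≡ 1#
  leftInverse a a≢0 = w , (λ w≡0 → 0≢1 (trans (sym (zeroˡ a)) (trans (cong (_* a) (sym w≡0)) wa≡1))) , wa≡1
    where
    w = proj₁ (inverse a a≢0)
    wa≡1 : w * a ≡ 1#
    wa≡1 = trans (*-comm w a) (proj₂ (inverse a a≢0))

  *-≢0# : ∀ {a b} → a ≢ 0# → b ≢ 0# → a * b ≢ 0#
  *-≢0# a≢0 b≢0 ab≡0 = b≢0 (*-cancel-0 a≢0 ab≡0)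

  x-y≡0⇒x≡y : ∀ {x y} → x + - y ≡ 0# → x ≡ y
  x-y≡0⇒x≡y {x} {y} e = trans (solve 2 (λ x y → x := (x :+ :- y) :+ y) refl x y)
    (trans (cong (_+ y) e) (+-identityˡ y))

  x≡y⇒x-y≡0 : ∀ {x y} → x ≡ y → x + - y ≡ 0#
  x≡y⇒x-y≡0 {x} refl = -‿inverseʳ x

  *-cancelˡ : ∀ {a b c} → a ≢ 0# → a * b ≡ a * c → b ≡ c
  *-cancelˡ {a} {b} {c} a≢0 e = x-y≡0⇒x≡y (*-cancel-0 a≢0
    (trans (solve 3 (λ a b c → a :* (b :+ :- c) := a :* b :+ :- (a :* c)) refl a b c) (x≡y⇒x-y≡0 e)))

  ^-≢0 : ∀ {x} n → x ≢ 0# → x ^ n ≢ 0#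
  ^-≢0 zero _ = 0≢1 ∘ sym
  ^-≢0 (suc n) x≢0 = *-≢0# x≢0 (^-≢0 n x≢0)

  1^ : ∀ n → 1# ^ n ≡ 1#
  1^ zero = refl
  1^ (suc n) = trans (*-identityˡ _) (1^ n)

  -- The monic polynomial with lower coefficients cs, constant term first.
  monic : ∀ {d} → Vec Carrier d → Carrier → Carrier
  monic [] x = 1#
  monic (c ∷ cs) x = c + x * monic cs x

  -- Synthetic division by x - a: the coefficients are the Horner values at `a` of the successive
  -- tails.
  quotient : ∀ {d} → Vec Carrier (suc d) → Carrier → Vec Carrier d
  quotient (c ∷ []) a = []
  quotient (c ∷ cs@(_ ∷ _)) a = monic cs a ∷ quotient cs a

  monic-factor : ∀ {d} (cs : Vec Carrier (suc d)) a x →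
    monic cs x + - monic cs a ≡ (x + - a) * monic (quotient cs a) x
  monic-factor (c ∷ []) a x =
    solve 4 (λ o c a x → (c :+ x :* o) :+ :- (c :+ a :* o) := (x :+ :- a) :* o) refl 1# c a x
  monic-factor (c ∷ cs@(_ ∷ _)) a x = begin
    (c + x * f) + - (c + a * g)                  ≡⟨ solve 5 (λ c a x f g → (c :+ x :* f) :+ :- (c :+ a :* g) :=
                                                      (x :+ :- a) :* g :+ x :* (f :+ :- g)) refl c a x f g ⟩
    (x + - a) * g + x * (f + - g)                ≡⟨ cong (λ z → (x + - a) * g + x * z) (monic-factor cs a x) ⟩
    (x + - a) * g + x * ((x + - a) * h)          ≡⟨ solve 4 (λ a x g h → (x :+ :- a) :* g :+ x :* ((x :+ :- a) :* h) :=
                                                      (x :+ :- a) :* (g :+ x :* h)) refl a x g h ⟩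
    (x + - a) * (g + x * h)                      ∎
    where
    f = monic cs x
    g = monic cs a
    h = monic (quotient cs a) x

  -- Dividing by x - r(0) lowers the degree by one. The other given roots remain roots of the
  -- quotient, because their differences to r(0) are nonzero.
  monic-roots : ∀ {d} (cs : Vec Carrier d) (r : Fin (suc d) → Carrier) →
    (∀ i j → r i ≡ r j → i ≡ j) → ¬ (∀ i → monic cs (r i) ≡ 0#)
  monic-roots [] r inj root = 0≢1 (sym (root zero))
  monic-roots cs@(_ ∷ _) r inj root = monic-roots (quotient cs a) (r ∘ suc)
    (λ i j e → Finₚ.suc-injective (inj (suc i) (suc j) e))
    (λ i → *-cancel-0 {r (suc i) + - a}
      (λ e → Finₚ.0≢1+n (sym (inj (suc i) zero (x-y≡0⇒x≡y e))))
      (trans (sym (monic-factor cs a (r (suc i)))) (x≡y⇒x-y≡0 (trans (root (suc i)) (sym (root zero))))))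
    where
    a = r zero

  point : Fin size → Carrier
  point = List.lookup elements

  position : Carrier → Fin size
  position x = index (elements-complete x)

  point-position : ∀ x → point (position x) ≡ x
  point-position x = sym (lookup-index (elements-complete x))

  point-injective : ∀ {i j} → point i ≡ point j → i ≡ j
  point-injective = lookup-unique elements-unique _ _

  position-point : ∀ i → position (point i) ≡ i
  position-point i = point-injective (point-position (point i))

  permutation : (f g : Carrier → Carrier) → (∀ x → f (g x) ≡ x) → (∀ x → g (f x) ≡ x) → Perm.Permutation size size
  permutation f g fg gf = Perm.permutation (position ∘ f ∘ point) (position ∘ g ∘ point)
    (λ i → trans (cong (position ∘ f) (point-position (g (point i)))) (trans (cong position (fg (point i))) (position-point i)))
    (λ i → trans (cong (position ∘ g) (point-position (f (point i)))) (trans (cong position (gf (point i))) (position-point i)))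

  module _ (M : CommutativeMonoid 0ℓ 0ℓ) where
    open CommutativeMonoid M using (_≈_) renaming (Carrier to C; trans to ≈-trans; reflexive to ≈-reflexive)
    open Algebra.Properties.CommutativeMonoid.Sum M using (sum; sum-permute; sum-cong-≗)
    sum-reindex : (h : Carrier → C) (f g : Carrier → Carrier) → (∀ x → f (g x) ≡ x) → (∀ x → g (f x) ≡ x) →
                  sum (h ∘ point) ≈ sum (h ∘ f ∘ point)
    sum-reindex h f g fg gf = ≈-trans (sum-permute (h ∘ point) (permutation f g fg gf))
      (≈-reflexive (sum-cong-≗ (λ i → cong h (point-position (f (point i))))))

  module Add = Algebra.Properties.CommutativeMonoid.Sum +-commutativeMonoid
  module Mul = Algebra.Properties.CommutativeMonoid.Sum *-commutativeMonoid

  +-cancel-0 : ∀ {a b} → a ≡ a + b → b ≡ 0#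
  +-cancel-0 {a} {b} e = begin
    b                ≡⟨ solve 2 (λ a b → b := :- a :+ (a :+ b)) refl a b ⟩
    - a + (a + b)    ≡⟨ cong (- a +_) (sym e) ⟩
    - a + a          ≡⟨ -‿inverseˡ a ⟩
    0#               ∎

  -- Translation by 1 permutes the field, so it fixes the sum of all elements; yet it adds 1 to each
  -- of the `size` summands.
  size•1≡0 : size • 1# ≡ 0#
  size•1≡0 = +-cancel-0 {Add.sum point} (begin
    Add.sum point                              ≡⟨ sum-reindex +-commutativeMonoid id (_+ 1#) (_+ - 1#)
                                                    (λ x → solve 2 (λ x o → x :+ :- o :+ o := x) refl x 1#)
                                                    (λ x → solve 2 (λ x o → x :+ o :+ :- o := x) refl x 1#) ⟩
    Add.sum (λ i → point i + 1#)               ≡⟨ Add.∑-distrib-+ point (λ _ → 1#) ⟩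
    Add.sum point + Add.sum {size} (λ _ → 1#)  ≡⟨ cong (Add.sum point +_) (Add.sum-replicate size) ⟩
    Add.sum point + size • 1#                  ∎)

  product-≢0 : ∀ {n} (f : Fin n → Carrier) → (∀ i → f i ≢ 0#) → Mul.sum f ≢ 0#
  product-≢0 {zero} f f≢0 = 0≢1 ∘ sym
  product-≢0 {suc n} f f≢0 = *-≢0# (f≢0 zero) (product-≢0 (f ∘ suc) (f≢0 ∘ suc))

  ifZero : Carrier → Carrier → Carrier → Carrier
  ifZero x u v = if does (x ≟ 0#) then u else v

  ifZero-0 : ∀ {x u v} → x ≡ 0# → ifZero x u v ≡ u
  ifZero-0 {x} {u} {v} e = cong (if_then u else v) (dec-true (x ≟ 0#) e)

  ifZero-≢0 : ∀ {x u v} → x ≢ 0# → ifZero x u v ≡ v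
  ifZero-≢0 {x} {u} {v} e = cong (if_then u else v) (dec-false (x ≟ 0#) e)

  -- Multiplication by a permutes the nonzero elements.
  ^-size-≢0 : ∀ a → a ≢ 0# → a ^ size ≡ a
  ^-size-≢0 a a≢0 = begin
    a ^ size                                  ≡⟨ Mul.sum-replicate size ⟨
    Mul.sum {size} (λ _ → a)                  ≡⟨ Mul.sum-cong-≗ {size} (λ i → sym (split (point i))) ⟩
    Mul.sum (λ i → ifZero (point i) 1# a * ifZero (point i) a 1#)
                                              ≡⟨ Mul.∑-distrib-+ (λ i → ifZero (point i) 1# a) (λ i → ifZero (point i) a 1#) ⟩
    Mul.sum (λ i → ifZero (point i) 1# a) * Mul.sum (λ i → ifZero (point i) a 1#)
                                              ≡⟨ cong₂ _*_ units zeros ⟩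
    1# * a                                    ≡⟨ *-identityˡ a ⟩
    a                                         ∎
    where
    w = proj₁ (inverse a a≢0)
    aw≡1 = proj₂ (inverse a a≢0)
    split : ∀ x → ifZero x 1# a * ifZero x a 1# ≡ a
    split x with x ≟ 0#
    ... | yes _ = *-identityˡ a
    ... | no _ = *-identityʳ a
    -- Replacing 0 by 1 makes a product over the whole field equal the product over its nonzero
    -- elements. Of the `size` factors `a`, those at nonzero places multiply to 1 and the one at 0
    -- survives.
    g : Carrier → Carrier
    g x = ifZero x 1# x
    g≢0 : ∀ x → g x ≢ 0#
    g≢0 x with x ≟ 0#
    ... | yes _ = 0≢1 ∘ sym
    ... | no x≢0 = x≢0
    g-* : ∀ x → g (a * x) ≡ g x * ifZero x 1# a
    g-* x with x ≟ 0#
    ... | yes refl = trans (ifZero-0 (zeroʳ a)) (sym (*-identityˡ 1#))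
    ... | no x≢0 = trans (ifZero-≢0 (*-≢0# a≢0 x≢0)) (*-comm a x)
    units : Mul.sum (λ i → ifZero (point i) 1# a) ≡ 1#
    units = *-cancelˡ (product-≢0 (g ∘ point) (g≢0 ∘ point)) (begin
      Mul.sum (g ∘ point) * Mul.sum (λ i → ifZero (point i) 1# a)
        ≡⟨ Mul.∑-distrib-+ (g ∘ point) (λ i → ifZero (point i) 1# a) ⟨
      Mul.sum (λ i → g (point i) * ifZero (point i) 1# a)   ≡⟨ Mul.sum-cong-≗ {size} (λ i → sym (g-* (point i))) ⟩
      Mul.sum (λ i → g (a * point i))
        ≡⟨ sum-reindex *-commutativeMonoid g (a *_) (w *_)
             (λ x → trans (sym (*-assoc a w x)) (trans (cong (_* x) aw≡1) (*-identityˡ x)))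
             (λ x → trans (sym (*-assoc w a x)) (trans (cong (_* x) (trans (*-comm w a) aw≡1)) (*-identityˡ x))) ⟨
      Mul.sum (g ∘ point)                                   ≡⟨ *-identityʳ _ ⟨
      Mul.sum (g ∘ point) * 1#                              ∎)
    zeros : Mul.sum (λ i → ifZero (point i) a 1#) ≡ a
    zeros = trans (sum-single *-commutativeMonoid (λ i → ifZero (point i) a 1#) (position 0#)
        (λ j j≢ → ifZero-≢0 (λ e → j≢ (point-injective (trans e (sym (point-position 0#)))))))
      (ifZero-0 (point-position 0#))

  •-absorb : ∀ {p} k x → p • 1# ≡ 0# → p ∣ k → k • x ≡ 0#
  •-absorb {p} .(c ℕ.* p) x p•1≡0 (divides c refl) = begin
    (c ℕ.* p) • x              ≡⟨ cong ((c ℕ.* p) •_) (sym (*-identityˡ x)) ⟩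
    (c ℕ.* p) • (1# * x)       ≡⟨ ×-assoc-* (c ℕ.* p) 1# x ⟨
    (c ℕ.* p) • 1# * x         ≡⟨ cong (_* x) (×1-homo-* c p) ⟩
    c • 1# * p • 1# * x        ≡⟨ cong (λ z → c • 1# * z * x) p•1≡0 ⟩
    c • 1# * 0# * x            ≡⟨ cong (_* x) (zeroʳ _) ⟩
    0# * x                     ≡⟨ zeroˡ x ⟩
    0#                         ∎

  -- By `prime∣C` all binomial terms strictly between the two ends vanish in characteristic p.
  frobenius : ∀ {p} → Prime p → p • 1# ≡ 0# → ∀ x y → (x + y) ^ p ≡ x ^ p + y ^ p
  frobenius {zero} pp = ⊥-elim (¬prime0 pp)
    where
    ¬prime0 : ¬ Prime 0
    ¬prime0 pp with () ← prime⇒nonTrivial pp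
  frobenius {suc n} pp p•1≡0 x y = begin
    (x + y) ^ p                                     ≡⟨ B.theorem p x y ⟩
    Add.sum (B.binomialTerm x y p)                  ≡⟨⟩
    B.binomialTerm x y p zero + Add.sum (B.binomialTerm x y p ∘ suc)
      ≡⟨ cong (B.binomialTerm x y p zero +_)
           (sum-single +-commutativeMonoid (B.binomialTerm x y p ∘ suc) (Fin.fromℕ n) middle) ⟩
    B.binomialTerm x y p zero + B.binomialTerm x y p (suc (Fin.fromℕ n))  ≡⟨ cong₂ _+_ first last ⟩
    y ^ p + x ^ p                                   ≡⟨ +-comm _ _ ⟩
    x ^ p + y ^ p                                   ∎
    where
    p = suc n
    module B = Algebra.Properties.CommutativeSemiring.Binomial commutativeSemiring
    middle : ∀ j → j ≢ Fin.fromℕ n → B.binomialTerm x y p (suc j) ≡ 0#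
    middle j j≢n = •-absorb (p Comb.C suc (Fin.toℕ j)) _ p•1≡0 (prime∣C pp (suc (Fin.toℕ j)) (ℕ.s≤s ℕ.z≤n)
      (ℕ.s≤s (ℕₚ.≤∧≢⇒< (Finₚ.toℕ≤pred[n] j) (λ e → j≢n (Finₚ.toℕ-injective (trans e (sym (Finₚ.toℕ-fromℕ n))))))))
    first : B.binomialTerm x y p zero ≡ y ^ p
    first = trans (1• _) (*-identityˡ _)
    last : B.binomialTerm x y p (suc (Fin.fromℕ n)) ≡ x ^ p
    last = begin
      (p Comb.C suc (Fin.toℕ (Fin.fromℕ n))) • (x ^ suc (Fin.toℕ (Fin.fromℕ n)) * y ^ (n ℕ.∸ Fin.toℕ (Fin.fromℕ n)))
        ≡⟨ cong (λ k → (p Comb.C suc k) • (x ^ suc k * y ^ (n ℕ.∸ k))) (Finₚ.toℕ-fromℕ n) ⟩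
      (p Comb.C p) • (x ^ p * y ^ (n ℕ.∸ n))   ≡⟨ cong₂ (λ c k → c • (x ^ p * y ^ k)) (Comb.nCn≡1 p) (ℕₚ.n∸n≡0 n) ⟩
      1 • (x ^ p * 1#)                    ≡⟨ 1• _ ⟩
      x ^ p * 1#                          ≡⟨ *-identityʳ _ ⟩
      x ^ p                               ∎

  frobenius-power : ∀ {p} → Prime p → p • 1# ≡ 0# → ∀ k x y → (x + y) ^ (p ℕ.^ k) ≡ x ^ (p ℕ.^ k) + y ^ (p ℕ.^ k)
  frobenius-power pp p•1≡0 zero x y = trans (*-identityʳ _) (sym (cong₂ _+_ (*-identityʳ x) (*-identityʳ y)))
  frobenius-power {p} pp p•1≡0 (suc k) x y = begin
    (x + y) ^ (p ℕ.* p ℕ.^ k)             ≡⟨ ^-assocʳ (x + y) p (p ℕ.^ k) ⟨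
    ((x + y) ^ p) ^ (p ℕ.^ k)             ≡⟨ cong (_^ (p ℕ.^ k)) (frobenius pp p•1≡0 x y) ⟩
    (x ^ p + y ^ p) ^ (p ℕ.^ k)           ≡⟨ frobenius-power pp p•1≡0 k (x ^ p) (y ^ p) ⟩
    (x ^ p) ^ (p ℕ.^ k) + (y ^ p) ^ (p ℕ.^ k)  ≡⟨ cong₂ _+_ (^-assocʳ x p (p ℕ.^ k)) (^-assocʳ y p (p ℕ.^ k)) ⟩
    x ^ (p ℕ.* p ℕ.^ k) + y ^ (p ℕ.* p ℕ.^ k)  ∎

  -- The multiple of 1 by a power of p is the same power of p · 1, and a field has no zero divisors.
  -- This identifies the characteristic.
  power•1≡0 : ∀ p k → (p ℕ.^ k) • 1# ≡ 0# → p • 1# ≡ 0#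
  power•1≡0 p zero e = ⊥-elim (0≢1 (trans (sym e) (1• 1#)))
  power•1≡0 p (suc k) e with (p • 1#) ≟ 0#
  ... | yes p•1≡0 = p•1≡0
  ... | no p•1≢0 = power•1≡0 p k (*-cancel-0 p•1≢0 (trans (sym (×1-homo-* p (p ℕ.^ k))) e))

  module _ (e : ℕ) (2+e<size : 3 ℕ.+ e ℕ.≤ size) where
    private
      cs : Vec Carrier (suc (suc e))
      cs = 0# ∷ - 1# ∷ Vec.replicate e 0#
      monic-replicate : ∀ e x → monic (Vec.replicate e 0#) x ≡ x ^ e
      monic-replicate zero x = refl
      monic-replicate (suc e) x = trans (+-identityˡ _) (cong (x *_) (monic-replicate e x))
      zeros : (∀ x → x ≢ 0# → x ^ suc e ≡ 1#) → ∀ x → monic cs x ≡ 0#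
      zeros roots x with x ≟ 0#
      ... | yes refl = trans (+-identityˡ _) (zeroˡ _)
      ... | no x≢0 = trans (+-identityˡ _) (trans (cong (x *_)
        (trans (cong (λ z → - 1# + x * z) (monic-replicate e x)) (trans (cong (- 1# +_) (roots x x≢0)) (-‿inverseˡ 1#)))) (zeroʳ x))

    -- Otherwise every field element would be a root of x^(e + 2) - x, the polynomial encoded by
    -- `cs`; its degree is less than `size`.
    non-root : Σ Carrier λ ν → ν ≢ 0# × ν ^ suc e ≢ 1#
    non-root with Finₚ.any? (λ i → ¬? (point i ≟ 0#) ×-dec ¬? ((point i ^ suc e) ≟ 1#))
    ... | yes (i , p) = point i , p
    ... | no none = ⊥-elim (monic-roots cs (point ∘ (λ i → Fin.inject≤ i 2+e<size))
      (λ i j eq → Finₚ.inject≤-injective 2+e<size 2+e<size i j (point-injective eq))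
      (λ i → zeros all _))
      where
      all : ∀ x → x ≢ 0# → x ^ suc e ≡ 1#
      all x x≢0 = decidable-stable ((x ^ suc e) ≟ 1#) (λ ≢1 → none (position x ,
        subst (_≢ 0#) (sym (point-position x)) x≢0 , subst (λ z → z ^ suc e ≢ 1#) (sym (point-position x)) ≢1))

-- The field of order q²: conjugation, one half, an element of norm -1, a skew element.

odd-half : ∀ q → q % 2 ≡ 1 → Σ ℕ λ m → q ≡ suc (m ℕ.* 2)
odd-half q odd = q ℕ./ 2 , trans (DivMod.m≡m%n+[m/n]*n q 2) (cong (ℕ._+ (q ℕ./ 2) ℕ.* 2) odd)

primePower-≢1 : ∀ {q} → IsPrimePower q → q ≢ 1
primePower-≢1 (p , k , pp , refl) e with refl ← ℕₚ.m*n≡1⇒m≡1 p (p ℕ.^ k) e with () ← prime⇒nonTrivial pp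

module HermitianField (F : FiniteField) (q : ℕ) (q-pp : IsPrimePower q) (q-odd : q % 2 ≡ 1)
  (size≡ : FiniteField.size F ≡ q ℕ.* q) where
  open FieldArithmetic F public
  open Hermitian F q using (pow; conj) public
  open Solver using (solve; _:=_; _:+_; _:*_; :-_)
  open ≡-Reasoning

  pow-^ : ∀ x n → pow x n ≡ x ^ n
  pow-^ x zero = refl
  pow-^ x (suc n) = cong (x *_) (pow-^ x n)

  -- The square of q · 1 is `size` · 1, which vanishes.
  q•1≡0 : q • 1# ≡ 0#
  q•1≡0 with (q • 1#) ≟ 0#
  ... | yes e = e
  ... | no ≢0 = *-cancel-0 ≢0 (trans (sym (×1-homo-* q q)) (trans (cong (_• 1#) (sym size≡)) size•1≡0))

  conj-^ : ∀ x → conj x ≡ x ^ q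
  conj-^ x = pow-^ x q

  conj-+ : ∀ x y → conj (x + y) ≡ conj x + conj y
  conj-+ x y = trans (conj-^ (x + y)) (trans (additive q-pp) (sym (cong₂ _+_ (conj-^ x) (conj-^ y))))
    where
    additive : IsPrimePower q → (x + y) ^ q ≡ x ^ q + y ^ q
    additive (p , k , pp , q≡) = subst (λ q → (x + y) ^ q ≡ x ^ q + y ^ q) (sym q≡)
      (frobenius-power pp (power•1≡0 p (suc k) (subst (λ q → q • 1# ≡ 0#) q≡ q•1≡0)) (suc k) x y)

  conj-* : ∀ x y → conj (x * y) ≡ conj x * conj y
  conj-* x y = trans (conj-^ (x * y)) (trans (^-distrib-* x y q) (sym (cong₂ _*_ (conj-^ x) (conj-^ y))))

  ^-size : ∀ x → x ^ size ≡ x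
  ^-size x with x ≟ 0#
  ... | no x≢0 = ^-size-≢0 x x≢0
  ... | yes refl = 0^positive size (position 0#)
    where
    0^positive : ∀ n → Fin n → 0# ^ n ≡ 0#
    0^positive (suc n) _ = zeroˡ _

  conj-conj : ∀ x → conj (conj x) ≡ x
  conj-conj x = begin
    conj (conj x)   ≡⟨ conj-^ (conj x) ⟩
    conj x ^ q      ≡⟨ cong (_^ q) (conj-^ x) ⟩
    (x ^ q) ^ q     ≡⟨ ^-assocʳ x q q ⟩
    x ^ (q ℕ.* q)   ≡⟨ cong (x ^_) size≡ ⟨
    x ^ size        ≡⟨ ^-size x ⟩
    x               ∎

  conj-0 : conj 0# ≡ 0#
  conj-0 = +-cancel-0 (trans (cong conj (sym (+-identityʳ 0#))) (conj-+ 0# 0#))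

  conj-1 : conj 1# ≡ 1#
  conj-1 = trans (conj-^ 1#) (1^ q)

  conj-neg : ∀ x → conj (- x) ≡ - conj x
  conj-neg x = x-y≡0⇒x≡y (begin
    conj (- x) + - - conj x  ≡⟨ solve 2 (λ a b → a :+ :- (:- b) := a :+ b) refl (conj (- x)) (conj x) ⟩
    conj (- x) + conj x      ≡⟨ conj-+ (- x) x ⟨
    conj (- x + x)           ≡⟨ cong conj (-‿inverseˡ x) ⟩
    conj 0#                  ≡⟨ conj-0 ⟩
    0#                       ∎)

  conj-≢0 : ∀ {x} → x ≢ 0# → conj x ≢ 0#
  conj-≢0 {x} x≢0 e = x≢0 (trans (sym (conj-conj x)) (trans (cong conj e) conj-0))

  m : ℕ
  m = proj₁ (odd-half q q-odd)

  q≡ : q ≡ suc (m ℕ.* 2)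
  q≡ = proj₂ (odd-half q q-odd)

  -- As q = 2 m + 1 vanishes in the field, 2 = 0 would give 1 = 0.
  2≢0 : 1# + 1# ≢ 0#
  2≢0 2≡0 = 0≢1 (sym (begin
    1#                           ≡⟨ +-identityʳ 1# ⟨
    1# + 0#                      ≡⟨ cong (1# +_) (zeroʳ (m • 1#)) ⟨
    1# + m • 1# * 0#             ≡⟨ cong (λ z → 1# + m • 1# * z) (trans (cong (1# +_) (+-identityʳ 1#)) 2≡0) ⟨
    1# + m • 1# * 2 • 1#         ≡⟨ cong (1# +_) (×1-homo-* m 2) ⟨
    suc (m ℕ.* 2) • 1#           ≡⟨ cong (_• 1#) q≡ ⟨
    q • 1#                       ≡⟨ q•1≡0 ⟩
    0#                           ∎))

  half : Carrier
  half = proj₁ (inverse (1# + 1#) 2≢0)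

  half+half : half + half ≡ 1#
  half+half = trans (trans (sym (cong₂ _+_ (*-identityˡ half) (*-identityˡ half))) (sym (distribʳ half 1# 1#)))
    (proj₂ (inverse (1# + 1#) 2≢0))

  conj-half : conj half ≡ half
  conj-half = *-cancelˡ 2≢0 (begin
    (1# + 1#) * conj half         ≡⟨ trans (distribʳ _ 1# 1#) (cong₂ _+_ (*-identityˡ _) (*-identityˡ _)) ⟩
    conj half + conj half         ≡⟨ conj-+ half half ⟨
    conj (half + half)            ≡⟨ trans (cong conj half+half) conj-1 ⟩
    1#                            ≡⟨ proj₂ (inverse (1# + 1#) 2≢0) ⟨
    (1# + 1#) * half              ∎)

  m≢0 : m ≢ 0
  m≢0 m≡0 = primePower-≢1 q-pp (trans q≡ (cong (λ m → suc (m ℕ.* 2)) m≡0))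

  -- 2 e = q² - 1, so ν ^ e is a square root of 1 for every ν ≢ 0.
  e : ℕ
  e = m ℕ.* suc q

  size-e : size ≡ suc (e ℕ.+ e)
  size-e = trans size≡ (subst (λ q → q ℕ.* q ≡ suc (m ℕ.* suc q ℕ.+ m ℕ.* suc q)) (sym q≡)
      (S.solve 1 (λ m → (S.con 1 S.:+ m S.:* S.con 2) S.:* (S.con 1 S.:+ m S.:* S.con 2) S.:=
         S.con 1 S.:+ (m S.:* (S.con 2 S.:+ m S.:* S.con 2) S.:+ m S.:* (S.con 2 S.:+ m S.:* S.con 2))) refl m))
    where module S = Data.Nat.Solver.+-*-Solver

  nonsquare : Σ Carrier λ ν → ν ≢ 0# × ν ^ e ≢ 1#
  nonsquare = go e refl
    where
    go : ∀ e′ → e ≡ e′ → Σ Carrier λ ν → ν ≢ 0# × ν ^ e′ ≢ 1#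
    go zero e≡0 = ⊥-elim (m≢0 (ℕₚ.m*n≡0⇒m≡0 m (suc q) e≡0))
    -- With e = e′ + 1 the field has 2 e′ + 3 elements, at least one more than the e′ + 2 roots that
    -- the polynomial in `non-root` can have.
    go (suc e′) e≡ = non-root e′ (subst (3 ℕ.+ e′ ℕ.≤_) (sym (trans size-e (cong (λ e → suc (e ℕ.+ e)) e≡)))
      (ℕ.s≤s (ℕ.s≤s (subst (suc e′ ℕ.≤_) (sym (ℕₚ.+-suc e′ e′)) (ℕ.s≤s (ℕₚ.m≤m+n e′ e′))))))

  ν : Carrier
  ν = proj₁ nonsquare

  ν^e : ν ^ e ≡ - 1#
  ν^e = x-y≡0⇒x≡y (*-cancel-0 (λ e → proj₂ (proj₂ nonsquare) (x-y≡0⇒x≡y e)) (begin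
    (ν ^ e + - 1#) * (ν ^ e + - - 1#)   ≡⟨ solve 2 (λ y o → (y :+ :- o) :* (y :+ :- (:- o)) := y :* y :+ :- (o :* o)) refl (ν ^ e) 1# ⟩
    ν ^ e * ν ^ e + - (1# * 1#)         ≡⟨ x≡y⇒x-y≡0 (trans square (sym (*-identityˡ 1#))) ⟩
    0#                                  ∎))
    where
    square : ν ^ e * ν ^ e ≡ 1#
    square = *-cancelˡ (proj₁ (proj₂ nonsquare)) (begin
      ν * (ν ^ e * ν ^ e)   ≡⟨ cong (ν *_) (^-homo-* ν e e) ⟨
      ν ^ suc (e ℕ.+ e)     ≡⟨ cong (ν ^_) size-e ⟨
      ν ^ size              ≡⟨ ^-size ν ⟩
      ν                     ≡⟨ *-identityʳ ν ⟨
      ν * 1#                ∎)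

  -- Its norm is ν^(m (q + 1)) = ν^e = -1, which makes vectors of the shape (0, 1, ε, s) isotropic
  -- and so provides the second hyperbolic pair.
  ε : Carrier
  ε = ν ^ m

  ε-norm : ε * conj ε ≡ - 1#
  ε-norm = trans (cong (ε *_) (conj-^ ε)) (trans (^-assocʳ ν m (suc q)) ν^e)

  θ : Carrier
  θ = ν + - conj ν

  conj-θ : conj θ ≡ - θ
  conj-θ = begin
    conj (ν + - conj ν)          ≡⟨ conj-+ ν (- conj ν) ⟩
    conj ν + conj (- conj ν)     ≡⟨ cong (conj ν +_) (trans (conj-neg (conj ν)) (cong -_ (conj-conj ν))) ⟩
    conj ν + - ν                 ≡⟨ solve 2 (λ a b → b :+ :- a := :- (a :+ :- b)) refl ν (conj ν) ⟩
    - (ν + - conj ν)             ∎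

  -- If `ν` were fixed, then ν^(q - 1) = 1. Since q - 1 = 2 m divides e = 2 m (m + 1), this would
  -- give ν^e = 1.
  θ≢0 : θ ≢ 0#
  θ≢0 θ≡0 = proj₂ (proj₂ nonsquare) (begin
    ν ^ (m ℕ.* suc q)            ≡⟨ cong (ν ^_) (subst (λ q → m ℕ.* suc q ≡ m ℕ.* 2 ℕ.* suc m) (sym q≡)
                                     (S.solve 1 (λ m → m S.:* (S.con 2 S.:+ m S.:* S.con 2) S.:= m S.:* S.con 2 S.:* (S.con 1 S.:+ m)) refl m)) ⟩
    ν ^ (m ℕ.* 2 ℕ.* suc m)      ≡⟨ ^-assocʳ ν (m ℕ.* 2) (suc m) ⟨
    (ν ^ (m ℕ.* 2)) ^ suc m      ≡⟨ cong (_^ suc m) ν^2m ⟩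
    1# ^ suc m                   ≡⟨ 1^ (suc m) ⟩
    1#                           ∎)
    where
    module S = Data.Nat.Solver.+-*-Solver
    ν^2m : ν ^ (m ℕ.* 2) ≡ 1#
    ν^2m = *-cancelˡ (proj₁ (proj₂ nonsquare)) (begin
      ν * ν ^ (m ℕ.* 2)     ≡⟨ cong (ν ^_) q≡ ⟨
      ν ^ q                 ≡⟨ conj-^ ν ⟨
      conj ν                ≡⟨ x-y≡0⇒x≡y θ≡0 ⟨
      ν                     ≡⟨ *-identityʳ ν ⟨
      ν * 1#                ∎)

-- Indicators, list searches and the Boolean pattern of the relations.

[_] : {P : Set} → Dec P → ℚ
[ p? ] = if does p? then 1ℚ else 0ℚ

[]-yes : {P : Set} (p? : Dec P) → P → [ p? ] ≡ 1ℚ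
[]-yes p? p = cong (if_then 1ℚ else 0ℚ) (dec-true p? p)

[]-no : {P : Set} (p? : Dec P) → ¬ P → [ p? ] ≡ 0ℚ
[]-no p? ¬p = cong (if_then 1ℚ else 0ℚ) (dec-false p? ¬p)

[]-⇔ : {P Q : Set} (p? : Dec P) (q? : Dec Q) → (P → Q) → (Q → P) → [ p? ] ≡ [ q? ]
[]-⇔ p? q? f g = cong (if_then 1ℚ else 0ℚ) (does-⇔ (mk⇔ f g) p? q?)

[]-× : {P Q : Set} (p? : Dec P) (q? : Dec Q) → [ p? ] Rat.* [ q? ] ≡ [ p? ×-dec q? ]
[]-× (yes _) (yes _) = refl
[]-× (yes _) (no _) = refl
[]-× (no _) (yes _) = refl
[]-× (no _) (no _) = refl

[]-¬ : {P : Set} (p? : Dec P) → [ ¬? p? ] ≡ 1ℚ Rat.- [ p? ]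
[]-¬ (yes _) = refl
[]-¬ (no _) = refl

[]-*-cong : {P : Set} (p? : Dec P) {x y : ℚ} → (P → x ≡ y) → [ p? ] Rat.* x ≡ [ p? ] Rat.* y
[]-*-cong (yes p) e = cong (1ℚ Rat.*_) (e p)
[]-*-cong (no _) {x} {y} e = trans (ℚₚ.*-zeroˡ x) (sym (ℚₚ.*-zeroˡ y))

∧-true⁻ : ∀ {a b} → a ∧ b ≡ true → a ≡ true × b ≡ true
∧-true⁻ {true} {true} _ = refl , refl

∧-true⁺ : ∀ {a b} → a ≡ true → b ≡ true → a ∧ b ≡ true
∧-true⁺ refl refl = refl

not-true⁻ : ∀ {a} → not a ≡ true → a ≡ false
not-true⁻ {false} _ = refl

does-false⁻ : {P : Set} (p? : Dec P) → does p? ≡ false → ¬ P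
does-false⁻ (no ¬p) _ = ¬p

module _ {A : Set} (f : A → Bool) where
  filterB-∈⁺ : ∀ {x xs} → x ∈ xs → f x ≡ true → x ∈ filterB f xs
  filterB-∈⁺ {x} (here refl) fx rewrite fx = here refl
  filterB-∈⁺ {x} {y ∷ ys} (there x∈) fx with f y
  ... | true = there (filterB-∈⁺ x∈ fx)
  ... | false = filterB-∈⁺ x∈ fx

  filterB-∈⁻ : ∀ {x} xs → x ∈ filterB f xs → x ∈ xs × f x ≡ true
  filterB-∈⁻ (y ∷ ys) x∈ with f y in fy
  filterB-∈⁻ (y ∷ ys) (here refl) | true = here refl , fy
  filterB-∈⁻ (y ∷ ys) (there x∈) | true = let (m , fx) = filterB-∈⁻ ys x∈ in there m , fx
  ... | false = let (m , fx) = filterB-∈⁻ ys x∈ in there m , fx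

  filterB-unique : ∀ {xs} → Unique xs → Unique (filterB f xs)
  filterB-unique [] = []
  filterB-unique {x ∷ xs} (x∉ ∷ u) with f x
  ... | true = All.tabulate (λ y∈ → All.lookup x∉ (proj₁ (filterB-∈⁻ xs y∈))) ∷ filterB-unique u
  ... | false = filterB-unique u

concatMap-unique : {A B : Set} (f : A → List B) {xs : List A} → Unique xs → (∀ x → Unique (f x)) →
  (∀ {x y b} → b ∈ f x → b ∈ f y → x ≡ y) → Unique (concatMap f xs)
concatMap-unique f [] _ _ = []
concatMap-unique f {x ∷ xs} (x∉ ∷ u) uf key = Uniqueₚ.++⁺ (uf x) (concatMap-unique f u uf key)
  λ (b∈fx , b∈rest) → let (y , y∈ , b∈fy) = find (∈-concatMap⁻ f {xs = xs} b∈rest)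
                      in All.lookup x∉ y∈ (key b∈fx b∈fy)

any-true⁺ : {A : Set} (f : A → Bool) {x : A} {xs : List A} → x ∈ xs → f x ≡ true → any f xs ≡ true
any-true⁺ f {xs = x ∷ xs} (here refl) fx rewrite fx = refl
any-true⁺ f {xs = y ∷ xs} (there x∈) fx with f y
... | true = refl
... | false = any-true⁺ f x∈ fx

any-true⁻ : {A : Set} (f : A → Bool) (xs : List A) → any f xs ≡ true → Σ A λ x → f x ≡ true
any-true⁻ f (x ∷ xs) e with f x in fx
... | true = x , fx
... | false = any-true⁻ f xs e

≡-does : {P : Set} {b : Bool} (p? : Dec P) → (b ≡ true → P) → (P → b ≡ true) → b ≡ does p?
≡-does {b = true} p? f g = sym (dec-true p? (f refl))
≡-does {b = false} p? f g = sym (dec-false p? (λ p → false≢true (g p)))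
  where
  false≢true : false ≢ true
  false≢true ()

-- The relation containing a pair whose normalised value of h is fixed (m) or skew (l) under
-- conjugation, and which lies on a line with P (k).
classify : Bool → Bool → Bool → Fin 6
classify true  true  true  = 0F
classify true  true  false = 1F
classify true  false _     = 5F
classify false true  true  = 2F
classify false true  false = 3F
classify false false _     = 4F

classify-entries : ∀ q m l k → (k ≡ true → l ≡ true) →
  let ⟦_⟧ = λ b → if b then 1ℚ else 0ℚ in
  ⟨ ⟦ k ∧ m ⟧ , ⟦ k ⟧ , 1ℚ , ⟦ m ⟧ , ⟦ l ⟧ , ⟦ m ∧ l ⟧ ⟩ ≡ ℚForm.relationEntries q (classify m l k)
classify-entries q true  true  true  _ = refl
classify-entries q true  true  false _ = refl
classify-entries q true  false false _ = refl
classify-entries q true  false true  k⇒l with () ← k⇒l refl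
classify-entries q false true  true  _ = refl
classify-entries q false true  false _ = refl
classify-entries q false false false _ = refl
classify-entries q false false true  k⇒l with () ← k⇒l refl

-- `Rel` with its five tests abstracted to Booleans, so that comparing it with `classify` becomes a
-- finite check.
relationBool : (same orthogonal common inE inT : Bool) → Fin 6 → Bool
relationBool same orthogonal common inE inT 0F = same
relationBool same orthogonal common inE inT 1F = not same ∧ orthogonal
relationBool same orthogonal common inE inT 2F = not same ∧ common
relationBool same orthogonal common inE inT 3F = not same ∧ inT ∧ not common
relationBool same orthogonal common inE inT 4F = not same ∧ not orthogonal ∧ not inE ∧ not inT
relationBool same orthogonal common inE inT 5F = not same ∧ inE

-- Equality means collinear with P and fixed, orthogonality means fixed and skew, and the cosets e
-- and t are the nonzero fixed and the nonzero skew values. The hypothesis removes the combinations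
-- with `k` but not `l`.
relationBool-classify : ∀ m l k → (k ≡ true → l ≡ true) → ∀ j →
  relationBool (k ∧ m) (m ∧ l) k (not (m ∧ l) ∧ m) (not (m ∧ l) ∧ l) j ≡ does (j Fin.≟ classify m l k)
relationBool-classify true true true _ = by-six refl refl refl refl refl refl
relationBool-classify true true false _ = by-six refl refl refl refl refl refl
relationBool-classify true false true k⇒l with () ← k⇒l refl
relationBool-classify true false false _ = by-six refl refl refl refl refl refl
relationBool-classify false true true _ = by-six refl refl refl refl refl refl
relationBool-classify false true false _ = by-six refl refl refl refl refl refl
relationBool-classify false false true k⇒l with () ← k⇒l refl
relationBool-classify false false false _ = by-six refl refl refl refl refl refl

inverse-ℚ : ∀ a → a ≢ 0ℚ → Σ ℚ λ b → b Rat.* a ≡ 1ℚ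
inverse-ℚ a a≢0 = (Rat.1/ a) , ℚₚ.*-inverseˡ a
  where
  instance
    a-nonZero : Rat.NonZero a
    a-nonZero = Rat.≢-nonZero a≢0

-- Counting in GF(q²): fixed and skew elements, sums over affine forms.

module HermitianGeometry (F : FiniteField) (q : ℕ) (q-pp : IsPrimePower q) (q-odd : q % 2 ≡ 1)
  (size≡ : FiniteField.size F ≡ q ℕ.* q) where
  open HermitianField F q q-pp q-odd size≡ hiding (e; m; ν; pow-^)
  open Hermitian F q using (V4; v4; zeroV; h; _·V_; _+V_; _==_; allV; normalized; hermPoints; 𝒳; N; pt;
    isZeroV; onCommonLine; inGFq*; isE; isT; zval; Rel)
  open V4
  open Solver using (solve; _:=_; _:+_; _:*_; :-_; con)
  open Rat using () renaming (_+_ to infixl 6 _⊞_; _*_ to infixl 7 _⊠_; _-_ to infixl 6 _⊟_)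
  open ≡-Reasoning

  r : ℚ
  r = ι (ℤ.pos q)

  S : (Carrier → ℚ) → ℚ
  S f = ∑ (f ∘ point)

  private module Sz = Summation.Size size

  S-cong : ∀ {f g} → (∀ x → f x ≡ g x) → S f ≡ S g
  S-cong e = Summation.∑-cong (e ∘ point)

  S-+ : ∀ f g → S (λ x → f x ⊞ g x) ≡ S f ⊞ S g
  S-+ f g = Sz.∑-+ (f ∘ point) (g ∘ point)

  S-*ˡ : ∀ c f → S (λ x → c ⊠ f x) ≡ c ⊠ S f
  S-*ˡ c f = Sz.∑-*ˡ c (f ∘ point)

  S-*ʳ : ∀ c f → S (λ x → f x ⊠ c) ≡ S f ⊠ c
  S-*ʳ c f = Sz.∑-*ʳ c (f ∘ point)

  S-swap : ∀ (f : Carrier → Carrier → ℚ) → S (λ x → S (λ y → f x y)) ≡ S (λ y → S (λ x → f x y))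
  S-swap f = Summation.∑-swap size size (λ i j → f (point i) (point j))

  S-reindex : (h : Carrier → ℚ) (f g : Carrier → Carrier) → (∀ x → f (g x) ≡ x) → (∀ x → g (f x) ≡ x) →
              S (h ∘ f) ≡ S h
  S-reindex h f g fg gf = sym (trans (Summation.∑≡sum size _)
    (trans (sum-reindex ℚₚ.+-0-commutativeMonoid h f g fg gf) (sym (Summation.∑≡sum size _))))

  S-point : ∀ a (f : Carrier → ℚ) → S (λ x → [ x ≟ a ] ⊠ f x) ≡ f a
  S-point a f = trans (Summation.∑-single (λ i → [ point i ≟ a ] ⊠ f (point i)) (position a)
      (λ j j≢ → trans (cong (_⊠ f (point j)) ([]-no (point j ≟ a) (λ e → j≢ (point-injective (trans e (sym (point-position a)))))))
        (ℚₚ.*-zeroˡ (f (point j)))))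
    (trans (cong₂ _⊠_ ([]-yes (point (position a) ≟ a) (point-position a)) (cong f (point-position a))) (ℚₚ.*-identityˡ (f a)))

  S-unique : ∀ {P : Carrier → Set} (p? : ∀ x → Dec (P x)) a → (∀ x → P x → x ≡ a) → P a → S (λ x → [ p? x ]) ≡ 1ℚ
  S-unique p? a unique pa = trans (S-cong (λ x → trans ([]-⇔ (p? x) (x ≟ a) (unique x) (λ { refl → pa })) (sym (ℚₚ.*-identityʳ _))))
    (S-point a (λ _ → 1ℚ))

  S-0 : S (λ _ → 0ℚ) ≡ 0ℚ
  S-0 = Summation.∑-0 size

  S-const : ∀ c → S (λ _ → c) ≡ r ⊠ r ⊠ c
  S-const c = begin
    S (λ _ → c)             ≡⟨ S-cong (λ _ → sym (ℚₚ.*-identityˡ c)) ⟩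
    S (λ _ → 1ℚ ⊠ c)        ≡⟨ S-*ʳ c (λ _ → 1ℚ) ⟩
    S (λ _ → 1ℚ) ⊠ c        ≡⟨ cong (_⊠ c) (∑-1 size) ⟩
    ι (ℤ.pos size) ⊠ c      ≡⟨ cong (λ n → ι n ⊠ c) (trans (cong ℤ.pos size≡) (ℤₚ.pos-* q q)) ⟩
    ι (ℤ.pos q Int.* ℤ.pos q) ⊠ c  ≡⟨ cong (_⊠ c) (ι-* (ℤ.pos q) (ℤ.pos q)) ⟩
    r ⊠ r ⊠ c               ∎

  Fixed Skew : Carrier → Set
  Fixed x = conj x ≡ x
  Skew x = conj x ≡ - x

  fixed? : ∀ x → Dec (Fixed x)
  fixed? x = conj x ≟ x

  skew? : ∀ x → Dec (Skew x)
  skew? x = conj x ≟ (- x)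

  fixed∧skew⇒0 : ∀ {x} → Fixed x → Skew x → x ≡ 0#
  fixed∧skew⇒0 {x} f s = *-cancel-0 2≢0 (begin
    (1# + 1#) * x    ≡⟨ trans (distribʳ x 1# 1#) (cong₂ _+_ (*-identityˡ x) (*-identityˡ x)) ⟩
    x + x            ≡⟨ cong (x +_) (trans (sym f) s) ⟩
    x + - x          ≡⟨ -‿inverseʳ x ⟩
    0#               ∎)

  skew-0 : Skew 0#
  skew-0 = trans conj-0 (solve 0 (con (ℤ.pos 0) := :- con (ℤ.pos 0)) refl)

  halves : ∀ x → half * (x + x) ≡ x
  halves x = trans (solve 2 (λ h x → h :* (x :+ x) := (h :+ h) :* x) refl half x)
    (trans (cong (_* x) half+half) (*-identityˡ x))

  realPart : Carrier → Carrier
  realPart x = half * (x + conj x)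

  realPart-fixed : ∀ x → Fixed (realPart x)
  realPart-fixed x = begin
    conj (half * (x + conj x))           ≡⟨ conj-* half (x + conj x) ⟩
    conj half * conj (x + conj x)        ≡⟨ cong₂ _*_ conj-half (trans (conj-+ x (conj x)) (cong (conj x +_) (conj-conj x))) ⟩
    half * (conj x + x)                  ≡⟨ cong (half *_) (+-comm (conj x) x) ⟩
    half * (x + conj x)                  ∎

  -- Skewness of x - s says x + conj x = s + s, and halving recovers s.
  realPart-unique : ∀ {x s} → Fixed s → Skew (x + - s) → s ≡ realPart x
  realPart-unique {x} {s} f k = sym (trans (cong (half *_) (x-y≡0⇒x≡y (begin
    x + conj x + - (s + s)               ≡⟨ solve 3 (λ x y s → x :+ y :+ :- (s :+ s) := (y :+ :- s) :+ (x :+ :- s)) refl x (conj x) s ⟩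
    (conj x + - s) + (x + - s)           ≡⟨ cong (_+ (x + - s)) (trans (cong (λ z → conj x + - z) (sym f)) (trans (cong (conj x +_) (sym (conj-neg s))) (sym (conj-+ x (- s))))) ⟩
    conj (x + - s) + (x + - s)           ≡⟨ cong (_+ (x + - s)) k ⟩
    - (x + - s) + (x + - s)              ≡⟨ -‿inverseˡ (x + - s) ⟩
    0#                                   ∎))) (halves s))

  skewPart-skew : ∀ x → Skew (x + - realPart x)
  skewPart-skew x = begin
    conj (x + - realPart x)              ≡⟨ trans (conj-+ x _) (cong (conj x +_) (trans (conj-neg _) (cong -_ (realPart-fixed x)))) ⟩
    conj x + - realPart x                ≡⟨ x-y≡0⇒x≡y (begin
      conj x + - p + - - (x + - p)         ≡⟨ solve 3 (λ x y p → y :+ :- p :+ :- (:- (x :+ :- p)) := (x :+ y) :+ :- (p :+ p)) refl x (conj x) p ⟩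
      (x + conj x) + - (p + p)             ≡⟨ x≡y⇒x-y≡0 (sym (trans (sym (distribˡ half _ _)) (halves (x + conj x)))) ⟩
      0#                                   ∎) ⟩
    - (x + - realPart x)                 ∎
    where p = realPart x

  -- Multiplication by the skew unit `θ` carries the fixed elements bijectively to the skew ones.
  fixedCount : S (λ x → [ fixed? x ]) ≡ S (λ x → [ skew? x ])
  fixedCount = trans (S-cong (λ x → []-⇔ (fixed? x) (skew? (θ * x))
      (λ f → trans (conj-* θ x) (trans (cong₂ _*_ conj-θ f) (solve 2 (λ t x → :- t :* x := :- (t :* x)) refl θ x)))
      (λ s → *-cancelˡ θ≢0 (begin
        θ * conj x          ≡⟨ solve 2 (λ t y → t :* y := :- (:- t :* y)) refl θ (conj x) ⟩
        - (- θ * conj x)    ≡⟨ cong (λ z → - (z * conj x)) conj-θ ⟨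
        - (conj θ * conj x) ≡⟨ cong -_ (trans (sym (conj-* θ x)) s) ⟩
        - - (θ * x)         ≡⟨ solve 1 (λ y → :- (:- y) := y) refl (θ * x) ⟩
        θ * x               ∎))))
    (S-reindex (λ x → [ skew? x ]) (θ *_) (w *_)
      (λ x → trans (sym (*-assoc θ w x)) (trans (cong (_* x) θw≡1) (*-identityˡ x)))
      (λ x → trans (sym (*-assoc w θ x)) (trans (cong (_* x) (trans (*-comm w θ) θw≡1)) (*-identityˡ x))))
    where
    w = proj₁ (inverse θ θ≢0)
    θw≡1 = proj₂ (inverse θ θ≢0)

  -- Every element is uniquely a fixed one plus a skew one.
  fixed*skew : S (λ x → [ fixed? x ]) ⊠ S (λ x → [ skew? x ]) ≡ r ⊠ r
  fixed*skew = begin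
    S (λ x → [ fixed? x ]) ⊠ S (λ x → [ skew? x ])        ≡⟨ S-*ʳ _ (λ x → [ fixed? x ]) ⟨
    S (λ s → [ fixed? s ] ⊠ S (λ x → [ skew? x ]))        ≡⟨ S-cong (λ s → cong ([ fixed? s ] ⊠_)
                                                             (sym (S-reindex (λ x → [ skew? x ]) (_+ - s) (_+ s)
                                                               (λ x → solve 2 (λ x s → x :+ s :+ :- s := x) refl x s)
                                                               (λ x → solve 2 (λ x s → x :+ :- s :+ s := x) refl x s)))) ⟩
    S (λ s → [ fixed? s ] ⊠ S (λ x → [ skew? (x + - s) ]))  ≡⟨ S-cong (λ s → sym (S-*ˡ [ fixed? s ] (λ x → [ skew? (x + - s) ]))) ⟩
    S (λ s → S (λ x → [ fixed? s ] ⊠ [ skew? (x + - s) ]))  ≡⟨ S-swap (λ s x → [ fixed? s ] ⊠ [ skew? (x + - s) ]) ⟩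
    S (λ x → S (λ s → [ fixed? s ] ⊠ [ skew? (x + - s) ]))  ≡⟨ S-cong (λ x → trans
                                                               (S-cong (λ s → []-× (fixed? s) (skew? (x + - s))))
                                                               (S-unique (λ s → fixed? s ×-dec skew? (x + - s)) (realPart x)
                                                                 (λ s (f , k) → realPart-unique f k)
                                                                 (realPart-fixed x , skewPart-skew x))) ⟩
    S (λ x → 1ℚ)                                          ≡⟨ trans (S-const 1ℚ) (ℚₚ.*-identityʳ _) ⟩
    r ⊠ r                                                 ∎

  -- Fixed and skew elements are equally many and the product of the two counts is q². The counts
  -- being natural numbers, each equals q.
  S-skew : S (λ x → [ skew? x ]) ≡ r
  S-skew = trans count (cong (ι ∘ ℤ.pos) (square-injective {c} {q} (ι-injective {c ℕ.* c} {q ℕ.* q} (begin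
    ι (ℤ.pos (c ℕ.* c))             ≡⟨ trans (cong ι (ℤₚ.pos-* c c)) (ι-* (ℤ.pos c) (ℤ.pos c)) ⟩
    ι (ℤ.pos c) ⊠ ι (ℤ.pos c)       ≡⟨ cong₂ _⊠_ (trans fixedCount count) count ⟨
    S (λ x → [ fixed? x ]) ⊠ S (λ x → [ skew? x ])  ≡⟨ fixed*skew ⟩
    r ⊠ r                           ≡⟨ trans (cong ι (ℤₚ.pos-* q q)) (ι-* (ℤ.pos q) (ℤ.pos q)) ⟨
    ι (ℤ.pos (q ℕ.* q))             ∎))))
    where
    c = countF (λ i → does (skew? (point i)))
    count : S (λ x → [ skew? x ]) ≡ ι (ℤ.pos c)
    count = ∑-countF size (λ i → does (skew? (point i)))
    square-injective : ∀ {a b} → a ℕ.* a ≡ b ℕ.* b → a ≡ b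
    square-injective {a} {b} e = ℕₚ.≤-antisym
      (ℕₚ.≮⇒≥ (λ b<a → ℕₚ.<⇒≢ (ℕₚ.*-mono-< b<a b<a) (sym e)))
      (ℕₚ.≮⇒≥ (λ a<b → ℕₚ.<⇒≢ (ℕₚ.*-mono-< a<b a<b) e))

  S-fixed : S (λ x → [ fixed? x ]) ≡ r
  S-fixed = trans fixedCount S-skew

  S-zero : S (λ x → [ x ≟ 0# ]) ≡ 1ℚ
  S-zero = S-unique (_≟ 0#) 0# (λ _ → id) refl

  -- The argument runs bijectively through the field for κ ≠ 0 and is constant for κ = 0. The
  -- indicator merges the cases, so that later sums over slopes stay linear.
  S-affine : ∀ (h : Carrier → ℚ) κ c →
    S (λ β → h (c + β * κ)) ≡ S h ⊞ [ κ ≟ 0# ] ⊠ (r ⊠ r ⊠ h c ⊟ S h)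
  S-affine h κ c with κ ≟ 0#
  ... | yes refl = begin
    S (λ β → h (c + β * 0#))             ≡⟨ S-cong (λ β → cong h (trans (cong (c +_) (zeroʳ β)) (+-identityʳ c))) ⟩
    S (λ _ → h c)                        ≡⟨ S-const (h c) ⟩
    r ⊠ r ⊠ h c                          ≡⟨ lem (S h) (r ⊠ r ⊠ h c) ⟩
    S h ⊞ 1ℚ ⊠ (r ⊠ r ⊠ h c ⊟ S h)       ∎
    where
    lem : ∀ s t → t ≡ s ⊞ 1ℚ ⊠ (t ⊟ s)
    lem = solve-∀ ℚ-ring
  ... | no κ≢0 = trans (S-reindex h (λ β → c + β * κ) (λ y → (y + - c) * w)
      (λ y → begin
        c + (y + - c) * w * κ     ≡⟨ solve 4 (λ c y w k → c :+ (y :+ :- c) :* w :* k := c :+ (y :+ :- c) :* (k :* w)) refl c y w κ ⟩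
        c + (y + - c) * (κ * w)   ≡⟨ cong (λ z → c + (y + - c) * z) κw≡1 ⟩
        c + (y + - c) * 1#        ≡⟨ cong (c +_) (*-identityʳ _) ⟩
        c + (y + - c)             ≡⟨ solve 2 (λ c y → c :+ (y :+ :- c) := y) refl c y ⟩
        y                         ∎)
      (λ β → begin
        (c + β * κ + - c) * w     ≡⟨ solve 4 (λ c b w k → (c :+ b :* k :+ :- c) :* w := b :* (k :* w)) refl c β w κ ⟩
        β * (κ * w)               ≡⟨ trans (cong (β *_) κw≡1) (*-identityʳ β) ⟩
        β                         ∎))
      (lem (S h) (r ⊠ r ⊠ h c ⊟ S h))
    where
    w = proj₁ (inverse κ κ≢0)
    κw≡1 = proj₂ (inverse κ κ≢0)
    lem : ∀ s t → s ≡ s ⊞ 0ℚ ⊠ t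
    lem = solve-∀ ℚ-ring

  S-nonzero : ∀ (g : Carrier → ℚ) → S (λ β → [ ¬? (β ≟ 0#) ] ⊠ g β) ≡ S g ⊟ g 0#
  S-nonzero g = begin
    S (λ β → [ ¬? (β ≟ 0#) ] ⊠ g β)                ≡⟨ S-cong (λ β → trans (cong (_⊠ g β) ([]-¬ (β ≟ 0#))) (lem [ β ≟ 0# ] (g β))) ⟩
    S (λ β → g β ⊞ Rat.- 1ℚ ⊠ ([ β ≟ 0# ] ⊠ g β))  ≡⟨ S-+ g (λ β → Rat.- 1ℚ ⊠ ([ β ≟ 0# ] ⊠ g β)) ⟩
    S g ⊞ S (λ β → Rat.- 1ℚ ⊠ ([ β ≟ 0# ] ⊠ g β))  ≡⟨ cong (S g ⊞_) (trans (S-*ˡ (Rat.- 1ℚ) (λ β → [ β ≟ 0# ] ⊠ g β)) (cong (Rat.- 1ℚ ⊠_) (S-point 0# g))) ⟩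
    S g ⊞ Rat.- 1ℚ ⊠ g 0#                          ≡⟨ cong (S g ⊞_) (ℚₚ.neg-distribˡ-* 1ℚ (g 0#)) ⟨
    S g ⊞ Rat.- (1ℚ ⊠ g 0#)                        ≡⟨ cong (λ z → S g ⊟ z) (ℚₚ.*-identityˡ (g 0#)) ⟩
    S g ⊟ g 0#                                     ∎
    where
    lem : ∀ b g → (1ℚ ⊟ b) ⊠ g ≡ g ⊞ Rat.- 1ℚ ⊠ (b ⊠ g)
    lem = solve-∀ ℚ-ring

  norm-≢0 : ∀ {x} → x ≢ 0# → x * conj x ≢ 0#
  norm-≢0 x≢0 = *-≢0# x≢0 (conj-≢0 x≢0)

  -- The factor β conj β is a norm, hence a unit of GF(q), and such factors preserve skewness in
  -- both directions.
  skew-scaled : ∀ τ β → β ≢ 0# → [ skew? (τ * β * conj β) ] ≡ [ skew? τ ]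
  skew-scaled τ β β≢0 = []-⇔ (skew? (τ * β * conj β)) (skew? τ)
    (λ s → *-cancelˡ (norm-≢0 β≢0) (begin
      β * conj β * conj τ          ≡⟨ solve 3 (λ b c t → b :* c :* t := t :* c :* b) refl β (conj β) (conj τ) ⟩
      conj τ * conj β * β          ≡⟨ image ⟨
      conj (τ * β * conj β)        ≡⟨ s ⟩
      - (τ * β * conj β)           ≡⟨ solve 3 (λ b c t → :- (t :* b :* c) := b :* c :* :- t) refl β (conj β) τ ⟩
      β * conj β * - τ             ∎))
    (λ s → begin
      conj (τ * β * conj β)        ≡⟨ image ⟩
      conj τ * conj β * β          ≡⟨ cong (λ z → z * conj β * β) s ⟩
      - τ * conj β * β             ≡⟨ solve 3 (λ b c t → :- t :* c :* b := :- (t :* b :* c)) refl β (conj β) τ ⟩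
      - (τ * β * conj β)           ∎)
    where
    image : conj (τ * β * conj β) ≡ conj τ * conj β * β
    image = trans (conj-* (τ * β) (conj β)) (cong₂ _*_ (conj-* τ β) (conj-conj β))

  -- The isotropic vectors (α , β) of the form α β̄ + ᾱ β: either β = 0, or α = τ β with τ skew.
  S-isotropic : ∀ (g : Carrier → Carrier → ℚ) →
    S (λ α → S (λ β → [ skew? (α * conj β) ] ⊠ g α β)) ≡
    S (λ α → g α 0#) ⊞ S (λ τ → [ skew? τ ] ⊠ (S (λ β → g (τ * β) β) ⊟ g 0# 0#))
  S-isotropic g = begin
    S (λ α → S (λ β → [ skew? (α * conj β) ] ⊠ g α β))      ≡⟨ S-swap (λ α β → [ skew? (α * conj β) ] ⊠ g α β) ⟩
    S G                                                     ≡⟨ lem₁ (G 0#) (S G) ⟩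
    G 0# ⊞ (S G ⊟ G 0#)                                     ≡⟨ cong₂ _⊞_ β≡0 (trans (sym (S-nonzero G)) β≢0) ⟩
    S (λ α → g α 0#) ⊞ S (λ τ → [ skew? τ ] ⊠ (S (λ β → g (τ * β) β) ⊟ g 0# 0#))  ∎
    where
    G : Carrier → ℚ
    G β = S (λ α → [ skew? (α * conj β) ] ⊠ g α β)
    lem₁ : ∀ a b → b ≡ a ⊞ (b ⊟ a)
    lem₁ = solve-∀ ℚ-ring
    β≡0 : G 0# ≡ S (λ α → g α 0#)
    β≡0 = S-cong (λ α → trans (cong (_⊠ g α 0#) ([]-yes (skew? (α * conj 0#))
        (subst Skew (sym (trans (cong (α *_) conj-0) (zeroʳ α))) skew-0))) (ℚₚ.*-identityˡ (g α 0#)))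
    rescale : ∀ β → β ≢ 0# → G β ≡ S (λ τ → [ skew? τ ] ⊠ g (τ * β) β)
    rescale β β≢0 = trans
      (sym (S-reindex (λ α → [ skew? (α * conj β) ] ⊠ g α β) (_* β) (_* w)
        (λ x → trans (*-assoc x w β) (trans (cong (x *_) (trans (*-comm w β) βw≡1)) (*-identityʳ x)))
        (λ x → trans (*-assoc x β w) (trans (cong (x *_) βw≡1) (*-identityʳ x)))))
      (S-cong (λ τ → cong (_⊠ g (τ * β) β) (skew-scaled τ β β≢0)))
      where
      w = proj₁ (inverse β β≢0)
      βw≡1 = proj₂ (inverse β β≢0)
    swap : ∀ a b c → a ⊠ (b ⊠ c) ≡ b ⊠ (a ⊠ c)
    swap = solve-∀ ℚ-ring
    β≢0 : S (λ β → [ ¬? (β ≟ 0#) ] ⊠ G β) ≡ S (λ τ → [ skew? τ ] ⊠ (S (λ β → g (τ * β) β) ⊟ g 0# 0#))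
    β≢0 = begin
      S (λ β → [ ¬? (β ≟ 0#) ] ⊠ G β)
        ≡⟨ S-cong (λ β → trans ([]-*-cong (¬? (β ≟ 0#)) (rescale β))
             (sym (S-*ˡ [ ¬? (β ≟ 0#) ] (λ τ → [ skew? τ ] ⊠ g (τ * β) β)))) ⟩
      S (λ β → S (λ τ → [ ¬? (β ≟ 0#) ] ⊠ ([ skew? τ ] ⊠ g (τ * β) β)))
        ≡⟨ S-swap (λ β τ → [ ¬? (β ≟ 0#) ] ⊠ ([ skew? τ ] ⊠ g (τ * β) β)) ⟩
      S (λ τ → S (λ β → [ ¬? (β ≟ 0#) ] ⊠ ([ skew? τ ] ⊠ g (τ * β) β)))
        ≡⟨ S-cong (λ τ → trans (S-cong (λ β → swap [ ¬? (β ≟ 0#) ] [ skew? τ ] (g (τ * β) β)))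
             (trans (S-*ˡ [ skew? τ ] (λ β → [ ¬? (β ≟ 0#) ] ⊠ g (τ * β) β))
               (cong ([ skew? τ ] ⊠_) (trans (S-nonzero (λ β → g (τ * β) β))
                 (cong (λ z → S (λ β → g (τ * β) β) ⊟ g z 0#) (zeroʳ τ)))))) ⟩
      S (λ τ → [ skew? τ ] ⊠ (S (λ β → g (τ * β) β) ⊟ g 0# 0#))  ∎

  origin? : ∀ a b → Dec (a ≡ 0# × b ≡ 0#)
  origin? a b = (a ≟ 0#) ×-dec (b ≟ 0#)

  -- The number of isotropic points of the line orthogonal to (a , b).
  isotropic-perp : ∀ a b → [ conj b ≟ 0# ] ⊞ S (λ τ → [ skew? τ ] ⊠ [ (τ * conj b + conj a) ≟ 0# ]) ≡
                           [ skew? (a * conj b) ] ⊞ r ⊠ [ origin? a b ]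
  isotropic-perp a b = cases (a ≟ 0#) (b ≟ 0#)
    where
    W = [ conj b ≟ 0# ] ⊞ S (λ τ → [ skew? τ ] ⊠ [ (τ * conj b + conj a) ≟ 0# ])
    W′ = [ skew? (a * conj b) ] ⊞ r ⊠ [ origin? a b ]
    b≡0⇒ : b ≡ 0# → conj b ≡ 0#
    b≡0⇒ e = trans (cong conj e) conj-0
    skew-yes : b ≡ 0# → [ skew? (a * conj b) ] ≡ 1ℚ
    skew-yes e = []-yes (skew? (a * conj b)) (subst Skew (sym (trans (cong (a *_) (b≡0⇒ e)) (zeroʳ a))) skew-0)
    term : b ≡ 0# → ∀ τ → τ * conj b + conj a ≡ conj a
    term e τ = trans (cong (_+ conj a) (trans (cong (τ *_) (b≡0⇒ e)) (zeroʳ τ))) (+-identityˡ (conj a))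
    cases : Dec (a ≡ 0#) → Dec (b ≡ 0#) → W ≡ W′
    cases (yes a≡0) (yes b≡0) = cong₂ _⊞_ (trans ([]-yes (conj b ≟ 0#) (b≡0⇒ b≡0)) (sym (skew-yes b≡0)))
      (trans (S-cong (λ τ → trans (cong ([ skew? τ ] ⊠_) ([]-yes ((τ * conj b + conj a) ≟ 0#)
          (trans (term b≡0 τ) (trans (cong conj a≡0) conj-0)))) (ℚₚ.*-identityʳ [ skew? τ ])))
        (trans S-skew (trans (sym (ℚₚ.*-identityʳ r)) (cong (r ⊠_) (sym ([]-yes (origin? a b) (a≡0 , b≡0)))))))
    cases (no a≢0) (yes b≡0) = cong₂ _⊞_ (trans ([]-yes (conj b ≟ 0#) (b≡0⇒ b≡0)) (sym (skew-yes b≡0)))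
      (trans (trans (S-cong (λ τ → trans (cong ([ skew? τ ] ⊠_) ([]-no ((τ * conj b + conj a) ≟ 0#)
          (λ e → conj-≢0 a≢0 (trans (sym (term b≡0 τ)) e)))) (ℚₚ.*-zeroʳ [ skew? τ ]))) S-0)
        (sym (trans (cong (r ⊠_) ([]-no (origin? a b) (a≢0 ∘ proj₁))) (ℚₚ.*-zeroʳ r))))
    cases _ (no b≢0) = begin
      W
        ≡⟨ cong₂ _⊞_ ([]-no (conj b ≟ 0#) (conj-≢0 b≢0))
             (S-cong (λ τ → trans (ℚₚ.*-comm [ skew? τ ] [ (τ * conj b + conj a) ≟ 0# ]) (cong (_⊠ [ skew? τ ])
               ([]-⇔ ((τ * conj b + conj a) ≟ 0#) (τ ≟ τ₀) (root τ) (λ { refl → τ₀-root }))))) ⟩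
      0ℚ ⊞ S (λ τ → [ τ ≟ τ₀ ] ⊠ [ skew? τ ])     ≡⟨ cong (0ℚ ⊞_) (S-point τ₀ (λ τ → [ skew? τ ])) ⟩
      0ℚ ⊞ [ skew? τ₀ ]                           ≡⟨ cong (0ℚ ⊞_) (trans (sym (skew-scaled τ₀ b b≢0))
                                                     ([]-⇔ (skew? (τ₀ * b * conj b)) (skew? (a * conj b)) to from)) ⟩
      0ℚ ⊞ [ skew? (a * conj b) ]                 ≡⟨ trans (ℚₚ.+-comm 0ℚ [ skew? (a * conj b) ]) (cong ([ skew? (a * conj b) ] ⊞_) (sym
                                                     (trans (cong (r ⊠_) ([]-no (origin? a b) (b≢0 ∘ proj₂))) (ℚₚ.*-zeroʳ r)))) ⟩
      W′                                          ∎
      where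
      w = proj₁ (inverse (conj b) (conj-≢0 b≢0))
      bw≡1 = proj₂ (inverse (conj b) (conj-≢0 b≢0))
      τ₀ = - (conj a * w)
      root : ∀ τ → τ * conj b + conj a ≡ 0# → τ ≡ τ₀
      root τ e = x-y≡0⇒x≡y (begin
        τ + - τ₀                           ≡⟨ cong (_+ - τ₀) (trans (cong (τ *_) bw≡1) (*-identityʳ τ)) ⟨
        τ * (conj b * w) + - τ₀            ≡⟨ solve 4 (λ t b a w → t :* (b :* w) :+ :- (:- (a :* w)) := (t :* b :+ a) :* w) refl τ (conj b) (conj a) w ⟩
        (τ * conj b + conj a) * w          ≡⟨ cong (_* w) e ⟩
        0# * w                             ≡⟨ zeroˡ w ⟩
        0#                                 ∎)
      τ₀-root : τ₀ * conj b + conj a ≡ 0#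
      τ₀-root = begin
        - (conj a * w) * conj b + conj a   ≡⟨ solve 3 (λ a w b → :- (a :* w) :* b :+ a := a :+ :- (a :* (b :* w))) refl (conj a) w (conj b) ⟩
        conj a + - (conj a * (conj b * w)) ≡⟨ x≡y⇒x-y≡0 (sym (trans (cong (conj a *_) bw≡1) (*-identityʳ (conj a)))) ⟩
        0#                                 ∎
      -- Up to a norm, τ₀ is therefore minus the conjugate of a conj b, so the one candidate slope
      -- is skew exactly when a conj b is.
      image : τ₀ * b * conj b ≡ - conj (a * conj b)
      image = begin
        - (conj a * w) * b * conj b        ≡⟨ solve 4 (λ a w b c → :- (a :* w) :* b :* c := :- (a :* b :* (c :* w))) refl (conj a) w b (conj b) ⟩
        - (conj a * b * (conj b * w))      ≡⟨ cong -_ (trans (cong (conj a * b *_) bw≡1) (*-identityʳ _)) ⟩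
        - (conj a * b)                     ≡⟨ cong -_ (sym (trans (conj-* a (conj b)) (cong (conj a *_) (conj-conj b)))) ⟩
        - conj (a * conj b)                ∎
      to : Skew (τ₀ * b * conj b) → Skew (a * conj b)
      to s = begin
        conj (a * conj b)                  ≡⟨ solve 1 (λ x → x := :- (:- x)) refl (conj (a * conj b)) ⟩
        - - conj (a * conj b)              ≡⟨ cong -_ (sym image) ⟩
        - (τ₀ * b * conj b)                ≡⟨ s ⟨
        conj (τ₀ * b * conj b)             ≡⟨ trans (cong conj image) (trans (conj-neg _) (cong -_ (conj-conj _))) ⟩
        - (a * conj b)                     ∎
      from : Skew (a * conj b) → Skew (τ₀ * b * conj b)
      from s = begin
        conj (τ₀ * b * conj b)             ≡⟨ trans (cong conj image) (trans (conj-neg _) (cong -_ (conj-conj _))) ⟩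
        - (a * conj b)                     ≡⟨ s ⟨
        conj (a * conj b)                  ≡⟨ solve 1 (λ x → x := :- (:- x)) refl (conj (a * conj b)) ⟩
        - - conj (a * conj b)              ≡⟨ cong -_ (sym image) ⟩
        - (τ₀ * b * conj b)                ∎

  module _ (h : Carrier → ℚ) (a b c : Carrier) where
    private
      s = S h
      u = r ⊠ r ⊠ h c ⊟ s

    -- The isotropic vectors fill q + 1 lines through the origin. Along a line `h` sums to `S h`, or
    -- to q² h(c) if the linear part vanishes there; `isotropic-perp` counts the lines of the second
    -- kind. The origin lies on all q + 1 lines, whence the subtraction of q h(c).
    S-isotropic-form : S (λ α → S (λ β → [ skew? (α * conj β) ] ⊠ h (c + (α * conj b + β * conj a)))) ≡
      s ⊞ r ⊠ s ⊟ r ⊠ h c ⊞ ([ skew? (a * conj b) ] ⊞ r ⊠ [ origin? a b ]) ⊠ (r ⊠ r ⊠ h c ⊟ s)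
    S-isotropic-form = begin
      S (λ α → S (λ β → [ skew? (α * conj β) ] ⊠ h (c + (α * conj b + β * conj a))))
        ≡⟨ S-isotropic (λ α β → h (c + (α * conj b + β * conj a))) ⟩
      S (λ α → h (c + (α * conj b + 0# * conj a))) ⊞
        S (λ τ → [ skew? τ ] ⊠ (S (λ β → h (c + (τ * β * conj b + β * conj a))) ⊟ h (c + (0# * conj b + 0# * conj a))))
        ≡⟨ cong₂ _⊞_
             (trans (S-cong (λ α → cong h (cong (c +_) (trans (cong (α * conj b +_) (zeroˡ (conj a))) (+-identityʳ _)))))
               (S-affine h (conj b) c))
             (trans (S-cong (λ τ → trans (cong ([ skew? τ ] ⊠_) (cong₂ _⊟_ (inner τ) (cong h base)))
                 (lem₁ [ skew? τ ] s (h c) [ (τ * conj b + conj a) ≟ 0# ] u)))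
               (trans (S-+ (λ τ → [ skew? τ ] ⊠ (s ⊟ h c)) (λ τ → [ skew? τ ] ⊠ [ (τ * conj b + conj a) ≟ 0# ] ⊠ u))
                 (cong₂ _⊞_ (trans (S-*ʳ (s ⊟ h c) (λ τ → [ skew? τ ])) (cong (_⊠ (s ⊟ h c)) S-skew))
                   (S-*ʳ u (λ τ → [ skew? τ ] ⊠ [ (τ * conj b + conj a) ≟ 0# ]))))) ⟩
      (s ⊞ [ conj b ≟ 0# ] ⊠ u) ⊞ (r ⊠ (s ⊟ h c) ⊞ Z ⊠ u)   ≡⟨ lem₂ s [ conj b ≟ 0# ] r (h c) Z u ⟩
      s ⊞ r ⊠ s ⊟ r ⊠ h c ⊞ ([ conj b ≟ 0# ] ⊞ Z) ⊠ u       ≡⟨ cong (λ z → s ⊞ r ⊠ s ⊟ r ⊠ h c ⊞ z ⊠ u) (isotropic-perp a b) ⟩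
      s ⊞ r ⊠ s ⊟ r ⊠ h c ⊞ ([ skew? (a * conj b) ] ⊞ r ⊠ [ origin? a b ]) ⊠ u  ∎
      where
      Z = S (λ τ → [ skew? τ ] ⊠ [ (τ * conj b + conj a) ≟ 0# ])
      base : c + (0# * conj b + 0# * conj a) ≡ c
      base = trans (cong (c +_) (trans (cong₂ _+_ (zeroˡ (conj b)) (zeroˡ (conj a))) (+-identityˡ 0#))) (+-identityʳ c)
      inner : ∀ τ → S (λ β → h (c + (τ * β * conj b + β * conj a))) ≡ s ⊞ [ (τ * conj b + conj a) ≟ 0# ] ⊠ u
      inner τ = trans (S-cong (λ β → cong h (solve 5 (λ c t β b a → c :+ (t :* β :* b :+ β :* a) := c :+ β :* (t :* b :+ a))
        refl c τ β (conj b) (conj a)))) (S-affine h (τ * conj b + conj a) c)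
      lem₁ : ∀ k s d z u → k ⊠ (s ⊞ z ⊠ u ⊟ d) ≡ k ⊠ (s ⊟ d) ⊞ k ⊠ z ⊠ u
      lem₁ = solve-∀ ℚ-ring
      lem₂ : ∀ s b r d z u → (s ⊞ b ⊠ u) ⊞ (r ⊠ (s ⊟ d) ⊞ z ⊠ u) ≡ s ⊞ r ⊠ s ⊟ r ⊠ d ⊞ (b ⊞ z) ⊠ u
      lem₂ = solve-∀ ℚ-ring

    -- A nonzero linear form in two variables takes each value q² times; the indicator corrects for
    -- the zero form, where all q⁴ arguments give h(c).
    S-form : S (λ α → S (λ β → h (c + (α * conj b + β * conj a)))) ≡
      r ⊠ r ⊠ s ⊞ [ origin? a b ] ⊠ (r ⊠ r ⊠ (r ⊠ r ⊠ h c ⊟ s))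
    S-form = trans (S-cong (λ α → trans (S-cong (λ β → cong h (sym (+-assoc c (α * conj b) (β * conj a)))))
        (S-affine h (conj a) (c + α * conj b))))
      (trans (S-+ (λ _ → s) (λ α → [ conj a ≟ 0# ] ⊠ (r ⊠ r ⊠ h (c + α * conj b) ⊟ s)))
        (cong₂ _⊞_ (S-const s) (trans (S-*ˡ [ conj a ≟ 0# ] (λ α → r ⊠ r ⊠ h (c + α * conj b) ⊟ s))
          (trans (cong ([ conj a ≟ 0# ] ⊠_) (trans (S-+ (λ α → r ⊠ r ⊠ h (c + α * conj b)) (λ _ → Rat.- s))
              (trans (cong₂ _⊞_ (trans (S-*ˡ (r ⊠ r) (λ α → h (c + α * conj b))) (cong (r ⊠ r ⊠_) (S-affine h (conj b) c)))
                  (S-const (Rat.- s)))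
                (lem₁ r s [ conj b ≟ 0# ] u))))
            (trans (sym (ℚₚ.*-assoc [ conj a ≟ 0# ] [ conj b ≟ 0# ] _)) (cong (_⊠ (r ⊠ r ⊠ u))
              (trans ([]-× (conj a ≟ 0#) (conj b ≟ 0#))
                ([]-⇔ ((conj a ≟ 0#) ×-dec (conj b ≟ 0#)) (origin? a b)
                  (λ (p , p′) → conj-0⁻¹ p , conj-0⁻¹ p′)
                  (λ (p , p′) → trans (cong conj p) conj-0 , trans (cong conj p′) conj-0)))))))))
      where
      conj-0⁻¹ : ∀ {x} → conj x ≡ 0# → x ≡ 0#
      conj-0⁻¹ {x} e = trans (sym (conj-conj x)) (trans (cong conj e) conj-0)
      lem₁ : ∀ r s z u → r ⊠ r ⊠ (s ⊞ z ⊠ u) ⊞ r ⊠ r ⊠ (Rat.- s) ≡ z ⊠ (r ⊠ r ⊠ u)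
      lem₁ = solve-∀ ℚ-ring

  -- The Hermitian form and hyperbolic frames.

  infixl 6 _⊹_
  infixr 7 _·_
  _⊹_ : V4 → V4 → V4
  _⊹_ = _+V_
  _·_ : Carrier → V4 → V4
  _·_ = _·V_

  v4-≡ : ∀ {a b c d a′ b′ c′ d′} → a ≡ a′ → b ≡ b′ → c ≡ c′ → d ≡ d′ → v4 a b c d ≡ v4 a′ b′ c′ d′
  v4-≡ refl refl refl refl = refl

  :0 :1 : ∀ {n} → Solver.Polynomial n
  :0 = con (ℤ.pos 0)
  :1 = con (ℤ.pos 1)

  :h :combination : ∀ {n} (_ _ _ _ _ _ _ _ : Solver.Polynomial n) → Solver.Polynomial n
  :h u0 u1 u2 u3 w0 w1 w2 w3 = u0 :* w3 :+ :- (u1 :* w1) :+ :- (u2 :* w2) :+ u3 :* w0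
  :combination A B C E o f g p = A :* o :+ (B :* f :+ (C :* g :+ E :* p))

  h-⊹ˡ : ∀ u v w → h (u ⊹ v) w ≡ h u w + h v w
  h-⊹ˡ u v w = solve 12 (λ u0 u1 u2 u3 v0 v1 v2 v3 w0 w1 w2 w3 →
      :h (u0 :+ v0) (u1 :+ v1) (u2 :+ v2) (u3 :+ v3) w0 w1 w2 w3 := :h u0 u1 u2 u3 w0 w1 w2 w3 :+ :h v0 v1 v2 v3 w0 w1 w2 w3)
    refl (x0 u) (x1 u) (x2 u) (x3 u) (x0 v) (x1 v) (x2 v) (x3 v) (conj (x0 w)) (conj (x1 w)) (conj (x2 w)) (conj (x3 w))

  h-·ˡ : ∀ a u w → h (a · u) w ≡ a * h u w
  h-·ˡ a u w = solve 9 (λ a u0 u1 u2 u3 w0 w1 w2 w3 →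
      :h (a :* u0) (a :* u1) (a :* u2) (a :* u3) w0 w1 w2 w3 := a :* :h u0 u1 u2 u3 w0 w1 w2 w3)
    refl a (x0 u) (x1 u) (x2 u) (x3 u) (conj (x0 w)) (conj (x1 w)) (conj (x2 w)) (conj (x3 w))

  conj-h : ∀ u v → conj (h u v) ≡ h v u
  conj-h u v = begin
    conj (h u v)
      ≡⟨ trans (conj-+ _ _) (cong₂ _+_ (trans (conj-+ _ _) (cong₂ _+_ (trans (conj-+ _ _) (cong₂ _+_ (term (x0 u) (x3 v))
           (trans (conj-neg _) (cong -_ (term (x1 u) (x1 v)))))) (trans (conj-neg _) (cong -_ (term (x2 u) (x2 v)))))) (term (x3 u) (x0 v))) ⟩
    conj (x0 u) * x3 v + - (conj (x1 u) * x1 v) + - (conj (x2 u) * x2 v) + conj (x3 u) * x0 v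
      ≡⟨ solve 8 (λ u0 u1 u2 u3 v0 v1 v2 v3 → :h u0 u1 u2 u3 v0 v1 v2 v3 := :h v0 v1 v2 v3 u0 u1 u2 u3) refl
           (conj (x0 u)) (conj (x1 u)) (conj (x2 u)) (conj (x3 u)) (x0 v) (x1 v) (x2 v) (x3 v) ⟩
    h v u ∎
    where
    term : ∀ a b → conj (a * conj b) ≡ conj a * b
    term a b = trans (conj-* a (conj b)) (cong (conj a *_) (conj-conj b))

  h-⊹ʳ : ∀ u v w → h u (v ⊹ w) ≡ h u v + h u w
  h-⊹ʳ u v w = begin
    h u (v ⊹ w)                     ≡⟨ conj-h (v ⊹ w) u ⟨
    conj (h (v ⊹ w) u)              ≡⟨ cong conj (h-⊹ˡ v w u) ⟩
    conj (h v u + h w u)            ≡⟨ conj-+ _ _ ⟩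
    conj (h v u) + conj (h w u)     ≡⟨ cong₂ _+_ (conj-h v u) (conj-h w u) ⟩
    h u v + h u w                   ∎

  h-·ʳ : ∀ a u w → h u (a · w) ≡ conj a * h u w
  h-·ʳ a u w = begin
    h u (a · w)                     ≡⟨ conj-h (a · w) u ⟨
    conj (h (a · w) u)              ≡⟨ cong conj (h-·ˡ a w u) ⟩
    conj (a * h w u)                ≡⟨ conj-* _ _ ⟩
    conj a * conj (h w u)           ≡⟨ cong (conj a *_) (conj-h w u) ⟩
    conj a * h u w                  ∎

  h-sym-value : ∀ {u v c} → h u v ≡ c → h v u ≡ conj c
  h-sym-value {u} {v} e = trans (sym (conj-h u v)) (cong conj e)

  h-sym-0 : ∀ {u v} → h u v ≡ 0# → h v u ≡ 0#
  h-sym-0 e = trans (h-sym-value e) conj-0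

  h-sym-1 : ∀ {u v} → h u v ≡ 1# → h v u ≡ 1#
  h-sym-1 e = trans (h-sym-value e) conj-1

  -- Hyperbolic frame: two orthogonal hyperbolic pairs (o , p) and (f , g).
  record Frame (p : V4) : Set where
    field
      o f g : V4
      op : h o p ≡ 1#
      oo : h o o ≡ 0#
      fp : h f p ≡ 0#
      fo : h f o ≡ 0#
      ff : h f f ≡ 0#
      gp : h g p ≡ 0#
      go : h g o ≡ 0#
      gg : h g g ≡ 0#
      fg : h f g ≡ 1#

    combination : Carrier → Carrier → Carrier → Carrier → V4
    combination A B C E = (A · o) ⊹ ((B · f) ⊹ ((C · g) ⊹ (E · p)))

    field
      -- The coefficient at a frame vector is the product of `z` with the partner of that vector in
      -- its hyperbolic pair.
      span : ∀ z → z ≡ combination (h z p) (h z g) (h z f) (h z o)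

    h-combination : ∀ A B C E w → h (combination A B C E) w ≡ A * h o w + (B * h f w + (C * h g w + E * h p w))
    h-combination A B C E w =
      trans (h-⊹ˡ _ _ w) (cong₂ _+_ (h-·ˡ A o w) (trans (h-⊹ˡ _ _ w) (cong₂ _+_ (h-·ˡ B f w)
        (trans (h-⊹ˡ _ _ w) (cong₂ _+_ (h-·ˡ C g w) (h-·ˡ E p w))))))

    module Combination (pp : h p p ≡ 0#) (A B C E : Carrier) where
      private
        z = combination A B C E
        values : ∀ w {a b c e} → h o w ≡ a → h f w ≡ b → h g w ≡ c → h p w ≡ e →
                 h z w ≡ A * a + (B * b + (C * c + E * e))
        values w refl refl refl refl = h-combination A B C E w

      z-p : h z p ≡ A
      z-p = trans (values p op fp gp pp) (trans (solve 6 (λ A B C E o i → :combination A B C E i o o o :=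
          A :* i :+ (B :+ C :+ E) :* o) refl A B C E 0# 1#)
        (trans (cong₂ _+_ (*-identityʳ A) (zeroʳ _)) (+-identityʳ A)))

      z-g : h z g ≡ B
      z-g = trans (values g (h-sym-0 go) fg gg (h-sym-0 gp)) (trans (solve 6 (λ A B C E o i → :combination A B C E o i o o :=
          B :* i :+ (A :+ C :+ E) :* o) refl A B C E 0# 1#)
        (trans (cong₂ _+_ (*-identityʳ B) (zeroʳ _)) (+-identityʳ B)))

      z-f : h z f ≡ C
      z-f = trans (values f (h-sym-0 fo) ff (h-sym-1 fg) (h-sym-0 fp)) (trans (solve 6 (λ A B C E o i → :combination A B C E o o i o :=
          C :* i :+ (A :+ B :+ E) :* o) refl A B C E 0# 1#)
        (trans (cong₂ _+_ (*-identityʳ C) (zeroʳ _)) (+-identityʳ C)))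

      z-o : h z o ≡ E
      z-o = trans (values o oo fo go (h-sym-1 op)) (trans (solve 6 (λ A B C E o i → :combination A B C E o o o i :=
          E :* i :+ (A :+ B :+ C) :* o) refl A B C E 0# 1#)
        (trans (cong₂ _+_ (*-identityʳ E) (zeroʳ _)) (+-identityʳ E)))

    h-span : ∀ z w → h z w ≡ h z p * conj (h w o) + (h z g * conj (h w f) + (h z f * conj (h w g) + h z o * conj (h w p)))
    h-span z w = trans (cong (λ v → h v w) (span z)) (trans (h-combination _ _ _ _ w)
      (cong₂ _+_ (cong (h z p *_) (sym (conj-h w o))) (cong₂ _+_ (cong (h z g *_) (sym (conj-h w f)))
        (cong₂ _+_ (cong (h z f *_) (sym (conj-h w g))) (cong (h z o *_) (sym (conj-h w p)))))))

  -- Any isotropic `u` with h(u,p) = 1 can take the place of `o`. Adding multiples of the radical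
  -- vector `p` makes f and g orthogonal to `u` without changing their products with each other or
  -- with `p`. Thus every point of 𝒳 gets a frame containing the same `p`.
  module Recentre {p : V4} (pp : h p p ≡ 0#) (frame : Frame p) (u : V4) (up : h u p ≡ 1#) (uu : h u u ≡ 0#) where
    open Frame frame
    private
      α = h u g
      β = h u f
      f′ = f ⊹ (- conj β · p)
      g′ = g ⊹ (- conj α · p)

      shift-h : ∀ v c w → h (v ⊹ (c · p)) w ≡ h v w + c * h p w
      shift-h v c w = trans (h-⊹ˡ v (c · p) w) (cong (h v w +_) (h-·ˡ c p w))

      h-shift : ∀ v c w → h w (v ⊹ (c · p)) ≡ h w v + conj c * h w p
      h-shift v c w = trans (h-⊹ʳ w v (c · p)) (cong (h w v +_) (h-·ʳ c w p))

      drop : ∀ {x} c {y} → y ≡ 0# → x + c * y ≡ x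
      drop {x} c refl = trans (cong (x +_) (zeroʳ c)) (+-identityʳ x)

      shift-p : ∀ v c → h v p ≡ 0# → h (v ⊹ (c · p)) p ≡ 0#
      shift-p v c vp = trans (shift-h v c p) (trans (drop c pp) vp)

      shift-shift : ∀ v c w d → h v p ≡ 0# → h w p ≡ 0# → h (v ⊹ (c · p)) (w ⊹ (d · p)) ≡ h v w
      shift-shift v c w d vp wp = trans (h-shift w d (v ⊹ (c · p))) (trans (drop (conj d) (shift-p v c vp))
        (trans (shift-h v c w) (drop c (h-sym-0 wp))))

      shift-u : ∀ v → h (v ⊹ (- conj (h u v) · p)) u ≡ 0#
      shift-u v = begin
        h (v ⊹ (- conj (h u v) · p)) u       ≡⟨ shift-h v (- conj (h u v)) u ⟩
        h v u + - conj (h u v) * h p u       ≡⟨ cong₂ (λ x y → x + - conj (h u v) * y) (sym (conj-h u v)) (h-sym-1 up) ⟩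
        conj (h u v) + - conj (h u v) * 1#   ≡⟨ cong (conj (h u v) +_) (*-identityʳ _) ⟩
        conj (h u v) + - conj (h u v)        ≡⟨ -‿inverseʳ _ ⟩
        0#                                   ∎

      -- Isotropy of `u` in frame coordinates; it cancels the surplus multiple of `p` that appears
      -- in `component`.
      trace : h u o + (conj (h u o) + (α * conj β + β * conj α)) ≡ 0#
      trace = begin
        h u o + (conj (h u o) + (α * conj β + β * conj α))
          ≡⟨ solve 4 (λ l m s t → l :+ (m :+ (s :+ t)) := m :+ (s :+ (t :+ l))) refl (h u o) (conj (h u o)) (α * conj β) (β * conj α) ⟩
        conj (h u o) + (α * conj β + (β * conj α + h u o))
          ≡⟨ cong₂ (λ x y → x + (α * conj β + (β * conj α + y))) (sym (trans (cong (_* conj (h u o)) up) (*-identityˡ _)))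
               (sym (trans (cong (h u o *_) (trans (cong conj up) conj-1)) (*-identityʳ _))) ⟩
        h u p * conj (h u o) + (α * conj β + (β * conj α + h u o * conj (h u p)))  ≡⟨ h-span u u ⟨
        h u u                                ≡⟨ uu ⟩
        0#                                   ∎

    recentre : Frame p
    recentre = record
      { o = u ; f = f′ ; g = g′ ; op = up ; oo = uu
      ; fp = shift-p f _ fp ; fo = shift-u f ; ff = trans (shift-shift f _ f _ fp fp) ff
      ; gp = shift-p g _ gp ; go = shift-u g ; gg = trans (shift-shift g _ g _ gp gp) gg
      ; fg = trans (shift-shift f _ g _ fp gp) fg
      ; span = λ z → trans (span z) (sym (trans
          (cong₂ (λ B C → (h z p · u) ⊹ ((B · f′) ⊹ ((C · g′) ⊹ (h z u · p)))) (B′ z g) (B′ z f))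
          (trans (cong₂ (λ w E → (h z p · w) ⊹ (((h z g + - h u g * h z p) · f′) ⊹ (((h z f + - h u f * h z p) · g′) ⊹ (E · p)))) u-span (h-span z u))
            (v4-≡ (component z (x0 o) (x0 f) (x0 g) (x0 p)) (component z (x1 o) (x1 f) (x1 g) (x1 p))
                  (component z (x2 o) (x2 f) (x2 g) (x2 p)) (component z (x3 o) (x3 f) (x3 g) (x3 p))))))
      }
      where
      B′ : ∀ z v → h z (v ⊹ (- conj (h u v) · p)) ≡ h z v + - h u v * h z p
      B′ z v = trans (h-shift v _ z) (cong (λ c → h z v + c * h z p) (trans (conj-neg _) (cong -_ (conj-conj _))))
      u-span : u ≡ combination 1# α β (h u o)
      u-span = trans (span u) (cong (λ A → combination A α β (h u o)) up)
      component : ∀ z o₁ f₁ g₁ p₁ →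
        h z p * (1# * o₁ + (α * f₁ + (β * g₁ + h u o * p₁))) +
          ((h z g + - α * h z p) * (f₁ + - conj β * p₁) + ((h z f + - β * h z p) * (g₁ + - conj α * p₁) +
            (h z p * conj (h u o) + (h z g * conj β + (h z f * conj α + h z o * conj (h u p)))) * p₁))
        ≡ h z p * o₁ + (h z g * f₁ + (h z f * g₁ + h z o * p₁))
      component z o₁ f₁ g₁ p₁ = begin
        _ ≡⟨ cong (λ j → A * (1# * o₁ + (α * f₁ + (β * g₁ + l * p₁))) +
                ((B + - α * A) * (f₁ + - conj β * p₁) + ((C + - β * A) * (g₁ + - conj α * p₁) +
                  (A * conj l + (B * conj β + (C * conj α + E * j))) * p₁))) (trans (cong conj up) conj-1) ⟩
        _ ≡⟨ solve 15 (λ i A B C E α β α′ β′ l l′ o f g p →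
               :combination A (B :+ :- α :* A) (C :+ :- β :* A) (:combination A B C E l′ β′ α′ i)
                 (:combination i α β l o f g p) (f :+ :- β′ :* p) (g :+ :- α′ :* p) p
               := (A :* (i :* o) :+ (B :* f :+ (C :* g :+ E :* i :* p))) :+ A :* p :* (l :+ (l′ :+ (α :* β′ :+ β :* α′))))
             refl 1# A B C E α β (conj α) (conj β) l (conj l) o₁ f₁ g₁ p₁ ⟩
        (A * (1# * o₁) + (B * f₁ + (C * g₁ + E * 1# * p₁))) + A * p₁ * (l + (conj l + (α * conj β + β * conj α)))
          ≡⟨ cong₂ _+_ (cong₂ (λ x y → A * x + (B * f₁ + (C * g₁ + y * p₁))) (*-identityˡ o₁) (*-identityʳ E)) (trans (cong (A * p₁ *_) trace) (zeroʳ _)) ⟩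
        (A * o₁ + (B * f₁ + (C * g₁ + E * p₁))) + 0#  ≡⟨ +-identityʳ _ ⟩
        A * o₁ + (B * f₁ + (C * g₁ + E * p₁))         ∎
        where
        A = h z p
        B = h z g
        C = h z f
        E = h z o
        l = h u o

  h-at : ∀ u w {c0 c1 c2 c3} → conj (x0 w) ≡ c0 → conj (x1 w) ≡ c1 → conj (x2 w) ≡ c2 → conj (x3 w) ≡ c3 →
         h u w ≡ x0 u * c3 + - (x1 u * c1) + - (x2 u * c2) + x3 u * c0
  h-at u w refl refl refl refl = refl

  -- The frame identities hold only modulo half + half = 1, norm = -1 and isotropy of `p`. They are
  -- stated as exact polynomial identities with an explicit multiple of each relation added, and
  -- these multiples are then dropped.
  drop₁ : ∀ {x k y} → y ≡ 0# → x + k * y ≡ x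
  drop₁ {x} {k} refl = trans (cong (x +_) (zeroʳ k)) (+-identityʳ x)

  drop₂ : ∀ {x k y l z} → y ≡ 0# → z ≡ 0# → x + k * y + l * z ≡ x
  drop₂ e e′ = trans (drop₁ e′) (drop₁ e)

  2half-1 : half + half + - 1# ≡ 0#
  2half-1 = x≡y⇒x-y≡0 half+half

  norm-1 : ∀ {x} → x * conj x ≡ - 1# → x * conj x + 1# ≡ 0#
  norm-1 e = trans (cong (_+ 1#) e) (-‿inverseˡ 1#)

  combination-cong : ∀ {A A′ B B′ C C′ E E′} → A ≡ A′ → B ≡ B′ → C ≡ C′ → E ≡ E′ → ∀ o f g p →
    A * o + (B * f + (C * g + E * p)) ≡ A′ * o + (B′ * f + (C′ * g + E′ * p))
  combination-cong refl refl refl refl _ _ _ _ = refl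

  conj-−half : conj (- half) ≡ - half
  conj-−half = trans (conj-neg half) (cong -_ conj-half)

  module _ (a b c : Carrier) (pp : h (v4 1# a b c) (v4 1# a b c) ≡ 0#) where
    private
      p = v4 1# a b c
      -- The last coordinates `s` and `t` make (0, 1, ε, s) and (0, 1, -ε, t) orthogonal to `p`. As
      -- ε has norm -1, both vectors are isotropic with product -2, and the factor -half in `g`
      -- makes the product 1.
      s = conj a + ε * conj b
      t = conj a + - (ε * conj b)
      o = v4 0# 0# 0# 1#
      f = v4 0# 1# ε s
      g = v4 0# (- half) (half * ε) (- half * t)
      s̄ = a + conj ε * b
      t̄ = a + - (conj ε * b)

      conj-s : conj s ≡ s̄
      conj-s = trans (conj-+ _ _) (cong₂ _+_ (conj-conj a) (trans (conj-* _ _) (cong (conj ε *_) (conj-conj b))))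
      conj-t : conj t ≡ t̄
      conj-t = trans (conj-+ _ _) (cong₂ _+_ (conj-conj a)
        (trans (conj-neg _) (cong -_ (trans (conj-* _ _) (cong (conj ε *_) (conj-conj b))))))

      h-p : ∀ u → h u p ≡ x0 u * conj c + - (x1 u * conj a) + - (x2 u * conj b) + x3 u * 1#
      h-p u = h-at u p conj-1 refl refl refl
      h-o : ∀ u → h u o ≡ x0 u * 1# + - (x1 u * 0#) + - (x2 u * 0#) + x3 u * 0#
      h-o u = h-at u o conj-0 conj-0 conj-0 conj-1
      h-f : ∀ u → h u f ≡ x0 u * s̄ + - (x1 u * 1#) + - (x2 u * conj ε) + x3 u * 0#
      h-f u = h-at u f conj-0 conj-1 refl conj-s
      h-g : ∀ u → h u g ≡ x0 u * (- half * t̄) + - (x1 u * - half) + - (x2 u * (half * conj ε)) + x3 u * 0#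
      h-g u = h-at u g conj-0 conj-−half (trans (conj-* half ε) (cong (_* conj ε) conj-half))
        (trans (conj-* (- half) t) (cong₂ _*_ conj-−half conj-t))

      pp′ : conj c + c + - (a * conj a) + - (b * conj b) ≡ 0#
      pp′ = trans (solve 6 (λ a a′ b b′ c c′ → c′ :+ c :+ :- (a :* a′) :+ :- (b :* b′) :=
          :1 :* c′ :+ :- (a :* a′) :+ :- (b :* b′) :+ c :* :1) refl a (conj a) b (conj b) c (conj c))
        (trans (sym (h-p p)) pp)

    frame-x0≡1 : Frame p
    frame-x0≡1 = record
      { o = o ; f = f ; g = g
      ; op = trans (h-p o) (solve 3 (λ a b c → :h :0 :0 :0 :1 :1 a b c := :1) refl (conj a) (conj b) (conj c))
      ; oo = trans (h-o o) (solve 0 (:h :0 :0 :0 :1 :0 :0 :0 :1 := :0) refl)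
      ; fp = trans (h-p f) (solve 4 (λ a b c e → :h :0 :1 e (a :+ e :* b) :1 a b c := :0) refl (conj a) (conj b) (conj c) ε)
      ; fo = trans (h-o f) (solve 2 (λ e s → :h :0 :1 e s :0 :0 :0 :1 := :0) refl ε s)
      ; ff = trans (h-f f) (trans (solve 4 (λ e e′ s s′ → :h :0 :1 e s :0 :1 e′ s′ := :0 :+ :- :1 :* (e :* e′ :+ :1))
          refl ε (conj ε) s s̄) (drop₁ (norm-1 ε-norm)))
      ; gp = trans (h-p g) (solve 5 (λ a b c e h → :h :0 (:- h) (h :* e) (:- h :* (a :+ :- (e :* b))) :1 a b c := :0)
          refl (conj a) (conj b) (conj c) ε half)
      ; go = trans (h-o g) (solve 3 (λ e t h → :h :0 (:- h) (h :* e) (:- h :* t) :0 :0 :0 :1 := :0) refl ε t half)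
      ; gg = trans (h-g g) (trans (solve 5 (λ e e′ t t′ h → :h :0 (:- h) (h :* e) (:- h :* t) :0 (:- h) (h :* e′) (:- h :* t′) :=
            :0 :+ :- (h :* h) :* (e :* e′ :+ :1)) refl ε (conj ε) t t̄ half) (drop₁ (norm-1 ε-norm)))
      ; fg = trans (h-g f) (trans (solve 5 (λ e e′ s t h → :h :0 :1 e s :0 (:- h) (h :* e′) (:- h :* t) :=
            :1 :+ :1 :* (h :+ h :+ :- :1) :+ :- h :* (e :* e′ :+ :1)) refl ε (conj ε) s t̄ half) (drop₂ 2half-1 (norm-1 ε-norm)))
      ; span = span
      }
      where
      expand = λ (z : V4) → combination-cong (h-p z) (h-g z) (h-f z) (h-o z)
      :image : ∀ {n} (a a′ b b′ c′ e′ h z0 z1 z2 z3 o₁ f₁ g₁ p₁ : Solver.Polynomial n) → Solver.Polynomial n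
      :image a a′ b b′ c′ e′ h z0 z1 z2 z3 = :combination (:h z0 z1 z2 z3 :1 a′ b′ c′)
        (:h z0 z1 z2 z3 :0 (:- h) (h :* e′) (:- h :* (a :+ :- (e′ :* b)))) (:h z0 z1 z2 z3 :0 :1 e′ (a :+ e′ :* b)) (:h z0 z1 z2 z3 :0 :0 :0 :1)
      span : ∀ z → z ≡ (h z p · o) ⊹ ((h z g · f) ⊹ ((h z f · g) ⊹ (h z o · p)))
      span z = v4-≡
        (sym (trans (expand z 0# 0# 0# 1#) (solve 11 (λ a a′ b b′ c′ e′ h z0 z1 z2 z3 →
            :image a a′ b b′ c′ e′ h z0 z1 z2 z3 :0 :0 :0 :1 := z0)
            refl a (conj a) b (conj b) (conj c) (conj ε) half (x0 z) (x1 z) (x2 z) (x3 z))))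
        (sym (trans (expand z 0# 1# (- half) a) (trans (solve 11 (λ a a′ b b′ c′ e′ h z0 z1 z2 z3 →
            :image a a′ b b′ c′ e′ h z0 z1 z2 z3 :0 :1 (:- h) a := z1 :+ (z1 :+ :- (a :* z0)) :* (h :+ h :+ :- :1))
            refl a (conj a) b (conj b) (conj c) (conj ε) half (x0 z) (x1 z) (x2 z) (x3 z)) (drop₁ 2half-1))))
        (sym (trans (expand z 0# ε (half * ε) b) (trans (solve 12 (λ a a′ b b′ c′ e e′ h z0 z1 z2 z3 →
            :image a a′ b b′ c′ e′ h z0 z1 z2 z3 :0 e (h :* e) b :=
            z2 :+ (z2 :+ :- (b :* z0)) :* (h :+ h :+ :- :1) :+ :- (h :+ h) :* (z2 :+ :- (b :* z0)) :* (e :* e′ :+ :1))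
            refl a (conj a) b (conj b) (conj c) ε (conj ε) half (x0 z) (x1 z) (x2 z) (x3 z)) (drop₂ 2half-1 (norm-1 ε-norm)))))
        (sym (trans (expand z 1# s (- half * t) c) (trans (solve 13 (λ a a′ b b′ c c′ e e′ h z0 z1 z2 z3 →
            :image a a′ b b′ c′ e′ h z0 z1 z2 z3 :1 (a′ :+ e :* b′) (:- h :* (a′ :+ :- (e :* b′))) c :=
            (z3 :+ z0 :* (c′ :+ c :+ :- (a :* a′) :+ :- (b :* b′))) :+
              (z1 :* a′ :+ z2 :* b′ :+ :- (z0 :* (a :* a′ :+ b :* b′))) :* (h :+ h :+ :- :1) :+
              (h :+ h) :* (z0 :* b :* b′ :+ :- (z2 :* b′)) :* (e :* e′ :+ :1))
            refl a (conj a) b (conj b) c (conj c) ε (conj ε) half (x0 z) (x1 z) (x2 z) (x3 z))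
          (trans (drop₂ 2half-1 (norm-1 ε-norm)) (drop₁ pp′)))))

  module _ (η : Carrier) (pp : h (v4 0# 1# η 0#) (v4 0# 1# η 0#) ≡ 0#) where
    private
      p = v4 0# 1# η 0#
      o = v4 0# (- half) (half * η) 0#
      f = v4 1# 0# 0# 0#
      g = v4 0# 0# 0# 1#

      h-p : ∀ u → h u p ≡ x0 u * 0# + - (x1 u * 1#) + - (x2 u * conj η) + x3 u * 0#
      h-p u = h-at u p conj-0 conj-1 refl conj-0
      h-o : ∀ u → h u o ≡ x0 u * 0# + - (x1 u * - half) + - (x2 u * (half * conj η)) + x3 u * 0#
      h-o u = h-at u o conj-0 conj-−half (trans (conj-* half η) (cong (_* conj η) conj-half)) conj-0
      h-f : ∀ u → h u f ≡ x0 u * 0# + - (x1 u * 0#) + - (x2 u * 0#) + x3 u * 1#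
      h-f u = h-at u f conj-1 conj-0 conj-0 conj-0
      h-g : ∀ u → h u g ≡ x0 u * 1# + - (x1 u * 0#) + - (x2 u * 0#) + x3 u * 0#
      h-g u = h-at u g conj-0 conj-0 conj-0 conj-1

      η-norm : η * conj η + 1# ≡ 0#
      η-norm = begin
        η * conj η + 1#   ≡⟨ solve 2 (λ e e′ → e :* e′ :+ :1 := :- (:0 :* :0 :+ :- (:1 :* :1) :+ :- (e :* e′) :+ :0 :* :0)) refl η (conj η) ⟩
        - (0# * 0# + - (1# * 1#) + - (η * conj η) + 0# * 0#)  ≡⟨ cong -_ (trans (sym (h-p p)) pp) ⟩
        - 0#              ≡⟨ solve 0 (:- :0 := :0) refl ⟩
        0#                ∎

    -- Isotropy of `p` says that η has norm -1. Then (0, 1, -η, 0) is isotropic too, and scaled by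
    -- -half it pairs with `p`; the first and last unit vectors form the orthogonal hyperbolic pair.
    frame-x1≡1 : Frame p
    frame-x1≡1 = record
      { o = o ; f = f ; g = g
      ; op = trans (h-p o) (trans (solve 3 (λ e e′ h → :h :0 (:- h) (h :* e) :0 :0 :1 e′ :0 :=
            :1 :+ :1 :* (h :+ h :+ :- :1) :+ :- h :* (e :* e′ :+ :1)) refl η (conj η) half) (drop₂ 2half-1 η-norm))
      ; oo = trans (h-o o) (trans (solve 3 (λ e e′ h → :h :0 (:- h) (h :* e) :0 :0 (:- h) (h :* e′) :0 :=
            :0 :+ :- (h :* h) :* (e :* e′ :+ :1)) refl η (conj η) half) (drop₁ η-norm))
      ; fp = trans (h-p f) (solve 1 (λ e → :h :1 :0 :0 :0 :0 :1 e :0 := :0) refl (conj η))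
      ; fo = trans (h-o f) (solve 2 (λ e h → :h :1 :0 :0 :0 :0 (:- h) (h :* e) :0 := :0) refl (conj η) half)
      ; ff = trans (h-f f) (solve 0 (:h :1 :0 :0 :0 :1 :0 :0 :0 := :0) refl)
      ; gp = trans (h-p g) (solve 1 (λ e → :h :0 :0 :0 :1 :0 :1 e :0 := :0) refl (conj η))
      ; go = trans (h-o g) (solve 2 (λ e h → :h :0 :0 :0 :1 :0 (:- h) (h :* e) :0 := :0) refl (conj η) half)
      ; gg = trans (h-g g) (solve 0 (:h :0 :0 :0 :1 :0 :0 :0 :1 := :0) refl)
      ; fg = trans (h-g f) (solve 0 (:h :1 :0 :0 :0 :0 :0 :0 :1 := :1) refl)
      ; span = λ z → v4-≡
          (sym (trans (expand z 0# 1# 0# 0#) (solve 7 (λ e e′ h z0 z1 z2 z3 → :image e′ h z0 z1 z2 z3 :0 :1 :0 :0 := z0)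
            refl η (conj η) half (x0 z) (x1 z) (x2 z) (x3 z))))
          (sym (trans (expand z (- half) 0# 0# 1#) (trans (solve 7 (λ e e′ h z0 z1 z2 z3 → :image e′ h z0 z1 z2 z3 (:- h) :0 :0 :1 :=
              z1 :+ z1 :* (h :+ h :+ :- :1))
            refl η (conj η) half (x0 z) (x1 z) (x2 z) (x3 z)) (drop₁ 2half-1))))
          (sym (trans (expand z (half * η) 0# 0# η) (trans (solve 7 (λ e e′ h z0 z1 z2 z3 → :image e′ h z0 z1 z2 z3 (h :* e) :0 :0 e :=
              z2 :+ z2 :* (h :+ h :+ :- :1) :+ :- ((h :+ h) :* z2) :* (e :* e′ :+ :1))
            refl η (conj η) half (x0 z) (x1 z) (x2 z) (x3 z)) (drop₂ 2half-1 η-norm))))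
          (sym (trans (expand z 0# 0# 1# 0#) (solve 7 (λ e e′ h z0 z1 z2 z3 → :image e′ h z0 z1 z2 z3 :0 :0 :1 :0 := z3)
            refl η (conj η) half (x0 z) (x1 z) (x2 z) (x3 z))))
      }
      where
      expand = λ (z : V4) → combination-cong (h-p z) (h-g z) (h-f z) (h-o z)
      :image : ∀ {n} (e′ h z0 z1 z2 z3 o₁ f₁ g₁ p₁ : Solver.Polynomial n) → Solver.Polynomial n
      :image e′ h z0 z1 z2 z3 = :combination (:h z0 z1 z2 z3 :0 :1 e′ :0) (:h z0 z1 z2 z3 :0 :0 :0 :1)
        (:h z0 z1 z2 z3 :1 :0 :0 :0) (:h z0 z1 z2 z3 :0 (:- h) (h :* e′) :0)

  h-kk : ∀ k p → h p p ≡ 0# → h (k · p) (k · p) ≡ 0#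
  h-kk k p pp = trans (h-·ˡ k p (k · p)) (trans (cong (k *_) (trans (h-·ʳ k p p) (trans (cong (conj k *_) pp) (zeroʳ _)))) (zeroʳ k))

  -- The form is conjugate linear on the right, so removing the factor k from `p` puts conj k on its
  -- partner and leaves f and g alone.
  unscale : ∀ k p → k ≢ 0# → Frame (k · p) → Frame p
  unscale k p k≢0 fr = record
    { o = conj k · o ; f = f ; g = g
    ; op = trans (h-·ˡ (conj k) o p) (trans (sym (h-·ʳ k o p)) op)
    ; oo = trans (h-·ˡ (conj k) o (conj k · o)) (trans (cong (conj k *_) (trans (h-·ʳ (conj k) o o) (trans (cong (conj (conj k) *_) oo) (zeroʳ _)))) (zeroʳ _))
    ; fp = *-cancel-0 (conj-≢0 k≢0) (trans (sym (h-·ʳ k f p)) fp)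
    ; fo = trans (h-·ʳ (conj k) f o) (trans (cong (conj (conj k) *_) fo) (zeroʳ _))
    ; ff = ff
    ; gp = *-cancel-0 (conj-≢0 k≢0) (trans (sym (h-·ʳ k g p)) gp)
    ; go = trans (h-·ʳ (conj k) g o) (trans (cong (conj (conj k) *_) go) (zeroʳ _))
    ; gg = gg ; fg = fg
    ; span = λ z → trans (span z) (v4-≡ (component z (x0 o) (x0 f) (x0 g) (x0 p)) (component z (x1 o) (x1 f) (x1 g) (x1 p))
                     (component z (x2 o) (x2 f) (x2 g) (x2 p)) (component z (x3 o) (x3 f) (x3 g) (x3 p)))
    }
    where
    open Frame fr
    component : ∀ z o₁ f₁ g₁ p₁ →
      h z (k · p) * o₁ + (h z g * f₁ + (h z f * g₁ + h z o * (k * p₁))) ≡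
      h z p * (conj k * o₁) + (h z g * f₁ + (h z f * g₁ + h z (conj k · o) * p₁))
    component z o₁ f₁ g₁ p₁ = begin
      h z (k · p) * o₁ + (h z g * f₁ + (h z f * g₁ + h z o * (k * p₁)))
        ≡⟨ cong (λ A → A * o₁ + (h z g * f₁ + (h z f * g₁ + h z o * (k * p₁)))) (h-·ʳ k z p) ⟩
      conj k * h z p * o₁ + (h z g * f₁ + (h z f * g₁ + h z o * (k * p₁)))
        ≡⟨ solve 8 (λ k k′ A E bf o p cg → k′ :* A :* o :+ (bf :+ (cg :+ E :* (k :* p))) := A :* (k′ :* o) :+ (bf :+ (cg :+ k :* E :* p)))
             refl k (conj k) (h z p) (h z o) (h z g * f₁) o₁ p₁ (h z f * g₁) ⟩
      h z p * (conj k * o₁) + (h z g * f₁ + (h z f * g₁ + k * h z o * p₁))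
        ≡⟨ cong (λ E → h z p * (conj k * o₁) + (h z g * f₁ + (h z f * g₁ + E * p₁)))
             (sym (trans (h-·ʳ (conj k) z o) (cong (_* h z o) (conj-conj k)))) ⟩
      h z p * (conj k * o₁) + (h z g * f₁ + (h z f * g₁ + h z (conj k · o) * p₁))  ∎

  swap₀₃ : V4 → V4
  swap₀₃ (v4 a b c d) = v4 d b c a

  h-swap₀₃ : ∀ u v → h (swap₀₃ u) (swap₀₃ v) ≡ h u v
  h-swap₀₃ u v = solve 8 (λ u0 u1 u2 u3 v0 v1 v2 v3 → :h u3 u1 u2 u0 v3 v1 v2 v0 := :h u0 u1 u2 u3 v0 v1 v2 v3) refl
    (x0 u) (x1 u) (x2 u) (x3 u) (conj (x0 v)) (conj (x1 v)) (conj (x2 v)) (conj (x3 v))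

  swap₀₃-frame : ∀ p → Frame (swap₀₃ p) → Frame p
  swap₀₃-frame p fr = record
    { o = swap₀₃ o ; f = swap₀₃ f ; g = swap₀₃ g
    ; op = trans (h-swap₀₃ o (swap₀₃ p)) op ; oo = trans (h-swap₀₃ o o) oo
    ; fp = trans (h-swap₀₃ f (swap₀₃ p)) fp ; fo = trans (h-swap₀₃ f o) fo ; ff = trans (h-swap₀₃ f f) ff
    ; gp = trans (h-swap₀₃ g (swap₀₃ p)) gp ; go = trans (h-swap₀₃ g o) go ; gg = trans (h-swap₀₃ g g) gg ; fg = trans (h-swap₀₃ f g) fg
    ; span = λ z → trans (cong swap₀₃ (span (swap₀₃ z))) (trans
        (cong₂ (λ A B → (A · swap₀₃ o) ⊹ ((B · swap₀₃ f) ⊹ ((h (swap₀₃ z) f · swap₀₃ g) ⊹ (h (swap₀₃ z) o · p)))) (h-swap₀₃ z p) (sym (h-swap₀₃ (swap₀₃ z) g)))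
        (cong₂ (λ C E → (h z p · swap₀₃ o) ⊹ ((h z (swap₀₃ g) · swap₀₃ f) ⊹ ((C · swap₀₃ g) ⊹ (E · p)))) (sym (h-swap₀₃ (swap₀₃ z) f)) (sym (h-swap₀₃ (swap₀₃ z) o))))
    }
    where open Frame fr

  frame-x0 : ∀ p → h p p ≡ 0# → x0 p ≢ 0# → Frame p
  frame-x0 p@(v4 p0 p1 p2 p3) pp p0≢0 = unscale w p w≢0
    (subst (λ x → Frame (v4 x (w * p1) (w * p2) (w * p3))) (sym wp0≡1)
      (frame-x0≡1 (w * p1) (w * p2) (w * p3)
        (subst (λ x → h (v4 x (w * p1) (w * p2) (w * p3)) (v4 x (w * p1) (w * p2) (w * p3)) ≡ 0#) wp0≡1 (h-kk w p pp))))
    where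
    w = proj₁ (leftInverse p0 p0≢0)
    w≢0 = proj₁ (proj₂ (leftInverse p0 p0≢0))
    wp0≡1 = proj₂ (proj₂ (leftInverse p0 p0≢0))

  -- Either the first coordinate is nonzero, or the last one, which the isometry `swap₀₃` brings to
  -- the front. If both are 0, isotropy forces the second to be nonzero, since otherwise the norm of
  -- the third would vanish.
  frame-exists : ∀ p → p ≢ zeroV → h p p ≡ 0# → Frame p
  frame-exists p@(v4 p0 p1 p2 p3) p≢0 pp = byCases (p0 ≟ 0#) (p3 ≟ 0#) (p1 ≟ 0#)
    where
    byCases : Dec (p0 ≡ 0#) → Dec (p3 ≡ 0#) → Dec (p1 ≡ 0#) → Frame p
    byCases (no p0≢0) _ _ = frame-x0 p pp p0≢0
    byCases _ (no p3≢0) _ = swap₀₃-frame p (frame-x0 (swap₀₃ p) (trans (h-swap₀₃ p p) pp) p3≢0)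
    byCases (yes p0≡0) (yes p3≡0) (yes p1≡0) = ⊥-elim (p≢0 (v4-≡ p0≡0 p1≡0 p2≡0 p3≡0))
      where
      square : p2 * conj p2 ≡ 0#
      square = begin
        p2 * conj p2    ≡⟨ solve 3 (λ x y z → x :* y := :- (:0 :* z :+ :- (:0 :* :0) :+ :- (x :* y) :+ :0 :* z)) refl p2 (conj p2) (conj p0) ⟩
        - (0# * conj p0 + - (0# * 0#) + - (p2 * conj p2) + 0# * conj p0)
          ≡⟨ cong -_ (trans (cong₂ _+_ (cong (_+ - (p2 * conj p2)) (cong₂ _+_ (trans (zeroˡ _) (sym (trans (cong (_* conj p3) p0≡0) (zeroˡ _))))
               (cong -_ (trans (zeroˡ _) (sym (trans (cong (_* conj p1) p1≡0) (zeroˡ _))))))) (cong (_* conj p0) (sym p3≡0))) pp) ⟩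
        - 0#            ≡⟨ solve 0 (:- :0 := :0) refl ⟩
        0#              ∎
      p2≡0 : p2 ≡ 0#
      p2≡0 with p2 ≟ 0#
      ... | yes e = e
      ... | no p2≢0 = ⊥-elim (*-≢0# p2≢0 (conj-≢0 p2≢0) square)
    byCases (yes p0≡0) (yes p3≡0) (no p1≢0) = unscale w p w≢0 (subst Frame (sym normal) (frame-x1≡1 (w * p2)
        (subst (λ v → h v v ≡ 0#) normal (h-kk w p pp))))
      where
      w = proj₁ (leftInverse p1 p1≢0)
      w≢0 = proj₁ (proj₂ (leftInverse p1 p1≢0))
      wp1≡1 = proj₂ (proj₂ (leftInverse p1 p1≢0))
      normal : w · p ≡ v4 0# 1# (w * p2) 0#
      normal = v4-≡ (trans (cong (w *_) p0≡0) (zeroʳ w)) wp1≡1 refl (trans (cong (w *_) p3≡0) (zeroʳ w))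

  -- Enumeration of points and their rescaled representatives.

  allV-complete : ∀ v → v ∈ allV
  allV-complete (v4 a b c d) = ∈-concatMap⁺ _ (lose (elements-complete a) (∈-concatMap⁺ _ (lose (elements-complete b)
    (∈-concatMap⁺ _ (lose (elements-complete c) (∈-map⁺ _ (elements-complete d)))))))

  allV-unique : Unique allV
  allV-unique = concatMap-unique fa elements-unique
    (λ a → concatMap-unique (fb a) elements-unique
      (λ b → concatMap-unique (fc a b) elements-unique
        (λ c → Uniqueₚ.map⁺ (cong x3) elements-unique)
        (λ m m′ → trans (sym (in-c m)) (in-c m′)))
      (λ m m′ → trans (sym (in-b m)) (in-b m′)))
    (λ m m′ → trans (sym (in-a m)) (in-a m′))
    where
    fc : Carrier → Carrier → Carrier → List V4
    fc a b c = List.map (λ d → v4 a b c d) elements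
    fb : Carrier → Carrier → List V4
    fb a b = concatMap (fc a b) elements
    fa : Carrier → List V4
    fa a = concatMap (fb a) elements
    in-c : ∀ {a b c v} → v ∈ fc a b c → x2 v ≡ c
    in-c m with _ , _ , refl ← ∈-map⁻ _ m = refl
    c-b : ∀ {a b c v} → v ∈ fc a b c → x1 v ≡ b
    c-b m with _ , _ , refl ← ∈-map⁻ _ m = refl
    c-a : ∀ {a b c v} → v ∈ fc a b c → x0 v ≡ a
    c-a m with _ , _ , refl ← ∈-map⁻ _ m = refl
    in-b : ∀ {a b v} → v ∈ fb a b → x1 v ≡ b
    in-b {a} {b} m = c-b (proj₂ (proj₂ (find (∈-concatMap⁻ (fc a b) {xs = elements} m))))
    b-a : ∀ {a b v} → v ∈ fb a b → x0 v ≡ a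
    b-a {a} {b} m = c-a (proj₂ (proj₂ (find (∈-concatMap⁻ (fc a b) {xs = elements} m))))
    in-a : ∀ {a v} → v ∈ fa a → x0 v ≡ a
    in-a {a} m = b-a (proj₂ (proj₂ (find (∈-concatMap⁻ (fb a) {xs = elements} m))))

  data Normal : V4 → Set where
    first  : ∀ {b c d} → Normal (v4 1# b c d)
    second : ∀ {c d} → Normal (v4 0# 1# c d)
    third  : ∀ {d} → Normal (v4 0# 0# 1# d)
    fourth : Normal (v4 0# 0# 0# 1#)

  1≟0 : does (1# ≟ 0#) ≡ false
  1≟0 = dec-false (1# ≟ 0#) (0≢1 ∘ sym)

  0≟0 : does (0# ≟ 0#) ≡ true
  0≟0 = dec-true (0# ≟ 0#) refl

  1≟1 : does (1# ≟ 1#) ≡ true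
  1≟1 = dec-true (1# ≟ 1#) refl

  normal⇒normalized : ∀ {v} → Normal v → normalized v ≡ true
  normal⇒normalized first rewrite 1≟0 = 1≟1
  normal⇒normalized second rewrite 0≟0 | 1≟0 = 1≟1
  normal⇒normalized third rewrite 0≟0 | 1≟0 = 1≟1
  normal⇒normalized fourth rewrite 0≟0 | 1≟0 = 1≟1

  normalized⇒normal : ∀ v → normalized v ≡ true → Normal v
  normalized⇒normal (v4 a b c d) e with a ≟ 0#
  ... | no _ with refl ← does-true⁻ (a ≟ 1#) e = first
  ... | yes refl with b ≟ 0#
  ... | no _ with refl ← does-true⁻ (b ≟ 1#) e = second
  ... | yes refl with c ≟ 0#
  ... | no _ with refl ← does-true⁻ (c ≟ 1#) e = third
  ... | yes refl with d ≟ 0#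
  ... | no _ with refl ← does-true⁻ (d ≟ 1#) e = fourth

  normalize : ∀ v → v ≢ zeroV → Σ Carrier λ k → k ≢ 0# × Normal (k · v)
  normalize (v4 a b c d) v≢0 with a ≟ 0#
  ... | no a≢0 = let (w , w≢0 , wa≡1) = leftInverse a a≢0 in
    w , w≢0 , subst (λ z → Normal (v4 z (w * b) (w * c) (w * d))) (sym wa≡1) first
  ... | yes refl with b ≟ 0#
  ... | no b≢0 = let (w , w≢0 , wb≡1) = leftInverse b b≢0 in
    w , w≢0 , subst₂ (λ z0 z → Normal (v4 z0 z (w * c) (w * d))) (sym (zeroʳ w)) (sym wb≡1) second
  ... | yes refl with c ≟ 0#
  ... | no c≢0 = let (w , w≢0 , wc≡1) = leftInverse c c≢0 in
    w , w≢0 , subst₂ (λ z0 z → Normal (v4 z0 z0 z (w * d))) (sym (zeroʳ w)) (sym wc≡1) third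
  ... | yes refl with d ≟ 0#
  ... | no d≢0 = let (w , w≢0 , wd≡1) = leftInverse d d≢0 in
    w , w≢0 , subst₂ (λ z0 z → Normal (v4 z0 z0 z0 z)) (sym (zeroʳ w)) (sym wd≡1) fourth
  ... | yes refl = ⊥-elim (v≢0 refl)

  -- Proportional vectors have the same leading position, and there both entries are 1.
  normal-scale : ∀ {u v} k → k ≢ 0# → Normal u → Normal v → v ≡ k · u → k ≡ 1#
  normal-scale k k≢0 = cases
    where
    same : 1# ≡ k * 1# → k ≡ 1#
    same e = sym (trans e (*-identityʳ k))
    earlier : ∀ {A : Set} → 0# ≡ k * 1# → A
    earlier e = ⊥-elim (k≢0 (sym (trans e (*-identityʳ k))))
    later : ∀ {A : Set} → 1# ≡ k * 0# → A
    later e = ⊥-elim (0≢1 (sym (trans e (zeroʳ k))))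
    cases : ∀ {u v} → Normal u → Normal v → v ≡ k · u → k ≡ 1#
    cases first first e = same (cong x0 e)
    cases first second e = earlier (cong x0 e)
    cases first third e = earlier (cong x0 e)
    cases first fourth e = earlier (cong x0 e)
    cases second first e = later (cong x0 e)
    cases second second e = same (cong x1 e)
    cases second third e = earlier (cong x1 e)
    cases second fourth e = earlier (cong x1 e)
    cases third first e = later (cong x0 e)
    cases third second e = later (cong x1 e)
    cases third third e = same (cong x2 e)
    cases third fourth e = earlier (cong x2 e)
    cases fourth first e = later (cong x0 e)
    cases fourth second e = later (cong x1 e)
    cases fourth third e = later (cong x2 e)
    cases fourth fourth e = same (cong x3 e)

  ·-assoc : ∀ a b v → a · (b · v) ≡ (a * b) · v
  ·-assoc a b v = v4-≡ (sym (*-assoc a b _)) (sym (*-assoc a b _)) (sym (*-assoc a b _)) (sym (*-assoc a b _))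

  1· : ∀ v → 1# · v ≡ v
  1· v = v4-≡ (*-identityˡ _) (*-identityˡ _) (*-identityˡ _) (*-identityˡ _)

  module Hats (p : V4) where

    X : Set
    X = Fin (N p)

    private
      membership : ∀ x → pt p x ∈ hermPoints × not (h p (pt p x) == 0#) ≡ true
      membership x = filterB-∈⁻ (λ v → not (h p v == 0#)) hermPoints (∈-lookup x)
      hermitian : ∀ x → normalized (pt p x) ≡ true × (h (pt p x) (pt p x) == 0#) ≡ true
      hermitian x = ∧-true⁻ (proj₂ (filterB-∈⁻ (λ v → normalized v ∧ (h v v == 0#)) allV (proj₁ (membership x))))

    pt-normal : ∀ x → Normal (pt p x)
    pt-normal x = normalized⇒normal (pt p x) (proj₁ (hermitian x))

    pt-isotropic : ∀ x → h (pt p x) (pt p x) ≡ 0#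
    pt-isotropic x = does-true⁻ (h (pt p x) (pt p x) ≟ 0#) (proj₂ (hermitian x))

    p-pt≢0 : ∀ x → h p (pt p x) ≢ 0#
    p-pt≢0 x = does-false⁻ (h p (pt p x) ≟ 0#) (not-true⁻ (proj₂ (membership x)))

    pt-injective : ∀ {x y} → pt p x ≡ pt p y → x ≡ y
    pt-injective {x} {y} = lookup-unique (filterB-unique _ (filterB-unique _ allV-unique)) x y

    pt-complete : ∀ v → Normal v → h v v ≡ 0# → h p v ≢ 0# → Σ X λ x → pt p x ≡ v
    pt-complete v nv vv pv≢0 = index v∈ , sym (lookup-index v∈)
      where
      v∈ : v ∈ 𝒳 p
      v∈ = filterB-∈⁺ _ (filterB-∈⁺ _ (allV-complete v)
        (∧-true⁺ (normal⇒normalized nv) (dec-true (h v v ≟ 0#) vv))) (cong not (dec-false (h p v ≟ 0#) pv≢0))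

    scale : X → Carrier
    scale x = h (pt p x) p

    scale≢0 : ∀ x → scale x ≢ 0#
    scale≢0 x e = p-pt≢0 x (h-sym-0 e)

    scale⁻¹ : X → Carrier
    scale⁻¹ x = proj₁ (inverse (scale x) (scale≢0 x))

    scale*scale⁻¹ : ∀ x → scale x * scale⁻¹ x ≡ 1#
    scale*scale⁻¹ x = proj₂ (inverse (scale x) (scale≢0 x))

    scale⁻¹≢0 : ∀ x → scale⁻¹ x ≢ 0#
    scale⁻¹≢0 x w≡0 = 0≢1 (trans (sym (zeroʳ (scale x))) (trans (cong (scale x *_) (sym w≡0)) (scale*scale⁻¹ x)))

    -- The representative of the point normalised by h (hat x) p = 1.
    hat : X → V4
    hat x = scale⁻¹ x · pt p x

    pt-hat : ∀ x → pt p x ≡ scale x · hat x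
    pt-hat x = sym (trans (·-assoc _ _ _) (trans (cong (_· pt p x) (scale*scale⁻¹ x)) (1· (pt p x))))

    hat-p : ∀ x → h (hat x) p ≡ 1#
    hat-p x = trans (h-·ˡ _ _ p) (trans (*-comm _ _) (scale*scale⁻¹ x))

    hat-isotropic : ∀ x → h (hat x) (hat x) ≡ 0#
    hat-isotropic x = trans (h-·ˡ _ _ _) (trans (cong (scale⁻¹ x *_) (trans (h-·ʳ _ _ _)
      (trans (cong (conj (scale⁻¹ x) *_) (pt-isotropic x)) (zeroʳ _)))) (zeroʳ _))

    hat-injective : ∀ {x y} → hat x ≡ hat y → x ≡ y
    hat-injective {x} {y} e = pt-injective (sym (begin
      pt p y       ≡⟨ pt-y ⟩
      k · pt p x   ≡⟨ cong (_· pt p x) (normal-scale k k≢0 (pt-normal x) (pt-normal y) pt-y) ⟩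
      1# · pt p x  ≡⟨ 1· _ ⟩
      pt p x       ∎))
      where
      k = scale y * scale⁻¹ x
      pt-y : pt p y ≡ k · pt p x
      pt-y = trans (pt-hat y) (trans (cong (scale y ·_) (sym e)) (·-assoc _ _ _))
      k≢0 : k ≢ 0#
      k≢0 = *-≢0# (scale≢0 y) (scale⁻¹≢0 x)

    -- The point of `v` is listed under its normal form k · v. Since h(k · v, p) = k, the rescaling
    -- divides by exactly this k and returns `v`. So the hats are precisely the isotropic vectors
    -- with h(v,p) = 1.
    hat-complete : ∀ v → h v p ≡ 1# → h v v ≡ 0# → Σ X λ x → hat x ≡ v
    hat-complete v vp vv = x , (begin
      scale⁻¹ x · pt p x         ≡⟨ cong (scale⁻¹ x ·_) pt-x ⟩
      scale⁻¹ x · (k · v)        ≡⟨ ·-assoc _ _ _ ⟩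
      (scale⁻¹ x * k) · v        ≡⟨ cong (λ z → (scale⁻¹ x * z) · v) scale≡k ⟨
      (scale⁻¹ x * scale x) · v  ≡⟨ cong (_· v) (trans (*-comm _ _) (scale*scale⁻¹ x)) ⟩
      1# · v                     ≡⟨ 1· v ⟩
      v                          ∎)
      where
      v≢0 : v ≢ zeroV
      v≢0 refl = 0≢1 (trans (sym (trans (h-·ˡ 0# zeroV p) (zeroˡ _))) (trans (cong (λ z → h z p) (v4-≡ (zeroˡ _) (zeroˡ _) (zeroˡ _) (zeroˡ _))) vp))
      k = proj₁ (normalize v v≢0)
      k≢0 = proj₁ (proj₂ (normalize v v≢0))
      kv-p : h (k · v) p ≡ k
      kv-p = trans (h-·ˡ k v p) (trans (cong (k *_) vp) (*-identityʳ k))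
      complete = pt-complete (k · v) (proj₂ (proj₂ (normalize v v≢0)))
        (trans (h-·ˡ k v _) (trans (cong (k *_) (trans (h-·ʳ k v v) (trans (cong (conj k *_) vv) (zeroʳ _)))) (zeroʳ k)))
        (λ e → k≢0 (trans (sym kv-p) (h-sym-0 e)))
      x = proj₁ complete
      pt-x = proj₂ complete
      scale≡k : scale x ≡ k
      scale≡k = trans (cong (λ z → h z p) pt-x) kv-p

  -- The tests for z(P,Q,R) and for a common line, expressed by H.

  module Cosets (n H w : Carrier) (n-fixed : Fixed n) (n≢0 : n ≢ 0#) (w-nH : w ≡ n * H) where
    conj-w : conj w ≡ n * conj H
    conj-w = trans (cong conj w-nH) (trans (conj-* n H) (cong (_* conj H) n-fixed))

    Fixed-w⇒ : Fixed w → Fixed H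
    Fixed-w⇒ f = *-cancelˡ n≢0 (trans (sym conj-w) (trans f w-nH))

    Fixed-w⇐ : Fixed H → Fixed w
    Fixed-w⇐ f = trans conj-w (trans (cong (n *_) f) (sym w-nH))

    -‿*ʳ : ∀ a b → - (a * b) ≡ a * - b
    -‿*ʳ a b = solve 2 (λ a b → :- (a :* b) := a :* :- b) refl a b

    Skew-w⇒ : Skew w → Skew H
    Skew-w⇒ s = *-cancelˡ n≢0 (trans (sym conj-w) (trans s (trans (cong -_ w-nH) (-‿*ʳ n H))))

    Skew-w⇐ : Skew H → Skew w
    Skew-w⇐ s = trans conj-w (trans (cong (n *_) s) (trans (sym (-‿*ʳ n H)) (cong -_ (sym w-nH))))

    w≡0⇒ : w ≡ 0# → H ≡ 0#
    w≡0⇒ e = *-cancel-0 n≢0 (trans (sym w-nH) e)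

    -- Because 2 is invertible, 0 is the only element both fixed and skew, so the two tests on `H`
    -- also decide orthogonality.
    orthogonal≡ : (w == 0#) ≡ does (fixed? H) ∧ does (skew? H)
    orthogonal≡ = does-⇔ (mk⇔ (λ e → subst Fixed (sym (w≡0⇒ e)) conj-0 , subst Skew (sym (w≡0⇒ e)) skew-0)
        (λ (f , s) → trans w-nH (trans (cong (n *_) (fixed∧skew⇒0 f s)) (zeroʳ n))))
      (w ≟ 0#) (fixed? H ×-dec skew? H)

    isE≡ : isE w ≡ not (does (fixed? H) ∧ does (skew? H)) ∧ does (fixed? H)
    isE≡ = cong₂ (λ a b → not a ∧ b) orthogonal≡ (does-⇔ (mk⇔ Fixed-w⇒ Fixed-w⇐) (fixed? w) (fixed? H))

    -- A nonzero skew element is 1 times itself; conversely θ c is skew for θ skew and c fixed.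
    isT≡ : isT w ≡ not (does (fixed? H) ∧ does (skew? H)) ∧ does (skew? H)
    isT≡ = trans (≡-does (¬? (w ≟ 0#) ×-dec skew? w) to from)
      (cong₂ (λ a b → not a ∧ b) orthogonal≡ (does-⇔ (mk⇔ Skew-w⇒ Skew-w⇐) (skew? w) (skew? H)))
      where
      test : Carrier → Carrier → Bool
      test θ c = not (θ == 0#) ∧ (conj θ == - θ) ∧ inGFq* c ∧ (w == θ * c)
      test⁻ : ∀ θ c → test θ c ≡ true → w ≢ 0# × Skew w
      test⁻ θ c e = (λ w≡0 → *-≢0# t≢0 c≢0 (trans (sym w≡) w≡0)) , (begin
          conj w           ≡⟨ trans (cong conj w≡) (conj-* θ c) ⟩
          conj θ * conj c  ≡⟨ cong₂ _*_ t-skew c-fixed ⟩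
          - θ * c          ≡⟨ solve 2 (λ t c → :- t :* c := :- (t :* c)) refl θ c ⟩
          - (θ * c)        ≡⟨ cong -_ w≡ ⟨
          - w              ∎)
        where
        e₁ = ∧-true⁻ e
        e₂ = ∧-true⁻ (proj₂ e₁)
        e₃ = ∧-true⁻ (proj₂ e₂)
        e₄ = ∧-true⁻ (proj₁ e₃)
        t≢0 = does-false⁻ (θ ≟ 0#) (not-true⁻ (proj₁ e₁))
        t-skew = does-true⁻ (skew? θ) (proj₁ e₂)
        c≢0 = does-false⁻ (c ≟ 0#) (not-true⁻ (proj₁ e₄))
        c-fixed = does-true⁻ (fixed? c) (proj₂ e₄)
        w≡ = does-true⁻ (w ≟ (θ * c)) (proj₂ e₃)
      to : isT w ≡ true → w ≢ 0# × Skew w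
      to e = let (θ , e′) = any-true⁻ (λ θ → any (test θ) elements) elements e
                 (c , e″) = any-true⁻ (test θ) elements e′
             in test⁻ θ c e″
      from : w ≢ 0# × Skew w → isT w ≡ true
      from (w≢0 , s) = any-true⁺ (λ θ → any (test θ) elements) (elements-complete w)
        (any-true⁺ (test w) (elements-complete 1#)
          (∧-true⁺ (cong not (dec-false (w ≟ 0#) w≢0)) (∧-true⁺ (dec-true (skew? w) s)
            (∧-true⁺ (∧-true⁺ (cong not (dec-false (1# ≟ 0#) (0≢1 ∘ sym))) (dec-true (fixed? 1#) conj-1))
              (dec-true (w ≟ (w * 1#)) (sym (*-identityʳ w)))))))

  module CommonLine (p Q R X Y : V4) (s t : Carrier) (Q≡ : Q ≡ s · X) (R≡ : R ≡ t · Y)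
    (σ τ : Carrier) (X≡ : X ≡ σ · Q) (Y≡ : Y ≡ τ · R)
    (Qp : h Q p ≡ s) (Rp : h R p ≡ t) (s≢0 : s ≢ 0#) (t≢0 : t ≢ 0#) (τ≢0 : τ ≢ 0#) (p≢0 : p ≢ zeroV) (pp : h p p ≡ 0#) where
    private
      vector : Carrier → Carrier → Carrier → V4
      vector a b c = ((a · p) ⊹ (b · Q)) ⊹ (c · R)
      nonzero test : Carrier → Carrier → Carrier → Bool
      nonzero a b c = not ((a == 0#) ∧ (b == 0#) ∧ (c == 0#))
      test a b c = nonzero a b c ∧ isZeroV (vector a b c)
      testB : Carrier → Carrier → Bool
      testB a b = any (test a b) elements
      testA : Carrier → Bool
      testA a = any (testB a) elements
      isZeroV⁻ : ∀ v → isZeroV v ≡ true → v ≡ zeroV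
      isZeroV⁻ v e = v4-≡ (does-true⁻ (x0 v ≟ 0#) (proj₁ e₁)) (does-true⁻ (x1 v ≟ 0#) (proj₁ e₂))
          (does-true⁻ (x2 v ≟ 0#) (proj₁ e₃)) (does-true⁻ (x3 v ≟ 0#) (proj₂ e₃))
        where
        e₁ = ∧-true⁻ e
        e₂ = ∧-true⁻ (proj₂ e₁)
        e₃ = ∧-true⁻ (proj₂ e₂)
      isZeroV⁺ : ∀ v → v ≡ zeroV → isZeroV v ≡ true
      isZeroV⁺ v refl = ∧-true⁺ z (∧-true⁺ z (∧-true⁺ z z))
        where z = dec-true (0# ≟ 0#) refl
      h-vector : ∀ a b c → h (vector a b c) p ≡ b * s + c * t
      h-vector a b c = trans (h-⊹ˡ _ _ p) (cong₂ _+_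
        (trans (h-⊹ˡ _ _ p) (trans (cong₂ _+_ (trans (h-·ˡ a p p) (trans (cong (a *_) pp) (zeroʳ a))) (trans (h-·ˡ b Q p) (cong (b *_) Qp))) (+-identityˡ _)))
        (trans (h-·ˡ c R p) (cong (c *_) Rp)))
      h-zeroV : ∀ v → h zeroV v ≡ 0#
      h-zeroV v = trans (cong (λ z → h z v) (v4-≡ (sym (zeroˡ _)) (sym (zeroˡ _)) (sym (zeroˡ _)) (sym (zeroˡ _))))
        (trans (h-·ˡ 0# p v) (zeroˡ _))

    -- Pairing a p + b Q + c R = 0 with `p` gives b s + c t = 0. If c were 0, then b = 0 and a p =
    -- 0, impossible for nonzero `p` and a nontrivial relation. So the relation can be divided by c
    -- t, which gives E = -a / (c t).
    common⇒ : onCommonLine p Q R ≡ true → Σ Carrier (λ E → Y ≡ X ⊹ (E · p))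
    common⇒ e = fromA (any-true⁻ testA elements e)
        where
        dependent : ∀ a b c → nonzero a b c ≡ true → vector a b c ≡ zeroV → Σ Carrier (λ E → Y ≡ X ⊹ (E · p))
        dependent a b c nz v≡0 = byCase (c ≟ 0#)
          where
          bs+ct : b * s + c * t ≡ 0#
          bs+ct = trans (sym (h-vector a b c)) (trans (cong (λ v → h v p) v≡0) (h-zeroV p))
          c′ = c * t
          byCase : Dec (c ≡ 0#) → Σ Carrier (λ E → Y ≡ X ⊹ (E · p))
          byCase (yes c≡0) = ⊥-elim (p≢0 (v4-≡ (p-component _ _ _ (cong x0 v≡0)) (p-component _ _ _ (cong x1 v≡0))
            (p-component _ _ _ (cong x2 v≡0)) (p-component _ _ _ (cong x3 v≡0))))
            where
            b≡0 : b ≡ 0#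
            b≡0 = *-cancel-0 s≢0 (trans (*-comm s b) (trans (sym (trans (cong (b * s +_)
              (trans (cong (_* t) c≡0) (zeroˡ _))) (+-identityʳ _))) bs+ct))
            a≢0 : a ≢ 0#
            a≢0 a≡0 = contradiction (trans (sym nz) (cong not (∧-true⁺ (dec-true (a ≟ 0#) a≡0)
                (∧-true⁺ (dec-true (b ≟ 0#) b≡0) (dec-true (c ≟ 0#) c≡0)))))
              where
              contradiction : true ≢ false
              contradiction ()
            p-component : ∀ p₁ Q R → a * p₁ + b * Q + c * R ≡ 0# → p₁ ≡ 0#
            p-component p₁ Q R e = *-cancel-0 a≢0 (begin
              a * p₁                       ≡⟨ solve 3 (λ p Q R → p := p :+ con (ℤ.pos 0) :* Q :+ con (ℤ.pos 0) :* R) refl (a * p₁) Q R ⟩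
              a * p₁ + 0# * Q + 0# * R     ≡⟨ cong₂ (λ b c → a * p₁ + b * Q + c * R) b≡0 c≡0 ⟨
              a * p₁ + b * Q + c * R       ≡⟨ e ⟩
              0#                           ∎)
          byCase (no c≢0) = E , Y≡X+Ep
            where
            c′≢0 = *-≢0# c≢0 t≢0
            u = proj₁ (leftInverse c′ c′≢0)
            uc′≡1 = proj₂ (proj₂ (leftInverse c′ c′≢0))
            E = - (u * a)
            Y≡X+Ep : Y ≡ X ⊹ (E · p)
            Y≡X+Ep = v4-≡ (component _ _ _ _ _ (cong x0 Q≡) (cong x0 R≡) (cong x0 v≡0))
              (component _ _ _ _ _ (cong x1 Q≡) (cong x1 R≡) (cong x1 v≡0))
              (component _ _ _ _ _ (cong x2 Q≡) (cong x2 R≡) (cong x2 v≡0))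
              (component _ _ _ _ _ (cong x3 Q≡) (cong x3 R≡) (cong x3 v≡0))
              where
              scalar : ∀ p₁ X Y → a * p₁ + b * (s * X) + c * (t * Y) ≡ 0# → Y ≡ X + E * p₁
              scalar p₁ X Y e = x-y≡0⇒x≡y (*-cancel-0 c′≢0 (begin
                c′ * (Y + - (X + - (u * a) * p₁))
                  ≡⟨ solve 9 (λ a b c s t u p X Y → c :* t :* (Y :+ :- (X :+ :- (u :* a) :* p)) :=
                       (a :* p :+ b :* (s :* X) :+ c :* (t :* Y)) :+ :- X :* (b :* s :+ c :* t) :+ a :* p :* (u :* (c :* t) :+ :- con (ℤ.pos 1)))
                       refl a b c s t u p₁ X Y ⟩
                (a * p₁ + b * (s * X) + c * (t * Y)) + - X * (b * s + c′) + a * p₁ * (u * c′ + - 1#)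
                  ≡⟨ cong₂ _+_ (cong₂ _+_ e (trans (cong (- X *_) bs+ct) (zeroʳ _))) (trans (cong (a * p₁ *_) (x≡y⇒x-y≡0 uc′≡1)) (zeroʳ _)) ⟩
                0# + 0# + 0#  ≡⟨ trans (+-identityʳ _) (+-identityʳ _) ⟩
                0#            ∎))
              component : ∀ p₁ X Y Q R → Q ≡ s * X → R ≡ t * Y → a * p₁ + b * Q + c * R ≡ 0# → Y ≡ X + E * p₁
              component p₁ X Y _ _ refl refl = scalar p₁ X Y
        fromC : ∀ a b → Σ Carrier (λ c → test a b c ≡ true) → Σ Carrier (λ E → Y ≡ X ⊹ (E · p))
        fromC a b (c , e) = dependent a b c (proj₁ nz,v≡0) (isZeroV⁻ (vector a b c) (proj₂ nz,v≡0))
          where nz,v≡0 = ∧-true⁻ {nonzero a b c} {isZeroV (vector a b c)} e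
        fromB : ∀ a → Σ Carrier (λ b → testB a b ≡ true) → Σ Carrier (λ E → Y ≡ X ⊹ (E · p))
        fromB a (b , e) = fromC a b (any-true⁻ (test a b) elements e)
        fromA : Σ Carrier (λ a → testA a ≡ true) → Σ Carrier (λ E → Y ≡ X ⊹ (E · p))
        fromA (a , e) = fromB a (any-true⁻ (testB a) elements e)

    -- Rewritten in `Q` and `R`, the equation Y = X + E p is a dependency with coefficients E, σ,
    -- -τ, the last of which is nonzero.
    common⇐ : Σ Carrier (λ E → Y ≡ X ⊹ (E · p)) → onCommonLine p Q R ≡ true
    common⇐ f = any-true⁺ testA (elements-complete E)
        (any-true⁺ (λ b → any (test E b) elements) (elements-complete σ)
          (any-true⁺ (test E σ) (elements-complete (- τ))
            (∧-true⁺ (cong not -τ-nonzero) (isZeroV⁺ (vector E σ (- τ)) (v4-≡ (scalar _ _ _ _ _ (cong x0 X≡) (cong x0 Y≡) (cong x0 Y≡X+Ep)) (scalar _ _ _ _ _ (cong x1 X≡) (cong x1 Y≡) (cong x1 Y≡X+Ep))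
              (scalar _ _ _ _ _ (cong x2 X≡) (cong x2 Y≡) (cong x2 Y≡X+Ep)) (scalar _ _ _ _ _ (cong x3 X≡) (cong x3 Y≡) (cong x3 Y≡X+Ep)))))))
        where
        E = proj₁ f
        Y≡X+Ep = proj₂ f
        -τ≢0 : - τ ≢ 0#
        -τ≢0 e = τ≢0 (trans (solve 1 (λ t → t := :- (:- t)) refl τ) (trans (cong -_ e) (solve 0 (:- con (ℤ.pos 0) := con (ℤ.pos 0)) refl)))
        -τ-nonzero : (E == 0#) ∧ (σ == 0#) ∧ (- τ == 0#) ≡ false
        -τ-nonzero = ∧-falseʳ (E == 0#) (∧-falseʳ (σ == 0#) (dec-false ((- τ) ≟ 0#) -τ≢0))
          where
          ∧-falseʳ : ∀ a {b} → b ≡ false → a ∧ b ≡ false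
          ∧-falseʳ true e = e
          ∧-falseʳ false _ = refl
        scalar : ∀ p₁ X Y Q R → X ≡ σ * Q → Y ≡ τ * R → Y ≡ X + E * p₁ → E * p₁ + σ * Q + - τ * R ≡ 0#
        scalar p₁ _ _ Q R refl refl e = begin
          E * p₁ + σ * Q + - τ * R          ≡⟨ solve 4 (λ e a t r → e :+ a :+ :- t :* r := (a :+ e) :+ :- (t :* r)) refl (E * p₁) (σ * Q) τ R ⟩
          σ * Q + E * p₁ + - (τ * R)        ≡⟨ x≡y⇒x-y≡0 (sym e) ⟩
          0#                                ∎

  -- Coordinates on 𝒳 relative to a base point, and the fibres of collinearity with P.

  module Configuration (p : V4) (p≢0 : p ≢ zeroV) (pp : h p p ≡ 0#) where
    open Hats p
    open ℚForm r using (dot; mm; md; dd; relationEntries) renaming (n to n₀; s to s₀)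

    size-X : ℕ
    size-X = Hermitian.N F q p

    private module Sum = Summation.Size size-X

    baseFrame : Frame p
    baseFrame = frame-exists p p≢0 pp

    basePoint : X
    basePoint = proj₁ (hat-complete (Frame.o baseFrame) (Frame.op baseFrame) (Frame.oo baseFrame))

    frame : X → Frame p
    frame x = Recentre.recentre pp baseFrame (hat x) (hat-p x) (hat-isotropic x)

    H : X → X → Carrier
    H x y = h (hat x) (hat y)

    -- With `H z x` these are the coordinates of `hat z` in the frame at `x`, at f, g and `p`
    -- respectively; the coordinate at `hat x` is always 1.
    α β : X → X → Carrier
    α x z = h (hat z) (Frame.g (frame x))
    β x z = h (hat z) (Frame.f (frame x))

    conj-H : ∀ x y → conj (H x y) ≡ H y x
    conj-H x y = conj-h (hat x) (hat y)

    -- For fixed x and y this is affine in the coordinates of `z`. It is what turns an entry of a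
    -- matrix product, a sum over `z`, into a sum over field elements.
    H-coordinates : ∀ x z y → H z y ≡ H z x + (H x y + (α x z * conj (β x y) + β x z * conj (α x y)))
    H-coordinates x z y = begin
      H z y
        ≡⟨ Frame.h-span (frame x) (hat z) (hat y) ⟩
      h (hat z) p * conj (H y x) + (α x z * conj (β x y) + (β x z * conj (α x y) + H z x * conj (h (hat y) p)))
        ≡⟨ cong₂ (λ u v → u + (α x z * conj (β x y) + (β x z * conj (α x y) + v)))
             (trans (cong₂ _*_ (hat-p z) (conj-H y x)) (*-identityˡ _))
             (trans (cong (H z x *_) (trans (cong conj (hat-p y)) conj-1)) (*-identityʳ _)) ⟩
      H x y + (α x z * conj (β x y) + (β x z * conj (α x y) + H z x))
        ≡⟨ solve 4 (λ a b c d → a :+ (b :+ (c :+ d)) := d :+ (a :+ (b :+ c))) refl (H x y) (α x z * conj (β x y)) (β x z * conj (α x y)) (H z x) ⟩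
      H z x + (H x y + (α x z * conj (β x y) + β x z * conj (α x y)))  ∎

    skew-sum⇒ : ∀ l a b → Skew (l + a * conj b) → l + (conj l + (a * conj b + b * conj a)) ≡ 0#
    skew-sum⇒ l a b s = begin
      l + (conj l + (a * conj b + b * conj a))      ≡⟨ solve 5 (λ l l′ a b′ t → l :+ (l′ :+ (a :* b′ :+ t)) := (l′ :+ t) :+ (l :+ a :* b′))
                                                       refl l (conj l) a (conj b) (b * conj a) ⟩
      (conj l + b * conj a) + (l + a * conj b)      ≡⟨ cong (_+ (l + a * conj b)) (conj-sum l a b) ⟨
      conj (l + a * conj b) + (l + a * conj b)      ≡⟨ cong (_+ (l + a * conj b)) s ⟩
      - (l + a * conj b) + (l + a * conj b)         ≡⟨ -‿inverseˡ _ ⟩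
      0#                                            ∎
      where
      conj-sum : ∀ l a b → conj (l + a * conj b) ≡ conj l + b * conj a
      conj-sum l a b = trans (conj-+ l (a * conj b)) (cong (conj l +_) (trans (conj-* a (conj b))
        (trans (cong (conj a *_) (conj-conj b)) (*-comm (conj a) b))))

    skew-sum⇐ : ∀ l a b → l + (conj l + (a * conj b + b * conj a)) ≡ 0# → Skew (l + a * conj b)
    skew-sum⇐ l a b e = begin
      conj (l + a * conj b)                         ≡⟨ trans (conj-+ l (a * conj b)) (cong (conj l +_) (trans (conj-* a (conj b)) (cong (conj a *_) (conj-conj b)))) ⟩
      conj l + conj a * b                           ≡⟨ solve 5 (λ l l′ a a′ t → l′ :+ a′ :* t := (l :+ (l′ :+ (a :+ t :* a′))) :+ :- (l :+ a))
                                                       refl l (conj l) (a * conj b) (conj a) b ⟩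
      l + (conj l + (a * conj b + b * conj a)) + - (l + a * conj b)  ≡⟨ cong (_+ - (l + a * conj b)) e ⟩
      0# + - (l + a * conj b)                       ≡⟨ +-identityˡ _ ⟩
      - (l + a * conj b)                            ∎

    -- Isotropy of `hat z`, expanded in coordinates, says that this element plus its conjugate is 0.
    coordinates-skew : ∀ x z → Skew (H z x + α x z * conj (β x z))
    coordinates-skew x z = skew-sum⇐ (H z x) (α x z) (β x z) (begin
      H z x + (conj (H z x) + (α x z * conj (β x z) + β x z * conj (α x z)))
        ≡⟨ cong (λ m → H z x + (m + (α x z * conj (β x z) + β x z * conj (α x z)))) (conj-H z x) ⟩
      H z x + (H x z + (α x z * conj (β x z) + β x z * conj (α x z)))  ≡⟨ H-coordinates x z z ⟨
      H z z  ≡⟨ hat-isotropic z ⟩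
      0#     ∎)

    hat-coordinates : ∀ x z → hat z ≡ Frame.combination (frame x) 1# (α x z) (β x z) (H z x)
    hat-coordinates x z = trans (Frame.span (frame x) (hat z))
      (cong (λ A → Frame.combination (frame x) A (α x z) (β x z) (H z x)) (hat-p z))

    coordinates-injective : ∀ x {z z′} → α x z ≡ α x z′ → β x z ≡ β x z′ → H z x ≡ H z′ x → z ≡ z′
    coordinates-injective x {z} {z′} eα eβ eλ = hat-injective (trans (hat-coordinates x z)
      (trans (trans (cong₂ (λ A B → Frame.combination (frame x) 1# A B (H z x)) eα eβ)
        (cong (Frame.combination (frame x) 1# (α x z′) (β x z′)) eλ)) (sym (hat-coordinates x z′))))

    -- The vector with these coordinates and leading coordinate 1 has product 1 with `p`, and the
    -- skewness makes it isotropic, so it is a hat.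
    coordinates-surjective : ∀ x a b l → Skew (l + a * conj b) →
      Σ X λ z → α x z ≡ a × β x z ≡ b × H z x ≡ l
    coordinates-surjective x a b l s = proj₁ complete ,
      trans (cong (λ w → h w (Frame.g (frame x))) (proj₂ complete)) C.z-g ,
      trans (cong (λ w → h w (Frame.f (frame x))) (proj₂ complete)) C.z-f ,
      trans (cong (λ w → h w (hat x)) (proj₂ complete)) C.z-o
      where
      v = Frame.combination (frame x) 1# a b l
      module C = Frame.Combination (frame x) pp 1# a b l
      vv : h v v ≡ 0#
      vv = begin
        h v v                                          ≡⟨ Frame.h-span (frame x) v v ⟩
        _                                              ≡⟨ cong₂ _+_ (cong₂ (λ A E → A * conj E) C.z-p C.z-o)
                                                          (cong₂ _+_ (cong₂ (λ A E → A * conj E) C.z-g C.z-f)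
                                                          (cong₂ _+_ (cong₂ (λ A E → A * conj E) C.z-f C.z-g)
                                                            (cong₂ (λ A E → A * conj E) C.z-o C.z-p))) ⟩
        1# * conj l + (a * conj b + (b * conj a + l * conj 1#))
          ≡⟨ cong₂ (λ u w → u + (a * conj b + (b * conj a + w))) (*-identityˡ _) (trans (cong (l *_) conj-1) (*-identityʳ l)) ⟩
        conj l + (a * conj b + (b * conj a + l))       ≡⟨ solve 4 (λ l′ s t l → l′ :+ (s :+ (t :+ l)) := l :+ (l′ :+ (s :+ t))) refl (conj l) (a * conj b) (b * conj a) l ⟩
        l + (conj l + (a * conj b + b * conj a))       ≡⟨ skew-sum⇒ l a b s ⟩
        0#                                             ∎
      complete = hat-complete v C.z-p vv

    S₃ : (Carrier → Carrier → Carrier → ℚ) → ℚ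
    S₃ f = S (λ a → S (λ b → S (λ l → f a b l)))

    S₃-cong : ∀ {f g} → (∀ a b l → f a b l ≡ g a b l) → S₃ f ≡ S₃ g
    S₃-cong e = S-cong (λ a → S-cong (λ b → S-cong (λ l → e a b l)))

    S₃-point : ∀ a₀ b₀ l₀ (G : Carrier → Carrier → Carrier → ℚ) →
      S₃ (λ a b l → [ a ≟ a₀ ] ⊠ ([ b ≟ b₀ ] ⊠ ([ l ≟ l₀ ] ⊠ G a b l))) ≡ G a₀ b₀ l₀
    S₃-point a₀ b₀ l₀ G = begin
      S₃ (λ a b l → [ a ≟ a₀ ] ⊠ ([ b ≟ b₀ ] ⊠ ([ l ≟ l₀ ] ⊠ G a b l)))
        ≡⟨ S-cong (λ a → trans (S-cong (λ b → trans (S-*ˡ [ a ≟ a₀ ] (λ l → [ b ≟ b₀ ] ⊠ ([ l ≟ l₀ ] ⊠ G a b l)))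
             (cong ([ a ≟ a₀ ] ⊠_) (trans (S-*ˡ [ b ≟ b₀ ] (λ l → [ l ≟ l₀ ] ⊠ G a b l))
               (cong ([ b ≟ b₀ ] ⊠_) (S-point l₀ (G a b)))))))
             (trans (S-*ˡ [ a ≟ a₀ ] (λ b → [ b ≟ b₀ ] ⊠ G a b l₀)) (cong ([ a ≟ a₀ ] ⊠_) (S-point b₀ (λ b → G a b l₀))))) ⟩
      S (λ a → [ a ≟ a₀ ] ⊠ G a b₀ l₀)   ≡⟨ S-point a₀ (λ a → G a b₀ l₀) ⟩
      G a₀ b₀ l₀                         ∎

    ∑-S-swap : ∀ (f : X → Carrier → ℚ) → ∑ (λ z → S (f z)) ≡ S (λ a → ∑ (λ z → f z a))
    ∑-S-swap f = Summation.∑-swap size-X size (λ z i → f z (point i))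

    -- Points of 𝒳 correspond bijectively to triples (a, b, l) with l + a conj b skew. The transfer
    -- inserts the indicator of the coordinates of `z` and exchanges the sums.
    ∑-coordinates : ∀ x (G : Carrier → Carrier → Carrier → ℚ) →
      ∑ (λ z → G (α x z) (β x z) (H z x)) ≡ S₃ (λ a b l → [ skew? (l + a * conj b) ] ⊠ G a b l)
    ∑-coordinates x G = begin
      ∑ (λ z → G (α x z) (β x z) (H z x))       ≡⟨ Summation.∑-cong (λ z → sym (S₃-point (α x z) (β x z) (H z x) G)) ⟩
      ∑ (λ z → S₃ (λ a b l → f z a b l))        ≡⟨ trans (∑-S-swap (λ z a → S (λ b → S (λ l → f z a b l))))
                                                   (S-cong (λ a → trans (∑-S-swap (λ z b → S (λ l → f z a b l)))
                                                     (S-cong (λ b → ∑-S-swap (λ z l → f z a b l))))) ⟩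
      S₃ (λ a b l → ∑ (λ z → f z a b l))        ≡⟨ S₃-cong (λ a b l → trans (Summation.∑-cong (λ z → regroup z a b l))
                                                   (trans (Sum.∑-*ʳ (G a b l) (λ z → [ at? z a b l ])) (cong (_⊠ G a b l) (count a b l)))) ⟩
      S₃ (λ a b l → [ skew? (l + a * conj b) ] ⊠ G a b l)  ∎
      where
      f : X → Carrier → Carrier → Carrier → ℚ
      f z a b l = [ a ≟ α x z ] ⊠ ([ b ≟ β x z ] ⊠ ([ l ≟ H z x ] ⊠ G a b l))
      at? : ∀ z a b l → Dec (a ≡ α x z × b ≡ β x z × l ≡ H z x)
      at? z a b l = (a ≟ α x z) ×-dec ((b ≟ β x z) ×-dec (l ≟ H z x))
      assoc : ∀ a b c d → a ⊠ (b ⊠ (c ⊠ d)) ≡ a ⊠ (b ⊠ c) ⊠ d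
      assoc = solve-∀ ℚ-ring
      regroup : ∀ z a b l → f z a b l ≡ [ at? z a b l ] ⊠ G a b l
      regroup z a b l = trans (assoc [ a ≟ α x z ] [ b ≟ β x z ] [ l ≟ H z x ] (G a b l))
        (cong (_⊠ G a b l) (trans (cong ([ a ≟ α x z ] ⊠_) ([]-× (b ≟ β x z) (l ≟ H z x))) ([]-× (a ≟ α x z) ((b ≟ β x z) ×-dec (l ≟ H z x)))))
      count : ∀ a b l → ∑ (λ z → [ at? z a b l ]) ≡ [ skew? (l + a * conj b) ]
      count a b l = bySkew (skew? (l + a * conj b))
        where
        bySkew : (s? : Dec (Skew (l + a * conj b))) → ∑ (λ z → [ at? z a b l ]) ≡ [ s? ]
        bySkew (yes s) = let (z₀ , eα , eβ , eλ) = coordinates-surjective x a b l s in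
          trans (Summation.∑-single (λ z → [ at? z a b l ]) z₀ (λ z z≢ → []-no (at? z a b l)
            (λ (a≡ , b≡ , l≡) → z≢ (coordinates-injective x (trans (sym a≡) (sym eα)) (trans (sym b≡) (sym eβ)) (trans (sym l≡) (sym eλ))))))
          ([]-yes (at? z₀ a b l) (sym eα , sym eβ , sym eλ))
        bySkew (no ¬s) = Summation.∑-zero (λ z → []-no (at? z a b l)
          (λ { (refl , refl , refl) → ¬s (coordinates-skew x z) }))

    Fibre : X → X → Set
    Fibre x y = α x y ≡ 0# × β x y ≡ 0#

    fibre? : ∀ x y → Dec (Fibre x y)
    fibre? x y = origin? (α x y) (β x y)

    infix 4 _∥_
    -- A form of `Fibre` without frames: the frame at `x` makes symmetry and transitivity opaque,
    -- whereas here they are negation and addition of E.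
    _∥_ : X → X → Set
    x ∥ y = Σ Carrier λ E → hat y ≡ hat x ⊹ (E · p)

    fibre⇒∥ : ∀ {x y} → Fibre x y → x ∥ y
    fibre⇒∥ {x} {y} (eα , eβ) = H y x , trans (hat-coordinates x y)
      (trans (cong₂ (λ a b → Frame.combination (frame x) 1# a b (H y x)) eα eβ)
        (v4-≡ (component _ _ _ _) (component _ _ _ _) (component _ _ _ _) (component _ _ _ _)))
      where
      component : ∀ o f g e → 1# * o + (0# * f + (0# * g + e)) ≡ o + e
      component o f g e = cong₂ _+_ (*-identityˡ o) (trans (cong₂ _+_ (zeroˡ f) (trans (cong (_+ e) (zeroˡ g)) (+-identityˡ e))) (+-identityˡ e))

    ∥⇒fibre : ∀ {x y} → x ∥ y → Fibre x y
    ∥⇒fibre {x} {y} (E , e) = orthogonal (Frame.g (frame x)) (Frame.go (frame x)) (Frame.gp (frame x)) ,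
                              orthogonal (Frame.f (frame x)) (Frame.fo (frame x)) (Frame.fp (frame x))
      where
      orthogonal : ∀ w → h w (hat x) ≡ 0# → h w p ≡ 0# → h (hat y) w ≡ 0#
      orthogonal w wx wp = begin
        h (hat y) w                ≡⟨ cong (λ v → h v w) e ⟩
        h (hat x ⊹ (E · p)) w      ≡⟨ trans (h-⊹ˡ (hat x) (E · p) w) (cong (h (hat x) w +_) (h-·ˡ E p w)) ⟩
        h (hat x) w + E * h p w    ≡⟨ cong₂ (λ u v → u + E * v) (h-sym-0 wx) (h-sym-0 wp) ⟩
        0# + E * 0#                ≡⟨ trans (+-identityˡ _) (zeroʳ E) ⟩
        0#                         ∎

    ∥-sym : ∀ {x y} → x ∥ y → y ∥ x
    ∥-sym {x} {y} (E , e) = - E , trans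
      (v4-≡ (component _ _) (component _ _) (component _ _) (component _ _)) (cong (_⊹ (- E · p)) (sym e))
      where
      component : ∀ a b → a ≡ (a + E * b) + - E * b
      component a b = solve 3 (λ a b E → a := (a :+ E :* b) :+ :- E :* b) refl a b E

    ∥-trans : ∀ {x y z} → x ∥ y → y ∥ z → x ∥ z
    ∥-trans {x} (E , e) (E′ , e′) = E + E′ , trans e′ (trans (cong (_⊹ (E′ · p)) e)
      (v4-≡ (component _ _) (component _ _) (component _ _) (component _ _)))
      where
      component : ∀ a b → (a + E * b) + E′ * b ≡ a + (E + E′) * b
      component a b = solve 4 (λ a b E E′ → (a :+ E :* b) :+ E′ :* b := a :+ (E :+ E′) :* b) refl a b E E′

    fibre-sym : ∀ {x y} → Fibre x y → Fibre y x
    fibre-sym = ∥⇒fibre ∘ ∥-sym ∘ fibre⇒∥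

    fibre-trans : ∀ {x y z} → Fibre x y → Fibre y z → Fibre x z
    fibre-trans f g = ∥⇒fibre (∥-trans (fibre⇒∥ f) (fibre⇒∥ g))

    skew-sum-cancel : ∀ {l s} → Skew (l + s) → Skew l → Skew s
    skew-sum-cancel {l} {s} ls sl = begin
      conj s                               ≡⟨ solve 2 (λ a b → b := :- a :+ (a :+ b)) refl (conj l) (conj s) ⟩
      - conj l + (conj l + conj s)         ≡⟨ cong₂ (λ a b → - a + b) sl (trans (sym (conj-+ l s)) ls) ⟩
      - - l + - (l + s)                    ≡⟨ solve 2 (λ l s → :- (:- l) :+ :- (l :+ s) := :- s) refl l s ⟩
      - s                                  ∎

    skew-H-sym : ∀ {x y} → Skew (H x y) → Skew (H y x)
    skew-H-sym {x} {y} s = begin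
      conj (H y x)     ≡⟨ cong conj (conj-H x y) ⟨
      conj (conj (H x y))  ≡⟨ cong conj s ⟩
      conj (- H x y)   ≡⟨ conj-neg _ ⟩
      - conj (H x y)   ≡⟨ cong -_ (conj-H x y) ⟩
      - H y x          ∎

    -- By `coordinates-skew` the sum of H(y,x) and α conj β is skew, so one summand is skew when the
    -- other is. This is how `L` enters `D M` and `D D`.
    skew-αβ : ∀ x y → [ skew? (α x y * conj (β x y)) ] ≡ [ skew? (H x y) ]
    skew-αβ x y = []-⇔ (skew? (α x y * conj (β x y))) (skew? (H x y))
      (λ s → skew-H-sym (skew-sum-cancel (subst Skew (+-comm (H y x) _) (coordinates-skew x y)) s))
      (λ s → skew-sum-cancel (coordinates-skew x y) (skew-H-sym s))

    fibre⇒skew : ∀ {x y} → Fibre x y → Skew (H x y)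
    fibre⇒skew {x} {y} (eα , _) = skew-H-sym (subst Skew
      (trans (cong (H y x +_) (trans (cong (_* conj (β x y)) eα) (zeroˡ _))) (+-identityʳ _)) (coordinates-skew x y))

    -- On a fibre H is skew, so a fixed value is 0; then all coordinates of `y` agree with those of
    -- `x`.
    fibre-unique : ∀ {x y} → Fibre x y → Fixed (H x y) → x ≡ y
    fibre-unique {x} {y} (eα , eβ) f = sym (coordinates-injective x
      (trans eα (sym (h-sym-0 (Frame.go (frame x))))) (trans eβ (sym (h-sym-0 (Frame.fo (frame x)))))
      (trans (h-sym-0 (fixed∧skew⇒0 f (fibre⇒skew (eα , eβ)))) (sym (hat-isotropic x))))

    fibre-refl : ∀ x → Fibre x x
    fibre-refl x = h-sym-0 (Frame.go (frame x)) , h-sym-0 (Frame.fo (frame x))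

    same⇒fibre : ∀ {x y} → x ≡ y → Fibre x y × Fixed (H x y)
    same⇒fibre {x} refl = fibre-refl x , subst Fixed (sym (hat-isotropic x)) conj-0

    -- The four matrices and the six counts.

    K M L D : Mat size-X
    K x y = [ fibre? x y ]
    M x y = [ fixed? (H x y) ]
    L x y = [ skew? (H x y) ]
    D x y = [ H x y ≟ 0# ]

    M-transposed : ∀ x z → M x z ≡ [ fixed? (H z x) ]
    M-transposed x z = []-⇔ (fixed? (H x z)) (fixed? (H z x))
      (λ f → trans (conj-H z x) (trans (sym f) (conj-H x z))) (λ f → trans (conj-H x z) (trans (sym f) (conj-H z x)))

    D-transposed : ∀ x z → D x z ≡ [ H z x ≟ 0# ]
    D-transposed x z = []-⇔ (H x z ≟ 0#) (H z x ≟ 0#) h-sym-0 h-sym-0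

    form : X → X → Carrier → Carrier → Carrier
    form x y a b = H x y + (a * conj (β x y) + b * conj (α x y))

    form-0 : ∀ x y → form x y 0# 0# ≡ H x y
    form-0 x y = trans (cong (H x y +_) (trans (cong₂ _+_ (zeroˡ _) (zeroˡ _)) (+-identityˡ 0#))) (+-identityʳ _)

    -- The fibre of `x` consists of the points with coordinates (0, 0, l), where l is an arbitrary
    -- skew element; in particular it has q points.
    ∑-fibre : ∀ x (g : Carrier → Carrier → Carrier → ℚ) →
      ∑ (λ z → K x z ⊠ g (α x z) (β x z) (H z x)) ≡ S (λ l → [ skew? l ] ⊠ g 0# 0# l)
    ∑-fibre x g = begin
      ∑ (λ z → K x z ⊠ g (α x z) (β x z) (H z x))     ≡⟨ ∑-coordinates x (λ a b l → [ origin? a b ] ⊠ g a b l) ⟩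
      S₃ (λ a b l → [ skew? (l + a * conj b) ] ⊠ ([ origin? a b ] ⊠ g a b l))
        ≡⟨ S-cong (λ a → trans (S-cong (λ b → trans (S-cong (λ l → regroup a b l))
             (trans (S-*ˡ [ a ≟ 0# ] (λ l → [ b ≟ 0# ] ⊠ ([ skew? (l + a * conj b) ] ⊠ g a b l)))
               (cong ([ a ≟ 0# ] ⊠_) (S-*ˡ [ b ≟ 0# ] (λ l → [ skew? (l + a * conj b) ] ⊠ g a b l))))))
             (trans (S-*ˡ [ a ≟ 0# ] (λ b → [ b ≟ 0# ] ⊠ S (λ l → [ skew? (l + a * conj b) ] ⊠ g a b l)))
               (cong ([ a ≟ 0# ] ⊠_) (S-point 0# (λ b → S (λ l → [ skew? (l + a * conj b) ] ⊠ g a b l)))))) ⟩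
      S (λ a → [ a ≟ 0# ] ⊠ S (λ l → [ skew? (l + a * conj 0#) ] ⊠ g a 0# l))
        ≡⟨ S-point 0# (λ a → S (λ l → [ skew? (l + a * conj 0#) ] ⊠ g a 0# l)) ⟩
      S (λ l → [ skew? (l + 0# * conj 0#) ] ⊠ g 0# 0# l)
        ≡⟨ S-cong (λ l → cong (λ m → [ skew? m ] ⊠ g 0# 0# l) (trans (cong (l +_) (zeroˡ _)) (+-identityʳ l))) ⟩
      S (λ l → [ skew? l ] ⊠ g 0# 0# l)  ∎
      where
      lem : ∀ s a b g → s ⊠ (a ⊠ b ⊠ g) ≡ a ⊠ (b ⊠ (s ⊠ g))
      lem = solve-∀ ℚ-ring
      regroup : ∀ a b l → [ skew? (l + a * conj b) ] ⊠ ([ origin? a b ] ⊠ g a b l) ≡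
                          [ a ≟ 0# ] ⊠ ([ b ≟ 0# ] ⊠ ([ skew? (l + a * conj b) ] ⊠ g a b l))
      regroup a b l = trans (cong (λ o → [ skew? (l + a * conj b) ] ⊠ (o ⊠ g a b l)) (sym ([]-× (a ≟ 0#) (b ≟ 0#))))
        (lem [ skew? (l + a * conj b) ] [ a ≟ 0# ] [ b ≟ 0# ] (g a b l))

    KK : ∀ x y → (K ·M K) x y ≡ r ⊠ K x y
    KK x y = begin
      ∑ (λ z → K x z ⊠ K z y)      ≡⟨ Summation.∑-cong (λ z → []-*-cong (fibre? x z) (λ xz →
                                      []-⇔ (fibre? z y) (fibre? x y) (fibre-trans xz) (fibre-trans (fibre-sym xz)))) ⟩
      ∑ (λ z → K x z ⊠ K x y)      ≡⟨ ∑-fibre x (λ _ _ _ → K x y) ⟩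
      S (λ l → [ skew? l ] ⊠ K x y)  ≡⟨ S-*ʳ (K x y) (λ l → [ skew? l ]) ⟩
      S (λ l → [ skew? l ]) ⊠ K x y  ≡⟨ cong (_⊠ K x y) S-skew ⟩
      r ⊠ K x y                    ∎

    -- Along the fibre of `x`, H(z,y) runs through l + H(x,y) with l skew. Exactly one such value is
    -- fixed, namely for l the negative of the skew part of H(x,y).
    KM : ∀ x y → (K ·M M) x y ≡ 1ℚ
    KM x y = begin
      ∑ (λ z → K x z ⊠ M z y)      ≡⟨ Summation.∑-cong (λ z → cong (λ w → K x z ⊠ [ fixed? w ]) (H-coordinates x z y)) ⟩
      ∑ (λ z → K x z ⊠ [ fixed? (H z x + form x y (α x z) (β x z)) ])  ≡⟨ ∑-fibre x (λ a b l → [ fixed? (l + form x y a b) ]) ⟩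
      S (λ l → [ skew? l ] ⊠ [ fixed? (l + form x y 0# 0#) ])
        ≡⟨ S-cong (λ l → trans (cong (λ w → [ skew? l ] ⊠ [ fixed? (l + w) ]) (form-0 x y)) ([]-× (skew? l) (fixed? (l + H x y)))) ⟩
      S (λ l → [ skew? l ×-dec fixed? (l + H x y) ])
        ≡⟨ S-unique (λ l → skew? l ×-dec fixed? (l + c)) (- (c + - realPart c)) unique
             (neg-skew (skewPart-skew c) , subst Fixed (solve 2 (λ c s → s := :- (c :+ :- s) :+ c) refl c (realPart c)) (realPart-fixed c)) ⟩
      1ℚ                           ∎
      where
      c = H x y
      neg-skew : ∀ {s} → Skew s → Skew (- s)
      neg-skew {s} e = trans (conj-neg s) (cong -_ e)
      unique : ∀ l → Skew l × Fixed (l + c) → l ≡ - (c + - realPart c)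
      unique l (s , f) = begin
        l                          ≡⟨ solve 2 (λ l c → l := :- (c :+ :- (l :+ c))) refl l c ⟩
        - (c + - (l + c))          ≡⟨ cong (λ w → - (c + - w)) (realPart-unique f
                                       (subst Skew (solve 2 (λ l c → :- l := c :+ :- (l :+ c)) refl l c) (neg-skew s))) ⟩
        - (c + - realPart c)       ∎

    -- The one value l = -H(x,y) that would give H(z,y) = 0 belongs to the fibre exactly when H(x,y)
    -- is skew.
    KD : ∀ x y → (K ·M D) x y ≡ L x y
    KD x y = begin
      ∑ (λ z → K x z ⊠ D z y)      ≡⟨ Summation.∑-cong (λ z → cong (λ w → K x z ⊠ [ w ≟ 0# ]) (H-coordinates x z y)) ⟩
      ∑ (λ z → K x z ⊠ [ (H z x + form x y (α x z) (β x z)) ≟ 0# ])  ≡⟨ ∑-fibre x (λ a b l → [ (l + form x y a b) ≟ 0# ]) ⟩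
      S (λ l → [ skew? l ] ⊠ [ (l + form x y 0# 0#) ≟ 0# ])
        ≡⟨ S-cong (λ l → trans (ℚₚ.*-comm [ skew? l ] [ (l + form x y 0# 0#) ≟ 0# ]) (cong (_⊠ [ skew? l ])
             ([]-⇔ ((l + form x y 0# 0#) ≟ 0#) (l ≟ (- c)) (to l) (from l)))) ⟩
      S (λ l → [ l ≟ (- c) ] ⊠ [ skew? l ])  ≡⟨ S-point (- c) (λ l → [ skew? l ]) ⟩
      [ skew? (- c) ]              ≡⟨ []-⇔ (skew? (- c)) (skew? c) neg-skew⁻ neg-skew ⟩
      L x y                        ∎
      where
      c = H x y
      neg-skew : ∀ {s} → Skew s → Skew (- s)
      neg-skew {s} e = trans (conj-neg s) (cong -_ e)
      neg-skew⁻ : ∀ {s} → Skew (- s) → Skew s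
      neg-skew⁻ {s} e = subst Skew (solve 1 (λ s → :- (:- s) := s) refl s) (neg-skew e)
      to : ∀ l → l + form x y 0# 0# ≡ 0# → l ≡ - c
      to l e = x-y≡0⇒x≡y (trans (cong (l +_) (trans (solve 1 (λ c → :- (:- c) := c) refl c) (sym (form-0 x y)))) e)
      from : ∀ l → l ≡ - c → l + form x y 0# 0# ≡ 0#
      from l refl = trans (cong (- c +_) (form-0 x y)) (-‿inverseˡ c)

    -- For every (a, b) exactly one fixed l makes l + a conj b skew, and by invariance this l does
    -- not affect `f`. So the sum over `z` becomes a free sum over (a, b).
    ∑-M : ∀ x y (f : Carrier → ℚ) → (∀ l w → Fixed l → f (l + w) ≡ f w) →
      ∑ (λ z → M x z ⊠ f (H z y)) ≡ S (λ a → S (λ b → f (form x y a b)))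
    ∑-M x y f invariant = begin
      ∑ (λ z → M x z ⊠ f (H z y))
        ≡⟨ Summation.∑-cong (λ z → trans (cong₂ (λ m w → m ⊠ f w) (M-transposed x z) (H-coordinates x z y))
             ([]-*-cong (fixed? (H z x)) (invariant (H z x) (form x y (α x z) (β x z))))) ⟩
      ∑ (λ z → [ fixed? (H z x) ] ⊠ f (form x y (α x z) (β x z)))
        ≡⟨ ∑-coordinates x (λ a b l → [ fixed? l ] ⊠ f (form x y a b)) ⟩
      S₃ (λ a b l → [ skew? (l + a * conj b) ] ⊠ ([ fixed? l ] ⊠ f (form x y a b)))
        ≡⟨ S-cong (λ a → S-cong (λ b → trans (S-cong (λ l → sym (ℚₚ.*-assoc [ skew? (l + a * conj b) ] [ fixed? l ] (f (form x y a b)))))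
             (trans (S-*ʳ (f (form x y a b)) (λ l → [ skew? (l + a * conj b) ] ⊠ [ fixed? l ]))
               (trans (cong (_⊠ f (form x y a b)) (one a b)) (ℚₚ.*-identityˡ (f (form x y a b))))))) ⟩
      S (λ a → S (λ b → f (form x y a b)))  ∎
      where
      one : ∀ a b → S (λ l → [ skew? (l + a * conj b) ] ⊠ [ fixed? l ]) ≡ 1ℚ
      one a b = trans (S-cong (λ l → []-× (skew? (l + c)) (fixed? l)))
        (S-unique (λ l → skew? (l + c) ×-dec fixed? l) (realPart (- c)) unique
          (skew , realPart-fixed (- c)))
        where
        c = a * conj b
        neg-skew : ∀ {s} → Skew s → Skew (- s)
        neg-skew {s} e = trans (conj-neg s) (cong -_ e)
        unique : ∀ l → Skew (l + c) × Fixed l → l ≡ realPart (- c)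
        unique l (s , f) = realPart-unique f (subst Skew (solve 2 (λ l c → :- (l :+ c) := :- c :+ :- l) refl l c) (neg-skew s))
        skew : Skew (realPart (- c) + c)
        skew = subst Skew (solve 2 (λ s c → :- (:- c :+ :- s) := s :+ c) refl (realPart (- c)) c) (neg-skew (skewPart-skew (- c)))

    -- Orthogonality to `x` sets l = 0, which leaves the pairs (a, b) with a conj b skew: the
    -- isotropic vectors of a hyperbolic line.
    ∑-D : ∀ x y (f : Carrier → ℚ) →
      ∑ (λ z → D x z ⊠ f (H z y)) ≡ S (λ a → S (λ b → [ skew? (a * conj b) ] ⊠ f (form x y a b)))
    ∑-D x y f = begin
      ∑ (λ z → D x z ⊠ f (H z y))
        ≡⟨ Summation.∑-cong (λ z → cong₂ (λ m w → m ⊠ f w) (D-transposed x z) (H-coordinates x z y)) ⟩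
      ∑ (λ z → [ H z x ≟ 0# ] ⊠ f (H z x + form x y (α x z) (β x z)))
        ≡⟨ ∑-coordinates x (λ a b l → [ l ≟ 0# ] ⊠ f (l + form x y a b)) ⟩
      S₃ (λ a b l → [ skew? (l + a * conj b) ] ⊠ ([ l ≟ 0# ] ⊠ f (l + form x y a b)))
        ≡⟨ S-cong (λ a → S-cong (λ b → trans
             (S-cong (λ l → swap [ skew? (l + a * conj b) ] [ l ≟ 0# ] (f (l + form x y a b))))
             (trans (S-point 0# (λ l → [ skew? (l + a * conj b) ] ⊠ f (l + form x y a b)))
               (cong₂ (λ u v → [ skew? u ] ⊠ f v) (+-identityˡ _) (+-identityˡ _))))) ⟩
      S (λ a → S (λ b → [ skew? (a * conj b) ] ⊠ f (form x y a b)))  ∎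
      where
      swap : ∀ a b c → a ⊠ (b ⊠ c) ≡ b ⊠ (a ⊠ c)
      swap = solve-∀ ℚ-ring

    fixed-shift : ∀ l w → Fixed l → [ fixed? (l + w) ] ≡ [ fixed? w ]
    fixed-shift l w f = []-⇔ (fixed? (l + w)) (fixed? w)
      (λ e → begin
        conj w                     ≡⟨ solve 2 (λ a b → b := :- a :+ (a :+ b)) refl (conj l) (conj w) ⟩
        - conj l + (conj l + conj w)  ≡⟨ cong₂ (λ a b → - a + b) f (trans (sym (conj-+ l w)) e) ⟩
        - l + (l + w)              ≡⟨ solve 2 (λ a b → :- a :+ (a :+ b) := b) refl l w ⟩
        w                          ∎)
      (λ e → trans (conj-+ l w) (cong₂ _+_ f e))

    -- This and the next three relations replace the products of indicators arising in `MM`, `DM`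
    -- and `DD` by single matrix entries, which makes the results linear in the six matrices.
    identity≡ : ∀ x y → idM x y ≡ K x y ⊠ M x y
    identity≡ x y = trans ([]-⇔ (x Fin.≟ y) (fibre? x y ×-dec fixed? (H x y))
      same⇒fibre (λ (k , m) → fibre-unique k m))
      (sym ([]-× (fibre? x y) (fixed? (H x y))))

    D≡ : ∀ x y → D x y ≡ M x y ⊠ L x y
    D≡ x y = trans ([]-⇔ (H x y ≟ 0#) (fixed? (H x y) ×-dec skew? (H x y))
      (λ e → subst Fixed (sym e) conj-0 , subst Skew (sym e) skew-0) (λ (f , s) → fixed∧skew⇒0 f s))
      (sym ([]-× (fixed? (H x y)) (skew? (H x y))))

    L-D : ∀ x y → L x y ⊠ D x y ≡ D x y
    L-D x y = trans ([]-× (skew? (H x y)) (H x y ≟ 0#)) ([]-⇔ (skew? (H x y) ×-dec (H x y ≟ 0#)) (H x y ≟ 0#)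
      proj₂ (λ e → subst Skew (sym e) skew-0 , e))

    K-D : ∀ x y → K x y ⊠ D x y ≡ K x y ⊠ M x y
    K-D x y = []-*-cong (fibre? x y) (λ k → []-⇔ (H x y ≟ 0#) (fixed? (H x y))
      (λ e → subst Fixed (sym e) conj-0) (λ f → fixed∧skew⇒0 f (fibre⇒skew k)))

    entries : X → X → Lin ℚ
    entries x y = ⟨ idM x y , K x y , 1ℚ , M x y , L x y , D x y ⟩

    MM : ∀ x y → (M ·M M) x y ≡ dot mm (entries x y)
    MM x y = begin
      ∑ (λ z → M x z ⊠ M z y)      ≡⟨ ∑-M x y (λ w → [ fixed? w ]) fixed-shift ⟩
      S (λ a → S (λ b → [ fixed? (form x y a b) ]))  ≡⟨ S-form (λ w → [ fixed? w ]) (α x y) (β x y) (H x y) ⟩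
      r ⊠ r ⊠ s ⊞ K x y ⊠ (r ⊠ r ⊠ (r ⊠ r ⊠ M x y ⊟ s))  ≡⟨ cong (λ s → r ⊠ r ⊠ s ⊞ K x y ⊠ (r ⊠ r ⊠ (r ⊠ r ⊠ M x y ⊟ s))) S-fixed ⟩
      r ⊠ r ⊠ r ⊞ K x y ⊠ (r ⊠ r ⊠ (r ⊠ r ⊠ M x y ⊟ r))  ≡⟨ lem r (K x y) (M x y) (L x y) (D x y) ⟩
      dot mm ⟨ K x y ⊠ M x y , K x y , 1ℚ , M x y , L x y , D x y ⟩
        ≡⟨ cong (λ i → dot mm ⟨ i , K x y , 1ℚ , M x y , L x y , D x y ⟩) (sym (identity≡ x y)) ⟩
      dot mm (entries x y)         ∎
      where
      s = S (λ w → [ fixed? w ])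
      lem : ∀ r k m l d → r ⊠ r ⊠ r ⊞ k ⊠ (r ⊠ r ⊠ (r ⊠ r ⊠ m ⊟ r)) ≡
        r ⊠ r ⊠ r ⊠ r ⊠ (k ⊠ m) ⊞ (Rat.- (r ⊠ r ⊠ r) ⊠ k ⊞ (r ⊠ r ⊠ r ⊠ 1ℚ ⊞ (0ℚ ⊠ m ⊞ (0ℚ ⊠ l ⊞ 0ℚ ⊠ d))))
      lem = solve-∀ ℚ-ring

    DM : ∀ x y → (D ·M M) x y ≡ dot md (entries x y)
    DM x y = begin
      ∑ (λ z → D x z ⊠ M z y)      ≡⟨ ∑-D x y (λ w → [ fixed? w ]) ⟩
      S (λ a → S (λ b → [ skew? (a * conj b) ] ⊠ [ fixed? (form x y a b) ]))
        ≡⟨ S-isotropic-form (λ w → [ fixed? w ]) (α x y) (β x y) (H x y) ⟩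
      s ⊞ r ⊠ s ⊟ r ⊠ M x y ⊞ ([ skew? (α x y * conj (β x y)) ] ⊞ r ⊠ K x y) ⊠ (r ⊠ r ⊠ M x y ⊟ s)
        ≡⟨ cong₂ (λ s l → s ⊞ r ⊠ s ⊟ r ⊠ M x y ⊞ (l ⊞ r ⊠ K x y) ⊠ (r ⊠ r ⊠ M x y ⊟ s)) S-fixed (skew-αβ x y) ⟩
      r ⊞ r ⊠ r ⊟ r ⊠ M x y ⊞ (L x y ⊞ r ⊠ K x y) ⊠ (r ⊠ r ⊠ M x y ⊟ r)  ≡⟨ lem r (K x y) (M x y) (L x y) ⟩
      dot md ⟨ K x y ⊠ M x y , K x y , 1ℚ , M x y , L x y , M x y ⊠ L x y ⟩
        ≡⟨ cong₂ (λ i d → dot md ⟨ i , K x y , 1ℚ , M x y , L x y , d ⟩) (sym (identity≡ x y)) (sym (D≡ x y)) ⟩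
      dot md (entries x y)         ∎
      where
      s = S (λ w → [ fixed? w ])
      lem : ∀ r k m l → r ⊞ r ⊠ r ⊟ r ⊠ m ⊞ (l ⊞ r ⊠ k) ⊠ (r ⊠ r ⊠ m ⊟ r) ≡
        r ⊠ r ⊠ r ⊠ (k ⊠ m) ⊞ (Rat.- (r ⊠ r) ⊠ k ⊞ ((r ⊠ r ⊞ r) ⊠ 1ℚ ⊞ (Rat.- r ⊠ m ⊞ (Rat.- r ⊠ l ⊞ r ⊠ r ⊠ (m ⊠ l)))))
      lem = solve-∀ ℚ-ring

    DD : ∀ x y → (D ·M D) x y ≡ dot dd (entries x y)
    DD x y = begin
      ∑ (λ z → D x z ⊠ D z y)      ≡⟨ ∑-D x y (λ w → [ w ≟ 0# ]) ⟩
      S (λ a → S (λ b → [ skew? (a * conj b) ] ⊠ [ form x y a b ≟ 0# ]))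
        ≡⟨ S-isotropic-form (λ w → [ w ≟ 0# ]) (α x y) (β x y) (H x y) ⟩
      s ⊞ r ⊠ s ⊟ r ⊠ D x y ⊞ ([ skew? (α x y * conj (β x y)) ] ⊞ r ⊠ K x y) ⊠ (r ⊠ r ⊠ D x y ⊟ s)
        ≡⟨ cong₂ (λ s l → s ⊞ r ⊠ s ⊟ r ⊠ D x y ⊞ (l ⊞ r ⊠ K x y) ⊠ (r ⊠ r ⊠ D x y ⊟ s)) S-zero (skew-αβ x y) ⟩
      1ℚ ⊞ r ⊠ 1ℚ ⊟ r ⊠ D x y ⊞ (L x y ⊞ r ⊠ K x y) ⊠ (r ⊠ r ⊠ D x y ⊟ 1ℚ)  ≡⟨ lem₁ r (K x y) (L x y) (D x y) ⟩
      1ℚ ⊞ r ⊟ r ⊠ D x y ⊞ r ⊠ r ⊠ (L x y ⊠ D x y) ⊟ L x y ⊞ r ⊠ r ⊠ r ⊠ (K x y ⊠ D x y) ⊟ r ⊠ K x y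
        ≡⟨ cong₂ (λ u v → 1ℚ ⊞ r ⊟ r ⊠ D x y ⊞ r ⊠ r ⊠ u ⊟ L x y ⊞ r ⊠ r ⊠ r ⊠ v ⊟ r ⊠ K x y) (L-D x y)
             (trans (K-D x y) (sym (identity≡ x y))) ⟩
      1ℚ ⊞ r ⊟ r ⊠ D x y ⊞ r ⊠ r ⊠ D x y ⊟ L x y ⊞ r ⊠ r ⊠ r ⊠ idM x y ⊟ r ⊠ K x y  ≡⟨ lem₂ r (idM x y) (K x y) (M x y) (L x y) (D x y) ⟩
      dot dd (entries x y)         ∎
      where
      s = S (λ w → [ w ≟ 0# ])
      lem₁ : ∀ r k l d → 1ℚ ⊞ r ⊠ 1ℚ ⊟ r ⊠ d ⊞ (l ⊞ r ⊠ k) ⊠ (r ⊠ r ⊠ d ⊟ 1ℚ) ≡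
        1ℚ ⊞ r ⊟ r ⊠ d ⊞ r ⊠ r ⊠ (l ⊠ d) ⊟ l ⊞ r ⊠ r ⊠ r ⊠ (k ⊠ d) ⊟ r ⊠ k
      lem₁ = solve-∀ ℚ-ring
      lem₂ : ∀ r i k m l d → 1ℚ ⊞ r ⊟ r ⊠ d ⊞ r ⊠ r ⊠ d ⊟ l ⊞ r ⊠ r ⊠ r ⊠ i ⊟ r ⊠ k ≡
        r ⊠ r ⊠ r ⊠ i ⊞ (Rat.- r ⊠ k ⊞ ((r ⊞ 1ℚ) ⊠ 1ℚ ⊞ (0ℚ ⊠ m ⊞ (Rat.- 1ℚ ⊠ l ⊞ (r ⊠ r ⊟ r) ⊠ d))))
      lem₂ = solve-∀ ℚ-ring

    -- Identification of the relations, and the conclusion.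

    m l k : X → X → Bool
    m x y = does (fixed? (H x y))
    l x y = does (skew? (H x y))
    k x y = does (fibre? x y)

    cls : X → X → Fin 6
    cls x y = classify (m x y) (l x y) (k x y)

    -- Points on a line with P have skew H, so for distinct points R_2 lies inside the condition z =
    -- t; `k` is what separates it from R_3.
    k⇒l : ∀ x y → k x y ≡ true → l x y ≡ true
    k⇒l x y e = dec-true (skew? (H x y)) (fibre⇒skew (does-true⁻ (fibre? x y) e))

    cls-sym : ∀ x y → cls x y ≡ cls y x
    cls-sym x y = trans (cong₂ (λ m l → classify m l (k x y))
        (does-⇔ (mk⇔ fixed-sym fixed-sym) (fixed? (H x y)) (fixed? (H y x)))
        (does-⇔ (mk⇔ skew-H-sym skew-H-sym) (skew? (H x y)) (skew? (H y x))))
      (cong (classify (m y x) (l y x)) (does-⇔ (mk⇔ fibre-sym fibre-sym) (fibre? x y) (fibre? y x)))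
      where
      fixed-sym : ∀ {x y} → Fixed (H x y) → Fixed (H y x)
      fixed-sym {x} {y} f = trans (conj-H y x) (trans (sym f) (conj-H x y))

    module _ (x y : X) where
      private
        n = conj (scale x) * scale x * (conj (scale y) * scale y)

        n-fixed : Fixed n
        n-fixed = trans (conj-* _ _) (cong₂ _*_ (norm-fixed (scale x)) (norm-fixed (scale y)))
          where
          norm-fixed : ∀ s → Fixed (conj s * s)
          norm-fixed s = trans (conj-* (conj s) s) (trans (cong (_* conj s) (conj-conj s)) (*-comm s (conj s)))

        n≢0 : n ≢ 0#
        n≢0 = *-≢0# (*-≢0# (conj-≢0 (scale≢0 x)) (scale≢0 x)) (*-≢0# (conj-≢0 (scale≢0 y)) (scale≢0 y))

      w : Carrier
      w = zval p (pt p x) (pt p y)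

      -- Each of the two scale factors occurs once plain and once conjugated, so together they
      -- contribute a product of two norms.
      zval-H : w ≡ n * H x y
      zval-H = begin
        h p (pt p x) * h (pt p x) (pt p y) * h (pt p y) p
          ≡⟨ cong₂ (λ a b → a * b * scale y) (sym (conj-h (pt p x) p))
               (trans (cong₂ h (pt-hat x) (pt-hat y)) (trans (h-·ˡ (scale x) (hat x) _) (cong (scale x *_) (h-·ʳ (scale y) (hat x) (hat y))))) ⟩
        conj (scale x) * (scale x * (conj (scale y) * H x y)) * scale y
          ≡⟨ solve 5 (λ s′ s t′ t h → s′ :* (s :* (t′ :* h)) :* t := s′ :* s :* (t′ :* t) :* h) refl
               (conj (scale x)) (scale x) (conj (scale y)) (scale y) (H x y) ⟩
        n * H x y  ∎

      same≡ : does (x Fin.≟ y) ≡ k x y ∧ m x y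
      same≡ = does-⇔ (mk⇔ same⇒fibre (λ (f , e) → fibre-unique f e))
        (x Fin.≟ y) (fibre? x y ×-dec fixed? (H x y))

      common≡ : onCommonLine p (pt p x) (pt p y) ≡ k x y
      common≡ = ≡-does (fibre? x y)
        (λ e → ∥⇒fibre (CommonLine.common⇒ p (pt p x) (pt p y) (hat x) (hat y) (scale x) (scale y)
          (pt-hat x) (pt-hat y) (scale⁻¹ x) (scale⁻¹ y) refl refl refl refl (scale≢0 x) (scale≢0 y) (scale⁻¹≢0 y) p≢0 pp e))
        (λ f → CommonLine.common⇐ p (pt p x) (pt p y) (hat x) (hat y) (scale x) (scale y)
          (pt-hat x) (pt-hat y) (scale⁻¹ x) (scale⁻¹ y) refl refl refl refl (scale≢0 x) (scale≢0 y) (scale⁻¹≢0 y) p≢0 pp (fibre⇒∥ f))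

      rel-cls : ∀ j → Rel p j x y ≡ does (j Fin.≟ cls x y)
      rel-cls j = trans (unfold j) (trans
        (cong-booleans same≡ (Cosets.orthogonal≡ n (H x y) w n-fixed n≢0 zval-H) common≡
          (Cosets.isE≡ n (H x y) w n-fixed n≢0 zval-H) (Cosets.isT≡ n (H x y) w n-fixed n≢0 zval-H))
        (relationBool-classify (m x y) (l x y) (k x y) (k⇒l x y) j))
        where
        unfold : ∀ j → Rel p j x y ≡ relationBool (does (x Fin.≟ y)) (w == 0#) (onCommonLine p (pt p x) (pt p y)) (isE w) (isT w) j
        unfold = by-six refl refl refl refl refl refl
        cong-booleans : ∀ {a a′ b b′ c c′ d d′ e e′} → a ≡ a′ → b ≡ b′ → c ≡ c′ → d ≡ d′ → e ≡ e′ →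
          relationBool a b c d e j ≡ relationBool a′ b′ c′ d′ e′ j
        cong-booleans refl refl refl refl refl = refl

    cls-entries : ∀ x y → entries x y ≡ relationEntries (cls x y)
    cls-entries x y = trans (cong₂ (λ i d → ⟨ i , K x y , 1ℚ , M x y , L x y , d ⟩)
        (cong (λ b → if b then 1ℚ else 0ℚ) (same≡ x y))
        (cong (λ b → if b then 1ℚ else 0ℚ) (does-⇔ (mk⇔ (λ e → subst Fixed (sym e) conj-0 , subst Skew (sym e) skew-0)
          (λ (f , s) → fixed∧skew⇒0 f s)) (H x y ≟ 0#) (fixed? (H x y) ×-dec skew? (H x y)))))
      (classify-entries r (m x y) (l x y) (k x y) (k⇒l x y))

    r≢0 : r ≢ 0ℚ
    r≢0 e = 1+m≢0 (trans (sym q≡) (ι-injective e))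
      where
      1+m≢0 : ∀ {m} → suc m ≢ 0
      1+m≢0 ()

    r-1≢0 : r Rat.- 1ℚ ≢ 0ℚ
    r-1≢0 e = primePower-≢1 q-pp (ι-injective (trans (lem r) (trans (cong (Rat._+ 1ℚ) e) (ℚₚ.+-identityˡ 1ℚ))))
      where
      lem : ∀ a → a ≡ a Rat.- 1ℚ Rat.+ 1ℚ
      lem = solve-∀ ℚ-ring

    r+1≢0 : s₀ ≢ 0ℚ
    r+1≢0 e = 1+m≢0 (trans (ℕₚ.+-comm 1 q) (ι-injective {q ℕ.+ 1} {0} (trans (ι-+ (ℤ.pos q) (ℤ.pos 1)) e)))
      where
      1+m≢0 : ∀ {m} → suc m ≢ 0
      1+m≢0 ()

    n⁻¹ : Σ ℚ λ b → b Rat.* n₀ ≡ 1ℚ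
    n⁻¹ = inverse-ℚ n₀ (CharacterIdentities.n≢0 r r≢0 r-1≢0 r+1≢0)

    K-trans : ∀ x y z → K x y ≡ 1ℚ → K y z ≡ 1ℚ → K x z ≡ 1ℚ
    K-trans x y z xy yz = []-yes (fibre? x z) (fibre-trans (fibre-of x y xy) (fibre-of y z yz))
      where
      fibre-of : ∀ x y → K x y ≡ 1ℚ → Fibre x y
      fibre-of x y e = does-true⁻ (fibre? x y) (indicator≢0 (does (fibre? x y)) (λ k≡0 → 0≢1ℚ (trans (sym k≡0) e)))

    conclusion : SchemeConclusion q size-X (Hermitian.Rel F q p)
    conclusion = SchemeFromProducts.Conclusion.conclusion q size-X r refl (Hermitian.Rel F q p) cls K M L D
      (λ j x y → rel-cls x y j) cls-sym cls-entries basePoint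
      (proj₁ n⁻¹) (proj₂ n⁻¹) r≢0 r-1≢0 r+1≢0 KK KM KD MM DM DD K-trans

open import Data.Nat using (_*_; _%_)

theorem4p8 : (q : ℕ) → IsPrimePower q → q % 2 ≡ 1 →
    (F : FiniteField) → FiniteField.size F ≡ q * q →
    (p : Hermitian.V4 F q) → p ≢ Hermitian.zeroV F q →
    Hermitian.h F q p p ≡ FiniteField.0# F →
    SchemeEigenConclusion F q p
theorem4p8 q q-pp q-odd F size≡ p p≢0 pp = HermitianGeometry.Configuration.conclusion F q q-pp q-odd size≡ p p≢0 pp
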